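{- Let $m\ge 4$ be an integer and let $\mathcal{U}=\{S_0, S_{2,1^0}, S_{2,1^1},\ldots,S_{2,1^{m-1}}\}$. Let $$Q=\left\{\mathbf{y}=(y_0,\ldots,y_m)\in\mathbb{R}^{m+1} \;\middle|\; \begin{array}{l} -y_1+y_2\ge 0,\\ 4y_1-3y_2\ge 0,\\ 3y_1-3y_3+y_4\ge 0,\\ y_1+2y_{m-1}-2y_m\ge 0,\\ y_0+y_{m-1}-y_m\ge 0,\\ y_0-2y_1+y_3\ge 0,\\ y_{i-1}-2y_i+y_{i+1}\ge 0 \quad\text{for all } 2\le i\le m-1,\\ m\,y_{m-1}-(m-1)\,y_m\ge 0 \end{array}\right\}.$$ Then $\operatorname{trop}(\mathcal{N}_{\mathcal{U}})=Q$.
   Context: All graphs are finite. For graphs $H,G$, $\hom(H;G)$ is the number of maps $V(H)\to V(G)$ sending every edge of $H$ to an edge of $G$. $S_0$ is the graph with a single vertex and no edges. For $k\ge 0$, $S_{2,1^k}$ is the tree with vertex set $\{1,\ldots,k+3\}$ and edge set $\{\{1,j\}: 2\le j\le k+2\}\cup\{\{k+2,k+3\}\}$ (a star with $k+1$ branches, one of which is lengthened to two edges). For a collection $\mathcal{U}=\{H_1,\ldots,H_s\}$ of connected graphs, the number graph profile $\mathcal{N}_{\mathcal{U}}\subseteq\mathbb{N}^s$ is the set of all vectors $(\hom(H_1;G),\ldots,\hom(H_s;G))$ as $G$ ranges over all graphs. For $\mathcal{S}\subseteq\mathbb{R}^s_{\ge 0}$, let $\log(\mathcal{S})=\{(\log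 v_1,\ldots,\log v_s): \mathbf{v}\in \mathcal{S}\cap\mathbb{R}^s_{>0}\}$, and the tropicalization (logarithmic limit set) is $\operatorname{trop}(\mathcal{S})=\lim_{\tau\to\infty}\log_\tau(\mathcal{S})$; for $\mathcal{N}_{\mathcal{U}}$ this equals the closure of the conical hull of $\log(\mathcal{N}_{\mathcal{U}})$. Coordinates are ordered so that $y_0$ corresponds to $S_0$ and $y_i$ corresponds to $S_{2,1^{i-1}}$ for $1\le i\le m$. -}

module Defs where

open import Level using (Level; 0ℓ; _⊔_) renaming (suc to lsuc)
open import Data.Nat.Base as ℕ using (ℕ; zero; suc; _∸_)
import Data.Nat.Properties as ℕ
open import Data.Integer.Base using (+_)
open import Data.Fin.Base using (Fin; zero; suc; toℕ; fromℕ<; finToFun)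
open import Data.Fin.Properties using (all?)
open import Data.List.Base using (length; filter; allFin)
open import Data.Rational as ℚ using (ℚ; 0ℚ; 1ℚ; ½)
import Data.Rational.Properties as ℚ
open import Data.Rational.Solver using (module +-*-Solver)
open import Data.Product.Base using (∃; _×_; _,_)
open import Data.Sum.Base using (_⊎_; inj₁; inj₂; swap)
open import Data.Empty using (⊥)
open import Relation.Nullary using (Dec; yes; no; ¬_)
open import Relation.Nullary.Decidable using (_→-dec_; _×-dec_; _⊎-dec_)
open import Relation.Unary using (Pred; _∈_; _⊆_)
open import Relation.Binary.Core using (Rel)
open import Relation.Binary.Definitions using (Symmetric; Irreflexive; Decidable)
open import Relation.Binary.PropositionalEquality
  using (_≡_; refl; sym; trans; cong; cong₂; subst; subst₂)

-- Real numbers are Cauchy sequences of rationals, equality of reals being _≃_.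

IsCauchy : (ℕ → ℚ) → Set
IsCauchy s = ∀ (ε : ℚ) → 0ℚ ℚ.< ε →
  ∃ λ N → ∀ m n → N ℕ.≤ m → N ℕ.≤ n → ℚ.∣ s m ℚ.- s n ∣ ℚ.< ε

record ℝ : Set where
  constructor mkℝ
  field
    seq    : ℕ → ℚ
    cauchy : IsCauchy seq
open ℝ public

private
  open +-*-Solver

  0<½* : ∀ {ε} → 0ℚ ℚ.< ε → 0ℚ ℚ.< ½ ℚ.* ε
  0<½* {ε} 0<ε =
    subst (ℚ._< ½ ℚ.* ε) (ℚ.*-zeroʳ ½) (ℚ.*-monoʳ-<-pos ½ 0<ε)

  halves : ∀ ε → ½ ℚ.* ε ℚ.+ ½ ℚ.* ε ≡ ε
  halves ε = trans (sym (ℚ.*-distribʳ-+ ε ½ ½)) (ℚ.*-identityˡ ε)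

  ≤-+∣∣ : ∀ a b → ℚ.∣ a ∣ ℚ.≤ ℚ.∣ b ∣ ℚ.+ ℚ.∣ a ℚ.- b ∣
  ≤-+∣∣ a b = subst (λ t → ℚ.∣ t ∣ ℚ.≤ ℚ.∣ b ∣ ℚ.+ ℚ.∣ a ℚ.- b ∣)
    (solve 2 (λ a b → b :+ (a :- b) := a) refl a b)
    (ℚ.∣p+q∣≤∣p∣+∣q∣ b (a ℚ.- b))

  ∣-∣-comm : ∀ a b → ℚ.∣ a ℚ.- b ∣ ≡ ℚ.∣ b ℚ.- a ∣
  ∣-∣-comm a b = trans
    (cong ℚ.∣_∣ (solve 2 (λ a b → a :- b := :- (b :- a)) refl a b))
    (ℚ.∣-p∣≡∣p∣ (b ℚ.- a))

  ≤+⇒-≤ : ∀ a b c → a ℚ.≤ b ℚ.+ c → a ℚ.- b ℚ.≤ c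
  ≤+⇒-≤ a b c p = subst (a ℚ.- b ℚ.≤_)
    (solve 2 (λ b c → (b :+ c) :- b := c) refl b c)
    (ℚ.+-monoˡ-≤ (ℚ.- b) p)

  ∣∣-∣∣≤ : ∀ a b → ℚ.∣ ℚ.∣ a ∣ ℚ.- ℚ.∣ b ∣ ∣ ℚ.≤ ℚ.∣ a ℚ.- b ∣
  ∣∣-∣∣≤ a b with ℚ.∣p∣≡p∨∣p∣≡-p (ℚ.∣ a ∣ ℚ.- ℚ.∣ b ∣)
  ... | inj₁ e rewrite e = ≤+⇒-≤ ℚ.∣ a ∣ ℚ.∣ b ∣ _ (≤-+∣∣ a b)
  ... | inj₂ e rewrite e = subst₂ ℚ._≤_
    (solve 2 (λ p q → q :- p := :- (p :- q)) refl ℚ.∣ a ∣ ℚ.∣ b ∣)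
    (∣-∣-comm b a)
    (≤+⇒-≤ ℚ.∣ b ∣ ℚ.∣ a ∣ _ (≤-+∣∣ b a))

  +-cauchy : ∀ s t → IsCauchy s → IsCauchy t → IsCauchy (λ n → s n ℚ.+ t n)
  +-cauchy s t cs ct ε 0<ε with cs (½ ℚ.* ε) (0<½* 0<ε) | ct (½ ℚ.* ε) (0<½* 0<ε)
  ... | M , p | N , q = M ℕ.⊔ N , λ m n m≥ n≥ → let open ℚ.≤-Reasoning in begin-strict
    ℚ.∣ (s m ℚ.+ t m) ℚ.- (s n ℚ.+ t n) ∣
      ≡⟨ cong ℚ.∣_∣ (solve 4 (λ a b c d → (a :+ b) :- (c :+ d) := (a :- c) :+ (b :- d))
           refl (s m) (t m) (s n) (t n)) ⟩
    ℚ.∣ (s m ℚ.- s n) ℚ.+ (t m ℚ.- t n) ∣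
      ≤⟨ ℚ.∣p+q∣≤∣p∣+∣q∣ (s m ℚ.- s n) (t m ℚ.- t n) ⟩
    ℚ.∣ s m ℚ.- s n ∣ ℚ.+ ℚ.∣ t m ℚ.- t n ∣
      <⟨ ℚ.+-mono-< (p m n (ℕ.m⊔n≤o⇒m≤o M N m≥) (ℕ.m⊔n≤o⇒m≤o M N n≥))
                    (q m n (ℕ.m⊔n≤o⇒n≤o M N m≥) (ℕ.m⊔n≤o⇒n≤o M N n≥)) ⟩
    ½ ℚ.* ε ℚ.+ ½ ℚ.* ε
      ≡⟨ halves ε ⟩
    ε ∎

  neg-cauchy : ∀ s → IsCauchy s → IsCauchy (λ n → ℚ.- s n)
  neg-cauchy s cs ε 0<ε with cs ε 0<ε
  ... | N , p = N , λ m n m≥ n≥ → subst (ℚ._< ε)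
    (trans (∣-∣-comm (s m) (s n))
      (cong ℚ.∣_∣ (solve 2 (λ a b → b :- a := (:- a) :- (:- b)) refl (s m) (s n))))
    (p m n m≥ n≥)

  abs-cauchy : ∀ s → IsCauchy s → IsCauchy (λ n → ℚ.∣ s n ∣)
  abs-cauchy s cs ε 0<ε with cs ε 0<ε
  ... | N , p = N , λ m n m≥ n≥ → ℚ.≤-<-trans (∣∣-∣∣≤ (s m) (s n)) (p m n m≥ n≥)

  bounded : ∀ s → IsCauchy s →
    ∃ λ B → ∃ λ N → ℚ.Positive B × (∀ n → N ℕ.≤ n → ℚ.∣ s n ∣ ℚ.≤ B)
  bounded s cs with cs 1ℚ (ℚ.positive⁻¹ 1ℚ)
  ... | N , p = B , N , B>0 , λ n n≥ → ℚ.≤-trans (≤-+∣∣ (s n) (s N))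
      (ℚ.+-monoʳ-≤ ℚ.∣ s N ∣ (ℚ.<⇒≤ (p n N n≥ ℕ.≤-refl)))
    where
    B : ℚ
    B = ℚ.∣ s N ∣ ℚ.+ 1ℚ
    B>0 : ℚ.Positive B
    B>0 = ℚ.nonNeg+pos⇒pos ℚ.∣ s N ∣ {{ℚ.∣-∣-nonNeg (s N)}} 1ℚ

  -- every positive ε is B * δ with δ positive
  quot : ∀ B → ℚ.Positive B → ∀ ε → 0ℚ ℚ.< ε → ∃ λ δ → 0ℚ ℚ.< δ × B ℚ.* δ ≡ ε
  quot B B>0 ε 0<ε = B⁻¹ ℚ.* ε
    , subst (ℚ._< B⁻¹ ℚ.* ε) (ℚ.*-zeroʳ B⁻¹) (ℚ.*-monoʳ-<-pos B⁻¹ {{ℚ.1/pos⇒pos B {{B>0}}}} 0<ε)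
    , trans (sym (ℚ.*-assoc B B⁻¹ ε))
        (trans (cong (ℚ._* ε) (ℚ.*-inverseʳ B {{B≢0}})) (ℚ.*-identityˡ ε))
    where
    B≢0 : ℚ.NonZero B
    B≢0 = ℚ.pos⇒nonZero B {{B>0}}
    B⁻¹ : ℚ
    B⁻¹ = ℚ.1/_ B {{B≢0}}

  *-diff : ∀ a b c d → a ℚ.* b ℚ.- c ℚ.* d ≡ a ℚ.* (b ℚ.- d) ℚ.+ d ℚ.* (a ℚ.- c)
  *-diff = solve 4 (λ a b c d → a :* b :- c :* d := a :* (b :- d) :+ d :* (a :- c)) refl

  ∣*∣< : ∀ a b {B δ} → ℚ.Positive B → ℚ.∣ a ∣ ℚ.≤ B → ℚ.∣ b ∣ ℚ.< δ →
    ℚ.∣ a ℚ.* b ∣ ℚ.< B ℚ.* δ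
  ∣*∣< a b {B} {δ} B>0 p q = subst (ℚ._< B ℚ.* δ) (sym (ℚ.∣p*q∣≡∣p∣*∣q∣ a b))
    (ℚ.≤-<-trans (ℚ.*-monoʳ-≤-nonNeg ℚ.∣ b ∣ {{ℚ.∣-∣-nonNeg b}} p)
      (ℚ.*-monoʳ-<-pos B {{B>0}} q))

  *-diff-bound : ∀ a b c d {B C δ η} → ℚ.Positive B → ℚ.Positive C →
    ℚ.∣ a ∣ ℚ.≤ B → ℚ.∣ d ∣ ℚ.≤ C → ℚ.∣ b ℚ.- d ∣ ℚ.< δ → ℚ.∣ a ℚ.- c ∣ ℚ.< η →
    ℚ.∣ a ℚ.* b ℚ.- c ℚ.* d ∣ ℚ.< B ℚ.* δ ℚ.+ C ℚ.* η
  *-diff-bound a b c d B>0 C>0 a≤B d≤C b-d a-c =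
    subst (ℚ._< _) (cong ℚ.∣_∣ (sym (*-diff a b c d)))
      (ℚ.≤-<-trans (ℚ.∣p+q∣≤∣p∣+∣q∣ (a ℚ.* (b ℚ.- d)) (d ℚ.* (a ℚ.- c)))
        (ℚ.+-mono-< (∣*∣< a (b ℚ.- d) B>0 a≤B b-d) (∣*∣< d (a ℚ.- c) C>0 d≤C a-c)))

  *-cauchy : ∀ s t → IsCauchy s → IsCauchy t → IsCauchy (λ n → s n ℚ.* t n)
  *-cauchy s t cs ct ε 0<ε =
    let B , K , B>0 , bs = bounded s cs
        C , L , C>0 , bt = bounded t ct
        δ , 0<δ , Bδ = quot B B>0 (½ ℚ.* ε) (0<½* 0<ε)
        η , 0<η , Cη = quot C C>0 (½ ℚ.* ε) (0<½* 0<ε)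
        M , p = ct δ 0<δ
        N , q = cs η 0<η
        KL = K ℕ.⊔ L
        MN = M ℕ.⊔ N
    in KL ℕ.⊔ MN , λ m n m≥ n≥ →
      let m≥MN = ℕ.m⊔n≤o⇒n≤o KL MN m≥
          n≥MN = ℕ.m⊔n≤o⇒n≤o KL MN n≥
      in subst (ℚ.∣ s m ℚ.* t m ℚ.- s n ℚ.* t n ∣ ℚ.<_)
        (trans (cong₂ ℚ._+_ Bδ Cη) (halves ε))
        (*-diff-bound (s m) (t m) (s n) (t n) B>0 C>0
          (bs m (ℕ.m⊔n≤o⇒m≤o K L (ℕ.m⊔n≤o⇒m≤o KL MN m≥)))
          (bt n (ℕ.m⊔n≤o⇒n≤o K L (ℕ.m⊔n≤o⇒m≤o KL MN n≥)))
          (p m n (ℕ.m⊔n≤o⇒m≤o M N m≥MN) (ℕ.m⊔n≤o⇒m≤o M N n≥MN))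
          (q m n (ℕ.m⊔n≤o⇒n≤o M N m≥MN) (ℕ.m⊔n≤o⇒n≤o M N n≥MN)))

infix  4 _<_ _≤_ _≃_
infixl 6 _+_ _-_
infixl 7 _*_ _·_
infix  8 -_
infixr 8 _^_

fromℚ : ℚ → ℝ
fromℚ q = mkℝ (λ _ → q) λ ε 0<ε → 0 , λ _ _ _ _ →
  subst (ℚ._< ε) (sym (cong ℚ.∣_∣ (ℚ.+-inverseʳ q))) 0<ε

fromℕ : ℕ → ℝ
fromℕ n = fromℚ (+ n ℚ./ 1)

0ℝ 1ℝ : ℝ
0ℝ = fromℚ 0ℚ
1ℝ = fromℚ 1ℚ

_+_ _*_ : ℝ → ℝ → ℝ
x + y = mkℝ (λ n → seq x n ℚ.+ seq y n) (+-cauchy (seq x) (seq y) (cauchy x) (cauchy y))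
x * y = mkℝ (λ n → seq x n ℚ.* seq y n) (*-cauchy (seq x) (seq y) (cauchy x) (cauchy y))

-_ ∣_∣ : ℝ → ℝ
-_ x  = mkℝ (λ n → ℚ.- seq x n) (neg-cauchy (seq x) (cauchy x))
∣ x ∣ = mkℝ (λ n → ℚ.∣ seq x n ∣) (abs-cauchy (seq x) (cauchy x))

_-_ : ℝ → ℝ → ℝ
x - y = x + - y

_·_ : ℕ → ℝ → ℝ
n · x = fromℕ n * x

_^_ : ℝ → ℕ → ℝ
x ^ zero  = 1ℝ
x ^ suc n = x * x ^ n

_<_ _≤_ _≃_ : Rel ℝ 0ℓ
x < y = ∃ λ (ε : ℚ) → 0ℚ ℚ.< ε ×
  ∃ λ N → ∀ n → N ℕ.≤ n → seq x n ℚ.+ ε ℚ.≤ seq y n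
x ≤ y = ∀ (ε : ℚ) → 0ℚ ℚ.< ε →
  ∃ λ N → ∀ n → N ℕ.≤ n → seq x n ℚ.≤ seq y n ℚ.+ ε
x ≃ y = x ≤ y × y ≤ x

-- IsLog τ v x says that x = log_τ v, for τ > 1 and v > 0.  Real powers of τ
-- are fixed by t ↦ τ ^ t being strictly increasing and by its values at
-- rational t, so τ ^ x = v means that τ ^ t < v for every rational t < x and
-- v < τ ^ t for every rational t > x.  With t = (a − c) / b, both sides are
-- multiplied out: t < x becomes a < c + b x, and τ ^ t < v becomes
-- τ ^ a < τ ^ c v ^ b.
IsLog : ℝ → ℝ → ℝ → Set
IsLog τ v x = ∀ (a b c : ℕ) →
    (fromℕ a < fromℕ c + b · x → τ ^ a < τ ^ c * v ^ b)
  × (fromℕ c + b · x < fromℕ a → τ ^ c * v ^ b < τ ^ a)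

ℝ^ : ℕ → Set
ℝ^ s = Fin s → ℝ

private variable
  ℓ ℓ′ : Level
  s : ℕ

-- the points of S with a zero coordinate have no logarithm and are dropped
log[_] : ℝ → Pred (ℝ^ s) ℓ → Pred (ℝ^ s) ℓ
log[ τ ] S x = ∃ λ v → v ∈ S × (∀ i → 0ℝ < v i) × (∀ i → IsLog τ (v i) (x i))

Within : ℝ → ℝ^ s → ℝ^ s → Set
Within ε x y = ∀ i → ∣ x i - y i ∣ < ε

-- Lower and upper (Kuratowski) limits, as τ → ∞, of sets A τ indexed by the
-- reals τ > 1.
LimInf LimSup : (ℝ → Pred (ℝ^ s) ℓ) → Pred (ℝ^ s) ℓ
LimInf A y = ∀ ε → 0ℝ < ε → ∃ λ T → ∀ τ → 1ℝ < τ → T ≤ τ →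
  ∃ λ x → x ∈ A τ × Within ε x y
LimSup A y = ∀ ε → 0ℝ < ε → ∀ T → ∃ λ τ → 1ℝ < τ × T ≤ τ ×
  ∃ λ x → x ∈ A τ × Within ε x y

-- Since LimInf A ⊆ LimSup A always holds, this says that the limit exists
-- and equals L.
Lim_≐_ : (ℝ → Pred (ℝ^ s) ℓ) → Pred (ℝ^ s) ℓ′ → Set (ℓ ⊔ ℓ′)
Lim A ≐ L = L ⊆ LimInf A × LimSup A ⊆ L

trop_≐_ : Pred (ℝ^ s) ℓ → Pred (ℝ^ s) ℓ′ → Set (ℓ ⊔ ℓ′)
trop S ≐ L = Lim (λ τ → log[ τ ] S) ≐ L

record Graph : Set₁ where
  field
    order  : ℕ
    _~_    : Rel (Fin order) 0ℓ
    ~-sym    : Symmetric _~_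
    ~-irrefl : Irreflexive _≡_ _~_
    _~?_   : Decidable _~_

module _ (H G : Graph) where
  private
    module H = Graph H
    module G = Graph G

  IsHom : Pred (Fin H.order → Fin G.order) 0ℓ
  IsHom f = ∀ u v → u H.~ v → f u G.~ f v

  isHom? : ∀ f → Dec (IsHom f)
  isHom? f = all? λ u → all? λ v → (u H.~? v) →-dec (f u G.~? f v)

  -- finToFun enumerates every map Fin H.order → Fin G.order exactly once
  hom : ℕ
  hom = length (filter (λ i → isHom? (finToFun i)) (allFin (G.order ℕ.^ H.order)))

S₀ : Graph
S₀ = record
  { order = 1 ; _~_ = λ _ _ → ⊥ ; ~-sym = λ () ; ~-irrefl = λ _ ()
  ; _~?_ = λ _ _ → no λ () }

-- S₂₁ k is the graph S_{2,1^k}; the vertex u : Fin (k + 3) carries the label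
-- label u ∈ {1, …, k + 3}.
module _ (k : ℕ) where
  private
    label : Fin (k ℕ.+ 3) → ℕ
    label u = suc (toℕ u)

  S₂₁-Edge : Rel (Fin (k ℕ.+ 3)) 0ℓ
  S₂₁-Edge u v =
      (label u ≡ 1 × 2 ℕ.≤ label v × label v ℕ.≤ k ℕ.+ 2)
    ⊎ (label u ≡ k ℕ.+ 2 × label v ≡ k ℕ.+ 3)

  private
    edge? : Decidable S₂₁-Edge
    edge? u v =
            (label u ℕ.≟ 1 ×-dec (2 ℕ.≤? label v ×-dec label v ℕ.≤? k ℕ.+ 2))
      ⊎-dec (label u ℕ.≟ k ℕ.+ 2 ×-dec label v ℕ.≟ k ℕ.+ 3)

    loopless : ∀ u → ¬ S₂₁-Edge u u
    loopless u (inj₁ (p , q , _)) = ℕ.<-irrefl (sym p) q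
    loopless u (inj₂ (p , q)) with ℕ.+-cancelˡ-≡ k 2 3 (trans (sym p) q)
    ... | ()

  S₂₁ : Graph
  S₂₁ = record
    { order    = k ℕ.+ 3
    ; _~_      = λ u v → S₂₁-Edge u v ⊎ S₂₁-Edge v u
    ; ~-sym    = swap
    ; ~-irrefl = λ { {u} refl (inj₁ e) → loopless u e ; {u} refl (inj₂ e) → loopless u e }
    ; _~?_     = λ u v → edge? u v ⊎-dec edge? v u
    }

𝒩 : (Fin s → Graph) → Pred (ℝ^ s) (lsuc 0ℓ)
𝒩 U v = ∃ λ (G : Graph) → ∀ i → v i ≃ fromℕ (hom (U i) G)

𝒰 : ∀ m → Fin (suc m) → Graph
𝒰 m zero    = S₀
𝒰 m (suc i) = S₂₁ (toℕ i)

-- The coordinate y_i.  The default value 0 for i ≥ s is never reached in Q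
-- below when m ≥ 4.
_!_ : ℝ^ s → ℕ → ℝ
_!_ {s} y i with i ℕ.<? s
... | yes i<s = y (fromℕ< i<s)
... | no  _   = 0ℝ

infixl 9 _!_

record Q (m : ℕ) (y : ℝ^ (suc m)) : Set where
  field
    ineq₁ : 0ℝ ≤ - y ! 1 + y ! 2
    ineq₂ : 0ℝ ≤ 4 · y ! 1 - 3 · y ! 2
    ineq₃ : 0ℝ ≤ 3 · y ! 1 - 3 · y ! 3 + y ! 4
    ineq₄ : 0ℝ ≤ y ! 1 + 2 · y ! (m ∸ 1) - 2 · y ! m
    ineq₅ : 0ℝ ≤ y ! 0 + y ! (m ∸ 1) - y ! m
    ineq₆ : 0ℝ ≤ y ! 0 - 2 · y ! 1 + y ! 3
    ineq₇ : ∀ i → 2 ℕ.≤ i → i ℕ.≤ m ∸ 1 →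
            0ℝ ≤ y ! (i ∸ 1) - 2 · y ! i + y ! (suc i)
    ineq₈ : 0ℝ ≤ m · y ! (m ∸ 1) - (m ∸ 1) · y ! m

-- Let d(v) be the degree of v and w(v) the sum of the degrees of its
-- neighbours.  Then hom(S_{2,1^k}; G) = M_k := Σ_v d(v)^k w(v), and every
-- inequality of Q is the logarithm of an inequality between the M_k and the
-- order of G, up to a constant factor that disappears as τ → ∞.  These
-- inequalities follow from Cauchy–Schwarz, from the maximum degree and from
-- w(v)² ≤ d(v) M_0.
--
-- Conversely, rounding and pushing towards the interior moves a point of Q to
-- a nearby p / q ∈ Q with p integral.  The function l ↦ p_{l+1} is convex for
-- l ≥ 1, so each of its values is attained by a line l ↦ c + l s below it, and
-- the inequalities of Q are exactly what is needed to choose α, a, g, f, e such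
-- that n^α copies of a graph with three layers, of sizes n^a, n^(g+f) and
-- n^(g+e), have M_l of order at most n^(p_{l+1}), with equality where the line
-- touches.  The disjoint union of these graphs and of n^(p_0) isolated vertices
-- realises p, and n is chosen such that n^q approximates τ.
module Submission where

-- No calculus of real powers is developed: every comparison of logarithms is made between natural
-- exponents of a rational term t > 1 of τ, after raising to a power that clears denominators. A
-- constant factor such as the 64 in `M1³≤` then costs one more factor t once τ is large, that is, a
-- bounded change of an exponent, and division by a large q makes it negligible. So that such errors
-- are estimated only once, all inequalities of Q share the format A y_i ≤ B y_j + C y_k of
-- `Constraint`. The difficulty of the construction is that a graph whose top layer reaches the
-- supporting line must not exceed any other target, while its middle and bottom layers also
-- contribute to M_0 and to the order. Complete bipartite graphs suffice for moderate slopes. For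
-- steep lines the top layer has to be smaller than the bottom layer, and the middle layer is then
-- cut into n^g parts, since a single K_{f,e} would give its vertices too large a w.

module FiniteSums where

  -- Finite sums of natural numbers, Cauchy-Schwarz and indicator functions

  import Algebra.Properties.Semiring.Sum
  open import Data.Nat.Base
  open import Data.Nat.Properties
  open import Data.Nat.Tactic.RingSolver using (solve-∀)
  open import Data.Fin.Base using (Fin; zero; suc; splitAt; remQuot; finToFun)
  open import Data.List.Base using (length; filter; tabulate; allFin)
  open import Data.Product.Base using (_×_; _,_) renaming (map₁ to ×-map₁)
  open import Data.Sum.Base using (_⊎_; inj₁; inj₂) renaming (map₁ to ⊎-map₁)
  open import Data.Vec.Functional using (_∷_)
  open import Function.Base using (_∘_; id)
  open import Level using (Level)
  open import Relation.Binary.PropositionalEquality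
  open import Relation.Nullary using (Dec; yes; no; contradiction)
  open import Relation.Nullary.Decidable using (_×-dec_)

  private variable
    p q : Level
    P : Set p
    R : Set q
    n : ℕ

  private module S = Algebra.Properties.Semiring.Sum +-*-semiring

  infixl 10 ∑-syntax

  -- Abstract, so that Agda can infer the summand and the range from a sum.
  abstract
    ∑ : (Fin n → ℕ) → ℕ
    ∑ = S.sum

  ∑-syntax : ∀ n → (Fin n → ℕ) → ℕ
  ∑-syntax _ = ∑

  syntax ∑-syntax n (λ i → x) = ∑[ i < n ] x

  abstract
    ∑-suc : (f : Fin (suc n) → ℕ) → ∑ f ≡ f zero + ∑ (f ∘ suc)
    ∑-suc f = refl

    ∑-zero : (f : Fin zero → ℕ) → ∑ f ≡ 0
    ∑-zero f = refl

    ∑-cong : {f g : Fin n → ℕ} → f ≗ g → ∑ f ≡ ∑ g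
    ∑-cong = S.sum-cong-≗

    ∑-distrib-+ : (f g : Fin n → ℕ) → ∑[ i < n ] (f i + g i) ≡ ∑ f + ∑ g
    ∑-distrib-+ = S.∑-distrib-+

    ∑-comm : ∀ {m n} (f : Fin m → Fin n → ℕ) →
      ∑[ i < m ] ∑[ j < n ] f i j ≡ ∑[ j < n ] ∑[ i < m ] f i j
    ∑-comm = S.∑-comm

    *-distribˡ-∑ : ∀ c (f : Fin n → ℕ) → c * ∑ f ≡ ∑[ i < n ] (c * f i)
    *-distribˡ-∑ = S.*-distribˡ-sum

    *-distribʳ-∑ : ∀ c (f : Fin n → ℕ) → ∑ f * c ≡ ∑[ i < n ] (f i * c)
    *-distribʳ-∑ = S.*-distribʳ-sum

    ∑-mono-≤ : {f g : Fin n → ℕ} → (∀ i → f i ≤ g i) → ∑ f ≤ ∑ g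
    ∑-mono-≤ {zero}  f≤g = z≤n
    ∑-mono-≤ {suc n} f≤g = +-mono-≤ (f≤g zero) (∑-mono-≤ (f≤g ∘ suc))

    term≤∑ : (f : Fin n → ℕ) → ∀ i → f i ≤ ∑ f
    term≤∑ f zero    = m≤m+n (f zero) _
    term≤∑ f (suc i) = ≤-trans (term≤∑ (f ∘ suc) i) (m≤n+m _ (f zero))

    ∑-const : ∀ n c → ∑[ _ < n ] c ≡ n * c
    ∑-const zero    c = refl
    ∑-const (suc n) c = cong (c +_) (∑-const n c)

    ∑-splitAt : ∀ m {n} (h : Fin m ⊎ Fin n → ℕ) →
      ∑ (h ∘ splitAt m) ≡ ∑ (h ∘ inj₁) + ∑ (h ∘ inj₂)
    ∑-splitAt zero    h = refl
    ∑-splitAt (suc m) h = trans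
      (cong (h (inj₁ zero) +_) (∑-splitAt m (h ∘ ⊎-map₁ suc)))
      (sym (+-assoc (h (inj₁ zero)) _ _))

    ∑-remQuot : ∀ m n (h : Fin m × Fin n → ℕ) →
      ∑ {m * n} (h ∘ remQuot n) ≡ ∑[ i < m ] ∑[ j < n ] h (i , j)
    ∑-remQuot zero    n h = refl
    ∑-remQuot (suc m) n h = trans
      (trans (∑-cong pointwise) (∑-splitAt n h′))
      (cong (∑ (λ j → h (zero , j)) +_) (∑-remQuot m n (h ∘ ×-map₁ suc)))
      where
      h′ : Fin n ⊎ Fin (m * n) → ℕ
      h′ (inj₁ j) = h (zero , j)
      h′ (inj₂ i) = h (×-map₁ suc (remQuot n i))

      pointwise : ∀ i → h (remQuot {suc m} n i) ≡ h′ (splitAt n i)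
      pointwise i with splitAt n i
      ... | inj₁ _ = refl
      ... | inj₂ _ = refl

    ∑-*-∑ : ∀ {m n} (f : Fin m → ℕ) (g : Fin n → ℕ) →
      ∑ f * ∑ g ≡ ∑[ i < m ] ∑[ j < n ] (f i * g j)
    ∑-*-∑ f g = trans (*-distribʳ-∑ (∑ g) f) (∑-cong λ i → *-distribˡ-∑ (f i) g)

  2ab≤a²+b² : ∀ a b → 2 * (a * b) ≤ a * a + b * b
  2ab≤a²+b² a b with ≤-total a b
  ... | inj₁ a≤b = subst (λ b → 2 * (a * b) ≤ a * a + b * b) (m+[n∸m]≡n a≤b) (ordered a (b ∸ a))
    where
    ordered : ∀ a d → 2 * (a * (a + d)) ≤ a * a + (a + d) * (a + d)
    ordered a d = ≤-trans (m≤m+n _ (d * d)) (≤-reflexive (eq a d))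
      where
      eq : ∀ a d → 2 * (a * (a + d)) + d * d ≡ a * a + (a + d) * (a + d)
      eq = solve-∀
  ... | inj₂ b≤a = subst (λ a → 2 * (a * b) ≤ a * a + b * b) (m+[n∸m]≡n b≤a) (ordered b (a ∸ b))
    where
    ordered : ∀ b d → 2 * ((b + d) * b) ≤ (b + d) * (b + d) + b * b
    ordered b d = ≤-trans (m≤m+n _ (d * d)) (≤-reflexive (eq b d))
      where
      eq : ∀ b d → 2 * ((b + d) * b) + d * d ≡ (b + d) * (b + d) + b * b
      eq = solve-∀

  ^-distribʳ-* : ∀ a b n → (a * b) ^ n ≡ a ^ n * b ^ n
  ^-distribʳ-* a b zero    = refl
  ^-distribʳ-* a b (suc n) = trans (cong (a * b *_) (^-distribʳ-* a b n)) (swap a b (a ^ n) (b ^ n))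
    where
    swap : ∀ a b x y → a * b * (x * y) ≡ a * x * (b * y)
    swap = solve-∀

  m*m≤n*n⇒m≤n : ∀ {m n} → m * m ≤ n * n → m ≤ n
  m*m≤n*n⇒m≤n m²≤n² = ≮⇒≥ λ n<m → <⇒≱ (*-mono-< n<m n<m) m²≤n²

  -- The termwise hypothesis t² ≤ ab replaces square roots, which ℕ lacks. The proof sums 2 t_i t_j
  -- ≤ a_i b_j + a_j b_i over all pairs.
  cauchy-schwarz : (t a b : Fin n → ℕ) → (∀ i → t i * t i ≤ a i * b i) →
    ∑ t * ∑ t ≤ ∑ a * ∑ b
  cauchy-schwarz {n} t a b t²≤ab = *-cancelˡ-≤ 2 (begin
    2 * (∑ t * ∑ t)
      ≡⟨ cong (2 *_) (∑-*-∑ t t) ⟩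
    2 * ∑[ i < n ] ∑[ j < n ] (t i * t j)
      ≡⟨ *-distribˡ-∑ 2 _ ⟩
    ∑[ i < n ] (2 * ∑[ j < n ] (t i * t j))
      ≡⟨ ∑-cong (λ i → *-distribˡ-∑ 2 _) ⟩
    ∑[ i < n ] ∑[ j < n ] (2 * (t i * t j))
      ≤⟨ ∑-mono-≤ (λ i → ∑-mono-≤ λ j → term i j) ⟩
    ∑[ i < n ] ∑[ j < n ] (a i * b j + a j * b i)
      ≡⟨ ∑-cong (λ i → ∑-distrib-+ (λ j → a i * b j) (λ j → a j * b i)) ⟩
    ∑[ i < n ] (∑[ j < n ] (a i * b j) + ∑[ j < n ] (a j * b i))
      ≡⟨ ∑-distrib-+ (λ i → ∑[ j < n ] (a i * b j)) (λ i → ∑[ j < n ] (a j * b i)) ⟩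
    ∑[ i < n ] ∑[ j < n ] (a i * b j) + ∑[ i < n ] ∑[ j < n ] (a j * b i)
      ≡⟨ cong (∑[ i < n ] ∑[ j < n ] (a i * b j) +_) (∑-comm (λ i j → a j * b i)) ⟩
    ∑[ i < n ] ∑[ j < n ] (a i * b j) + ∑[ i < n ] ∑[ j < n ] (a i * b j)
      ≡⟨ cong₂ _+_ (∑-*-∑ a b) (∑-*-∑ a b) ⟨
    ∑ a * ∑ b + ∑ a * ∑ b
      ≡⟨ cong (∑ a * ∑ b +_) (+-identityʳ (∑ a * ∑ b)) ⟨
    2 * (∑ a * ∑ b) ∎)
    where
    open ≤-Reasoning
    4tt : ∀ x y → (2 * (x * y)) * (2 * (x * y)) ≡ 4 * ((x * x) * (y * y))
    4tt = solve-∀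

    regroup : ∀ x y z u → 4 * ((x * y) * (z * u)) ≡ 2 * ((x * u) * (z * y)) + 2 * ((x * u) * (z * y))
    regroup = solve-∀

    square : ∀ x y → (x * x + y * y) + 2 * (x * y) ≡ (x + y) * (x + y)
    square = solve-∀

    -- With x = a_i b_j and y = a_j b_i, squaring reduces this to t_i² t_j² ≤ xy and 4xy ≤ (x + y)².
    term : ∀ i j → 2 * (t i * t j) ≤ a i * b j + a j * b i
    term i j = m*m≤n*n⇒m≤n (begin
      (2 * (t i * t j)) * (2 * (t i * t j))
        ≡⟨ 4tt (t i) (t j) ⟩
      4 * ((t i * t i) * (t j * t j))
        ≤⟨ *-monoʳ-≤ 4 (*-mono-≤ (t²≤ab i) (t²≤ab j)) ⟩
      4 * ((a i * b i) * (a j * b j))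
        ≡⟨ regroup (a i) (b i) (a j) (b j) ⟩
      2 * ((a i * b j) * (a j * b i)) + 2 * ((a i * b j) * (a j * b i))
        ≤⟨ +-monoˡ-≤ _ (2ab≤a²+b² (a i * b j) (a j * b i)) ⟩
      ((a i * b j) * (a i * b j) + (a j * b i) * (a j * b i)) + 2 * ((a i * b j) * (a j * b i))
        ≡⟨ square (a i * b j) (a j * b i) ⟩
      (a i * b j + a j * b i) * (a i * b j + a j * b i) ∎)

  ⟦_⟧ : Dec P → ℕ
  ⟦ yes _ ⟧ = 1
  ⟦ no  _ ⟧ = 0

  ⟦⟧-cong : (d : Dec P) (e : Dec R) → (P → R) → (R → P) → ⟦ d ⟧ ≡ ⟦ e ⟧
  ⟦⟧-cong (yes _) (yes _) _ _ = refl
  ⟦⟧-cong (no  _) (no  _) _ _ = refl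
  ⟦⟧-cong (yes p) (no ¬r) f _ = contradiction (f p) ¬r
  ⟦⟧-cong (no ¬p) (yes r) _ g = contradiction (g r) ¬p

  ⟦⟧-× : (d : Dec P) (e : Dec R) → ⟦ d ×-dec e ⟧ ≡ ⟦ d ⟧ * ⟦ e ⟧
  ⟦⟧-× (yes _) (yes _) = refl
  ⟦⟧-× (yes _) (no  _) = refl
  ⟦⟧-× (no  _) (yes _) = refl
  ⟦⟧-× (no  _) (no  _) = refl

  ⟦⟧-idem : (d : Dec P) → ⟦ d ⟧ * ⟦ d ⟧ ≡ ⟦ d ⟧
  ⟦⟧-idem (yes _) = refl
  ⟦⟧-idem (no  _) = refl

  abstract
    length-filter-allFin : ∀ {P : Fin n → Set} (P? : ∀ i → Dec (P i)) →
      length (filter P? (allFin n)) ≡ ∑ (λ i → ⟦ P? i ⟧)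
    length-filter-allFin P? = go P? id
      where
      go : ∀ {n} {A : Set} {P : A → Set} (P? : ∀ a → Dec (P a)) (f : Fin n → A) →
        length (filter P? (tabulate f)) ≡ ∑ (λ i → ⟦ P? (f i) ⟧)
      go {zero}  P? f = refl
      go {suc n} P? f with P? (f zero)
      ... | yes _ = cong suc (go P? (f ∘ suc))
      ... | no  _ = go P? (f ∘ suc)

  -- `finToFun` reads its index in base N with the value at `zero` as leading digit, which
  -- `∑-remQuot` splits off. `F` has to respect `≗` because the function is reassembled from its
  -- digits only pointwise.
  ∑-finToFun : ∀ N h (F : (Fin (suc h) → Fin N) → ℕ) → (∀ {f g} → f ≗ g → F f ≡ F g) →
    ∑ {N ^ suc h} (F ∘ finToFun) ≡ ∑[ x < N ] ∑ {N ^ h} (λ i → F (x ∷ finToFun i))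
  ∑-finToFun N h F F-cong = trans
    (∑-cong {N * N ^ h} λ i → F-cong λ { zero → refl ; (suc j) → refl })
    (∑-remQuot N (N ^ h) λ (x , i) → F (x ∷ finToFun i))

-- Homomorphism counts as sums over the image of the centre

module HomCount where

  open FiniteSums
  open import Data.Nat.Base
  open import Data.Nat.Properties
  open import Data.Fin.Base using (Fin; zero; suc; toℕ; finToFun)
  open import Data.Product.Base using (_×_; _,_; proj₁; proj₂)
  open import Data.Sum.Base using (_⊎_; inj₁; inj₂)
  open import Data.Vec.Functional using (_∷_)
  open import Data.Unit.Base using (tt)
  open import Function.Base using (_∘_)
  open import Relation.Binary.PropositionalEquality
  open import Relation.Nullary using (Dec; yes)
  open import Relation.Nullary.Decidable using (_×-dec_)
  open import Defs using (Graph; hom; isHom?; S₀; S₂₁)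

  module _ (G : Graph) where
    open Graph G

    adj : Fin order → Fin order → ℕ
    adj u v = ⟦ u ~? v ⟧

    deg : Fin order → ℕ
    deg u = ∑[ v < order ] adj u v

    walks₂ : Fin order → ℕ
    walks₂ u = ∑[ v < order ] (adj u v * deg v)

    adj-sym : ∀ u v → adj u v ≡ adj v u
    adj-sym u v = ⟦⟧-cong (u ~? v) (v ~? u) ~-sym ~-sym

    -- A homomorphism from S_{2,1^k} is an image u of the centre, k images of the
    -- leaves, and a walk of two edges from u.
    M : ℕ → ℕ
    M k = ∑[ u < order ] (deg u ^ k * walks₂ u)

    hom-S₀ : hom S₀ G ≡ order
    hom-S₀ = trans (length-filter-allFin _)
      (trans (∑-cong λ i → ⟦⟧-cong (isHom? S₀ G (finToFun i)) (yes tt) _ (λ _ _ _ ()))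
        (trans (∑-const (order ^ 1) 1) (trans (*-identityʳ (order ^ 1)) (*-identityʳ order))))

    private
      -- The condition on the images of the non-central vertices, arranged for recursion: leaves are
      -- peeled off one by one, and the last two arguments form the lengthened branch.
      Spider : ∀ k → Fin order → (Fin (k + 2) → Fin order) → Set
      Spider zero    c g = c ~ g zero × g zero ~ g (suc zero)
      Spider (suc k) c g = c ~ g zero × Spider k c (g ∘ suc)

      spider? : ∀ k c g → Dec (Spider k c g)
      spider? zero    c g = c ~? g zero ×-dec g zero ~? g (suc zero)
      spider? (suc k) c g = c ~? g zero ×-dec spider? k c (g ∘ suc)

      Spider-cong : ∀ k c {g h} → g ≗ h → Spider k c g → Spider k c h
      Spider-cong zero    c {g} {h} e (p , q) =
        subst (c ~_) (e zero) p , subst₂ _~_ (e zero) (e (suc zero)) q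
      Spider-cong (suc k) c {g} {h} e (p , q) =
        subst (c ~_) (e zero) p , Spider-cong k c (e ∘ suc) q

      ⟦spider⟧-cong : ∀ k c {g h} → g ≗ h → ⟦ spider? k c g ⟧ ≡ ⟦ spider? k c h ⟧
      ⟦spider⟧-cong k c {g} {h} e = ⟦⟧-cong (spider? k c g) (spider? k c h)
        (Spider-cong k c e) (Spider-cong k c (sym ∘ e))

      count-spiders : ∀ k c →
        ∑ {order ^ (k + 2)} (λ i → ⟦ spider? k c (finToFun i) ⟧) ≡ deg c ^ k * walks₂ c
      count-spiders zero c = begin
        ∑ {order ^ 2} (λ i → ⟦ spider? 0 c (finToFun i) ⟧)
          ≡⟨ ∑-finToFun order 1 (λ g → ⟦ spider? 0 c g ⟧) (⟦spider⟧-cong 0 c) ⟩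
        ∑[ x < order ] ∑ {order ^ 1} (λ i → ⟦ spider? 0 c (x ∷ finToFun i) ⟧)
          ≡⟨ ∑-cong (λ x → ∑-finToFun order 0 (λ g → ⟦ spider? 0 c (x ∷ g) ⟧)
               (λ {g} {h} e → ⟦spider⟧-cong 0 c {x ∷ g} {x ∷ h} λ { zero → refl ; (suc i) → e i })) ⟩
        ∑[ x < order ] ∑[ y < order ] ∑ {1} (λ i → ⟦ spider? 0 c (x ∷ (y ∷ finToFun i)) ⟧)
          ≡⟨ ∑-cong (λ x → ∑-cong λ y → trans (trans (∑-const 1 _) (*-identityˡ _))
               (⟦⟧-× (c ~? x) (x ~? y))) ⟩
        ∑[ x < order ] ∑[ y < order ] (adj c x * adj x y)
          ≡⟨ ∑-cong (λ x → *-distribˡ-∑ (adj c x) (adj x)) ⟨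
        walks₂ c
          ≡⟨ *-identityˡ (walks₂ c) ⟨
        1 * walks₂ c ∎
        where open ≡-Reasoning
      count-spiders (suc k) c = begin
        ∑ {order ^ suc (k + 2)} (λ i → ⟦ spider? (suc k) c (finToFun i) ⟧)
          ≡⟨ ∑-finToFun order (k + 2) (λ g → ⟦ spider? (suc k) c g ⟧) (⟦spider⟧-cong (suc k) c) ⟩
        ∑[ x < order ] ∑ {order ^ (k + 2)} (λ i → ⟦ spider? (suc k) c (x ∷ finToFun i) ⟧)
          ≡⟨ ∑-cong (λ x → ∑-cong λ i → ⟦⟧-× (c ~? x) (spider? k c (finToFun i))) ⟩
        ∑[ x < order ] ∑ {order ^ (k + 2)} (λ i → adj c x * ⟦ spider? k c (finToFun i) ⟧)
          ≡⟨ ∑-cong (λ x → *-distribˡ-∑ (adj c x) (λ i → ⟦ spider? k c (finToFun i) ⟧)) ⟨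
        ∑[ x < order ] (adj c x * ∑ {order ^ (k + 2)} (λ i → ⟦ spider? k c (finToFun i) ⟧))
          ≡⟨ ∑-cong (λ x → cong (adj c x *_) (count-spiders k c)) ⟩
        ∑[ x < order ] (adj c x * (deg c ^ k * walks₂ c))
          ≡⟨ *-distribʳ-∑ _ (adj c) ⟨
        deg c * (deg c ^ k * walks₂ c)
          ≡⟨ *-assoc (deg c) (deg c ^ k) (walks₂ c) ⟨
        deg c ^ suc k * walks₂ c ∎
        where open ≡-Reasoning

      -- Index i carries the label i + 2 of `S₂₁-Edge`; thus index k is the middle vertex of the
      -- long branch and index k + 1 its end.
      LegsAndPath : ∀ k → Fin order → (Fin (k + 2) → Fin order) → Set
      LegsAndPath k c g = (∀ i → toℕ i ≤ k → c ~ g i)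
        × (∀ i j → toℕ i ≡ k → toℕ j ≡ suc k → g i ~ g j)

      Spider⇒ : ∀ k c g → Spider k c g → LegsAndPath k c g
      Spider⇒ zero    c g (p , q) =
        (λ { zero _ → p ; (suc zero) () }) , λ { zero (suc zero) _ _ → q }
      Spider⇒ (suc k) c g (p , q) with Spider⇒ k c (g ∘ suc) q
      ... | legs , path = (λ { zero _ → p ; (suc i) (s≤s i≤k) → legs i i≤k })
        , λ { (suc i) (suc j) e e′ → path i j (suc-injective e) (suc-injective e′) }

      ⇒Spider : ∀ k c g → LegsAndPath k c g → Spider k c g
      ⇒Spider zero    c g (legs , path) = legs zero z≤n , path zero (suc zero) refl refl
      ⇒Spider (suc k) c g (legs , path) = legs zero z≤n , ⇒Spider k c (g ∘ suc)
        ((λ i i≤k → legs (suc i) (s≤s i≤k)) , λ i j e e′ → path (suc i) (suc j) (cong suc e) (cong suc e′))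

      Edge : ℕ → ℕ → ℕ → Set
      Edge k a b = (suc a ≡ 1 × 2 ≤ suc b × suc b ≤ k + 2) ⊎ (suc a ≡ k + 2 × suc b ≡ k + 3)

      -- S_{2,1^k} has order k + 3, which does not reduce to a successor; hence h.
      HomFrom : ∀ h → ℕ → (Fin h → Fin order) → Set
      HomFrom h k f = ∀ u v → Edge k (toℕ u) (toℕ v) ⊎ Edge k (toℕ v) (toℕ u) → f u ~ f v

      Hom⇒Spider : ∀ k f → HomFrom (suc (k + 2)) k f → Spider k (f zero) (f ∘ suc)
      Hom⇒Spider k f hom = ⇒Spider k (f zero) (f ∘ suc)
        ( (λ i i≤k → hom zero (suc i) (inj₁ (inj₁ (refl , s≤s (s≤s z≤n) ,
            ≤-trans (s≤s (s≤s i≤k)) (≤-reflexive (+-comm 2 k))))))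
        , λ i j e e′ → hom (suc i) (suc j) (inj₁ (inj₂
            ( trans (cong 2+ e) (+-comm 2 k)
            , trans (cong 2+ e′) (+-comm 3 k)))))

      Spider⇒Hom : ∀ k f → Spider k (f zero) (f ∘ suc) → HomFrom (suc (k + 2)) k f
      Spider⇒Hom k f sp = λ u v → λ { (inj₁ e) → edge u v e ; (inj₂ e) → ~-sym (edge v u e) }
        where
        legs = proj₁ (Spider⇒ k (f zero) (f ∘ suc) sp)
        path = proj₂ (Spider⇒ k (f zero) (f ∘ suc) sp)

        edge : ∀ u v → Edge k (toℕ u) (toℕ v) → f u ~ f v
        edge zero    zero    (inj₁ (_ , s≤s () , _))
        edge zero    (suc i) (inj₁ (_ , _ , i<)) =
          legs i (≤-pred (≤-pred (≤-trans i< (≤-reflexive (+-comm k 2)))))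
        edge (suc u) v       (inj₁ (() , _))
        edge zero    v       (inj₂ (e , _)) with () ← trans e (+-comm k 2)
        edge (suc i) zero    (inj₂ (_ , e)) with () ← trans e (+-comm k 3)
        edge (suc i) (suc j) (inj₂ (e , e′)) = path i j
          (suc-injective (suc-injective (trans e (+-comm k 2))))
          (suc-injective (suc-injective (trans e′ (+-comm k 3))))

      count-homs : ∀ h k → h ≡ suc (k + 2) → (D : ∀ f → Dec (HomFrom h k f)) →
        ∑ {order ^ h} (λ i → ⟦ D (finToFun i) ⟧) ≡ M k
      count-homs _ k refl D = begin
        ∑ {order ^ suc (k + 2)} (λ i → ⟦ D (finToFun i) ⟧)
          ≡⟨ ∑-cong (λ i → D≡ (finToFun i)) ⟩
        ∑ {order ^ suc (k + 2)} (λ i → F (finToFun i))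
          ≡⟨ ∑-finToFun order (k + 2) F F-cong ⟩
        ∑[ c < order ] ∑ {order ^ (k + 2)} (λ i → ⟦ spider? k c (finToFun i) ⟧)
          ≡⟨ ∑-cong (count-spiders k) ⟩
        M k ∎
        where
        open ≡-Reasoning
        F : (Fin (suc (k + 2)) → Fin order) → ℕ
        F f = ⟦ spider? k (f zero) (f ∘ suc) ⟧

        D≡ : ∀ f → ⟦ D f ⟧ ≡ F f
        D≡ f = ⟦⟧-cong (D f) (spider? k (f zero) (f ∘ suc)) (Hom⇒Spider k f) (Spider⇒Hom k f)

        F-cong : ∀ {f g} → f ≗ g → F f ≡ F g
        F-cong {f} {g} e = trans (⟦spider⟧-cong k (f zero) (e ∘ suc))
          (cong (λ c → ⟦ spider? k c (g ∘ suc) ⟧) (e zero))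

    hom-S₂₁ : ∀ k → hom (S₂₁ k) G ≡ M k
    hom-S₂₁ k = trans (length-filter-allFin _)
      (count-homs (k + 3) k (+-suc k 2) (isHom? (S₂₁ k) G))

-- Inequalities between the M_k and the order

module HomInequalities where

  open FiniteSums
  open HomCount
  open import Data.Nat.Base
  open import Data.Nat.Properties
  open import Data.Nat.Tactic.RingSolver using (solve-∀)
  open import Data.Fin.Base using (Fin; zero; suc)
  open import Data.Product.Base using (∃; _×_; _,_; proj₁; proj₂)
  open import Data.Sum.Base using (_⊎_; inj₁; inj₂)
  open import Function.Base using (_∘_)
  open import Relation.Binary.PropositionalEquality
  open import Relation.Nullary using (yes; no)
  open import Defs using (Graph)

  private
    x^2 : ∀ x → x ^ 2 ≡ x * x
    x^2 x = cong (x *_) (*-identityʳ x)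

    x^3 : ∀ x → x ^ 3 ≡ x * (x * x)
    x^3 x = cong (x *_) (x^2 x)

    attained-max : ∀ {n} (f : Fin n → ℕ) → ∃ λ D → (∀ i → f i ≤ D) × (D ≡ 0 ⊎ ∃ λ i → D ≡ f i)
    attained-max {zero}  f = 0 , (λ ()) , inj₁ refl
    attained-max {suc n} f with attained-max (f ∘ suc)
    ... | D , f≤D , att with ≤-total D (f zero)
    ...   | inj₁ D≤f₀ = f zero , (λ { zero → ≤-refl ; (suc i) → ≤-trans (f≤D i) D≤f₀ }) , inj₂ (zero , refl)
    ...   | inj₂ f₀≤D = D , (λ { zero → f₀≤D ; (suc i) → f≤D i }) , att′ att
      where
      att′ : D ≡ 0 ⊎ ∃ (λ i → D ≡ f (suc i)) → D ≡ 0 ⊎ ∃ λ i → D ≡ f i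
      att′ (inj₁ e)       = inj₁ e
      att′ (inj₂ (i , e)) = inj₂ (suc i , e)

    -- T grows only when T³ falls short of the new S; then T + 1 ≤ 2T for T ≥ 1, which gives the
    -- factor 8. Together with the 8 of (2TS)³ it makes the 64 of `M1³≤`.
    approx-∛ : ∀ S → ∃ λ T → S ≤ T * (T * T) × T * (T * T) ≤ 8 * S
    approx-∛ zero = 0 , z≤n , z≤n
    approx-∛ (suc S) with approx-∛ S
    ... | T , S≤T³ , T³≤8S with suc S ≤? T * (T * T)
    ...   | yes S<T³ = T , S<T³ , ≤-trans T³≤8S (*-monoʳ-≤ 8 (n≤1+n S))
    ...   | no  S≮T³ = suc T , ≤-trans (s≤s S≤T³) (grow T) , shrink T (≮⇒≥ S≮T³)
      where
      grow-eq : ∀ T → suc (T * (T * T)) + 3 * (T * T + T) ≡ suc T * (suc T * suc T)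
      grow-eq = solve-∀

      grow : ∀ T → suc (T * (T * T)) ≤ suc T * (suc T * suc T)
      grow T = ≤-trans (m≤m+n _ (3 * (T * T + T))) (≤-reflexive (grow-eq T))

      8T³ : ∀ T → 2 * T * (2 * T * (2 * T)) ≡ 8 * (T * (T * T))
      8T³ = solve-∀

      shrink : ∀ T → T * (T * T) ≤ S → suc T * (suc T * suc T) ≤ 8 * suc S
      shrink zero    _    = ≤-trans (s≤s z≤n) (*-monoʳ-≤ 8 (s≤s (z≤n {S})))
      shrink T@(suc T′) T³≤S = begin
        suc T * (suc T * suc T)     ≤⟨ *-mono-≤ 1+T≤2T (*-mono-≤ 1+T≤2T 1+T≤2T) ⟩
        2 * T * (2 * T * (2 * T))   ≡⟨ 8T³ T ⟩
        8 * (T * (T * T))           ≤⟨ *-monoʳ-≤ 8 (≤-trans T³≤S (n≤1+n S)) ⟩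
        8 * suc S                   ∎
        where
        open ≤-Reasoning
        1+T≤2T : suc T ≤ 2 * T
        1+T≤2T = +-mono-≤ {1} {T} (s≤s z≤n) (≤-reflexive (sym (+-identityʳ T)))

  module _ (G : Graph) where
    open Graph G using (order)

    private
      A : Fin order → Fin order → ℕ
      A = adj G

      d w : Fin order → ℕ
      d = deg G
      w = walks₂ G

      S : ℕ
      S = ∑[ u < order ] (d u * d u)

      q : Fin order → ℕ
      q u = ∑[ v < order ] (A u v * (d v * d v))

      A≤1 : ∀ u v → A u v ≤ 1
      A≤1 u v with Graph._~?_ G u v
      ... | yes _ = ≤-refl
      ... | no  _ = z≤n

      adj-swap : ∀ (h : Fin order → Fin order → ℕ) →
        ∑[ u < order ] ∑[ v < order ] (A u v * h u v) ≡ ∑[ u < order ] ∑[ v < order ] (A u v * h v u)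
      adj-swap h = trans (∑-comm (λ u v → A u v * h u v))
        (∑-cong λ v → ∑-cong λ u → cong (_* h u v) (adj-sym G u v))

      M0≡∑w : M G 0 ≡ ∑ w
      M0≡∑w = ∑-cong λ u → *-identityˡ (w u)

      -- Both sides count walks of two edges, by an end vertex and by the middle vertex.
      M0≡S : M G 0 ≡ S
      M0≡S = trans M0≡∑w (trans (adj-swap (λ u v → d v))
        (∑-cong λ u → sym (*-distribʳ-∑ (d u) (A u))))

      d≤order : ∀ u → d u ≤ order
      d≤order u = ≤-trans (∑-mono-≤ (A≤1 u)) (≤-reflexive (trans (∑-const order 1) (*-identityʳ order)))

      -- An edge at u is itself one term of the degree of u, and an indicator equals its square.
      A≤A*dˡ : ∀ u v → A u v ≤ A u v * d u
      A≤A*dˡ u v = ≤-trans (≤-reflexive (sym (⟦⟧-idem (Graph._~?_ G u v))))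
        (*-monoʳ-≤ (A u v) (term≤∑ (A u) v))

      A≤A*dʳ : ∀ u v → A u v ≤ A u v * d v
      A≤A*dʳ u v = subst (λ a → a ≤ a * d v) (adj-sym G v u) (A≤A*dˡ v u)

      d≤w : ∀ u → d u ≤ w u
      d≤w u = ∑-mono-≤ (A≤A*dʳ u)

      w≤dw : ∀ u → w u ≤ d u * w u
      w≤dw u = subst (w u ≤_) (sym (*-distribˡ-∑ (d u) (λ v → A u v * d v)))
        (∑-mono-≤ λ v → ≤-trans (*-monoˡ-≤ (d v) (A≤A*dˡ u v)) (≤-reflexive (rot (A u v) (d u) (d v))))
        where
        rot : ∀ a b c → a * b * c ≡ b * (a * c)
        rot = solve-∀

      -- Cauchy-Schwarz over the neighbours of u. `q` is kept as a sum over neighbours, sharper than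
      -- S, because Σ d q is M_2 (see `M0²≤`).
      w²≤dq : ∀ u → w u * w u ≤ d u * q u
      w²≤dq u = cauchy-schwarz (λ v → A u v * d v) (A u) (λ v → A u v * (d v * d v))
        λ v → ≤-reflexive (regroup (A u v) (d v))
        where
        regroup : ∀ a b → a * b * (a * b) ≡ a * (a * (b * b))
        regroup = solve-∀

      q≤S : ∀ u → q u ≤ S
      q≤S u = ∑-mono-≤ λ v → ≤-trans (*-monoˡ-≤ (d v * d v) (A≤1 u v)) (≤-reflexive (*-identityˡ _))

      w²≤dS : ∀ u → w u * w u ≤ d u * S
      w²≤dS u = ≤-trans (w²≤dq u) (*-monoʳ-≤ (d u) (q≤S u))

      Δ : ℕ
      Δ = proj₁ (attained-max d)

      d≤Δ : ∀ u → d u ≤ Δ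
      d≤Δ = proj₁ (proj₂ (attained-max d))

      Δ² : Δ * Δ ≤ S
      Δ² with proj₂ (proj₂ (attained-max d))
      ... | inj₁ Δ≡0 rewrite Δ≡0 = z≤n
      ... | inj₂ (u , Δ≡d) rewrite Δ≡d = term≤∑ (λ u → d u * d u) u

      -- A vertex of maximum degree contributes d^k w ≥ d^(k+1), by `d≤w`.
      Δ^≤M : ∀ k → Δ ^ suc k ≤ M G k
      Δ^≤M k with proj₂ (proj₂ (attained-max d))
      ... | inj₁ Δ≡0 rewrite Δ≡0 = z≤n
      ... | inj₂ (u , Δ≡d) rewrite Δ≡d = begin
        d u * d u ^ k   ≡⟨ *-comm (d u) (d u ^ k) ⟩
        d u ^ k * d u   ≤⟨ *-monoʳ-≤ (d u ^ k) (d≤w u) ⟩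
        d u ^ k * w u   ≤⟨ term≤∑ (λ u → d u ^ k * w u) u ⟩
        M G k           ∎
        where open ≤-Reasoning

      M-suc≤ : ∀ k {B} → (∀ u → d u ≤ B) → M G (suc k) ≤ B * M G k
      M-suc≤ k {B} d≤B = begin
        M G (suc k)                             ≤⟨ ∑-mono-≤ (λ u → *-monoˡ-≤ (w u) (*-monoˡ-≤ (d u ^ k) (d≤B u))) ⟩
        ∑[ u < order ] (B * d u ^ k * w u)      ≡⟨ ∑-cong (λ u → *-assoc B (d u ^ k) (w u)) ⟩
        ∑[ u < order ] (B * (d u ^ k * w u))    ≡⟨ *-distribˡ-∑ B _ ⟨
        B * M G k                               ∎
        where open ≤-Reasoning

    M0≤M1 : M G 0 ≤ M G 1
    M0≤M1 = ∑-mono-≤ λ u → ≤-trans (≤-reflexive (*-identityˡ (w u)))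
      (≤-trans (w≤dw u) (≤-reflexive (cong (_* w u) (sym (*-identityʳ (d u))))))

    M-log-convex : ∀ k → M G (suc k) ^ 2 ≤ M G k * M G (2+ k)
    M-log-convex k = subst (_≤ M G k * M G (2+ k)) (sym (x^2 (M G (suc k))))
      (cauchy-schwarz _ _ _ λ u → ≤-reflexive (regroup (d u) (d u ^ k) (w u)))
      where
      regroup : ∀ d p w → d * p * w * (d * p * w) ≡ p * w * (d * (d * p) * w)
      regroup = solve-∀

    M-suc≤order : ∀ k → M G (suc k) ≤ order * M G k
    M-suc≤order k = M-suc≤ k d≤order

    M-suc²≤ : ∀ k → M G (suc k) ^ 2 ≤ M G 0 * M G k ^ 2
    M-suc²≤ k = begin
      M G (suc k) ^ 2               ≡⟨ x^2 (M G (suc k)) ⟩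
      M G (suc k) * M G (suc k)     ≤⟨ *-mono-≤ (M-suc≤ k d≤Δ) (M-suc≤ k d≤Δ) ⟩
      Δ * M G k * (Δ * M G k)       ≡⟨ regroup Δ (M G k) ⟩
      Δ * Δ * (M G k * M G k)       ≤⟨ *-monoˡ-≤ _ Δ² ⟩
      S * (M G k * M G k)           ≡⟨ cong₂ _*_ (sym M0≡S) (sym (x^2 (M G k))) ⟩
      M G 0 * M G k ^ 2             ∎
      where
      open ≤-Reasoning
      regroup : ∀ a b → a * b * (a * b) ≡ a * a * (b * b)
      regroup = solve-∀

    -- Each of the k + 1 factors M_{k+1} ≤ Δ M_k costs one Δ, and Δ^(k+1) ≤ M_k pays for all of
    -- them.
    M-suc^≤ : ∀ k → M G (suc k) ^ suc k ≤ M G k ^ 2+ k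
    M-suc^≤ k = begin
      M G (suc k) ^ suc k           ≤⟨ ^-monoˡ-≤ (suc k) (M-suc≤ k d≤Δ) ⟩
      (Δ * M G k) ^ suc k           ≡⟨ ^-distribʳ-* Δ (M G k) (suc k) ⟩
      Δ ^ suc k * M G k ^ suc k     ≤⟨ *-monoˡ-≤ _ (Δ^≤M k) ⟩
      M G k ^ 2+ k                  ∎
      where open ≤-Reasoning

    -- Cauchy-Schwarz for Σ w against the constant 1, with w² ≤ d q. Reversing the edges turns Σ
    -- d(u) q(u) into Σ d(v)² w(v) = M_2.
    M0²≤ : M G 0 ^ 2 ≤ order * M G 2
    M0²≤ = begin
      M G 0 ^ 2                                ≡⟨ x^2 (M G 0) ⟩
      M G 0 * M G 0                            ≡⟨ cong₂ _*_ M0≡∑w M0≡∑w ⟩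
      ∑ w * ∑ w                                ≤⟨ cauchy-schwarz w (λ _ → 1) (λ u → d u * q u)
                                                    (λ u → ≤-trans (w²≤dq u) (≤-reflexive (sym (*-identityˡ _)))) ⟩
      ∑[ _ < order ] 1 * ∑[ u < order ] (d u * q u)
                                               ≡⟨ cong₂ _*_ (trans (∑-const order 1) (*-identityʳ order)) dq ⟩
      order * M G 2                            ∎
      where
      open ≤-Reasoning
      rot : ∀ a b c → a * (b * c) ≡ b * (a * c)
      rot = solve-∀

      rot′ : ∀ a b c → a * (b * b * c) ≡ b * (b * 1) * (a * c)
      rot′ = solve-∀

      dq : ∑[ u < order ] (d u * q u) ≡ M G 2
      dq = begin-equality
        ∑[ u < order ] (d u * q u)
          ≡⟨ ∑-cong (λ u → trans (*-distribˡ-∑ (d u) _) (∑-cong λ v → rot (d u) (A u v) (d v * d v))) ⟩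
        ∑[ u < order ] ∑[ v < order ] (A u v * (d u * (d v * d v)))
          ≡⟨ adj-swap (λ u v → d u * (d v * d v)) ⟩
        ∑[ u < order ] ∑[ v < order ] (A u v * (d v * (d u * d u)))
          ≡⟨ ∑-cong (λ u → trans (∑-cong λ v → trans (cong (A u v *_) (*-comm (d v) (d u * d u))) (rot′ (A u v) (d u) (d v)))
               (sym (*-distribˡ-∑ (d u ^ 2) (λ v → A u v * d v)))) ⟩
        M G 2 ∎

    -- Two applications of Cauchy-Schwarz with B = Σ d² w²: first M_2² ≤ S B, then B² ≤ M_3 · S M_2,
    -- where one w² is replaced by d S. Hence M_2⁴ ≤ M_2 S³ M_3.
    M2³≤ : M G 2 ^ 3 ≤ M G 0 ^ 3 * M G 3
    M2³≤ = subst₂ _≤_ (sym (x^3 (M G 2))) (cong (λ s → s * M G 3) (trans (sym (x^3 S)) (cong (_^ 3) (sym M0≡S)))) (cancel (M G 2) refl)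
      where
      open ≤-Reasoning
      P = M G 2
      B = ∑[ u < order ] (d u * d u * (w u * w u))

      eq₁ : ∀ d w → d * (d * 1) * w * (d * (d * 1) * w) ≡ d * d * (d * d * (w * w))
      eq₁ = solve-∀

      P²≤ : P * P ≤ S * B
      P²≤ = cauchy-schwarz _ _ _ λ u → ≤-reflexive (eq₁ (d u) (w u))

      eq₂ : ∀ d w → d * d * (w * w) * (d * d * (w * w)) ≡ d * (d * (d * (d * (w * w)))) * (w * w)
      eq₂ = solve-∀

      eq₃ : ∀ s d w → d * (d * (d * (d * (w * w)))) * (d * s) ≡ d * (d * (d * 1)) * w * (s * (d * (d * 1) * w))
      eq₃ = solve-∀

      B²≤ : B * B ≤ M G 3 * (S * P)
      B²≤ = ≤-trans (cauchy-schwarz _ _ (λ u → S * (d u ^ 2 * w u)) λ u → begin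
          d u * d u * (w u * w u) * (d u * d u * (w u * w u))     ≡⟨ eq₂ (d u) (w u) ⟩
          d u * (d u * (d u * (d u * (w u * w u)))) * (w u * w u)
            ≤⟨ *-monoʳ-≤ (d u * (d u * (d u * (d u * (w u * w u))))) (w²≤dS u) ⟩
          d u * (d u * (d u * (d u * (w u * w u)))) * (d u * S)   ≡⟨ eq₃ S (d u) (w u) ⟩
          d u ^ 3 * w u * (S * (d u ^ 2 * w u))                   ∎)
        (≤-reflexive (cong (M G 3 *_) (sym (*-distribˡ-∑ S _))))

      eq₄ : ∀ p → p * (p * (p * p)) ≡ p * p * (p * p)
      eq₄ = solve-∀

      eq₅ : ∀ s b → s * b * (s * b) ≡ s * s * (b * b)
      eq₅ = solve-∀

      eq₆ : ∀ s m p → s * s * (m * (s * p)) ≡ p * (s * (s * s) * m)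
      eq₆ = solve-∀

      P⁴≤ : P * (P * (P * P)) ≤ P * (S * (S * S) * M G 3)
      P⁴≤ = begin
        P * (P * (P * P))            ≡⟨ eq₄ P ⟩
        P * P * (P * P)              ≤⟨ *-mono-≤ P²≤ P²≤ ⟩
        S * B * (S * B)              ≡⟨ eq₅ S B ⟩
        S * S * (B * B)              ≤⟨ *-monoʳ-≤ (S * S) B²≤ ⟩
        S * S * (M G 3 * (S * P))    ≡⟨ eq₆ S (M G 3) P ⟩
        P * (S * (S * S) * M G 3)    ∎

      -- The common factor P can be cancelled only when it is positive; for P = 0 the claim is
      -- trivial.
      cancel : ∀ p → p ≡ P → P * (P * P) ≤ S * (S * S) * M G 3
      cancel zero    0≡P = subst (λ p → p * (p * p) ≤ S * (S * S) * M G 3) 0≡P z≤n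
      cancel (suc p) e   = *-cancelˡ-≤ P {{subst NonZero e _}} P⁴≤

    -- With T ≈ S^(1/3), a vertex u of degree at least T has w(u) ≤ T d(u), and a
    -- vertex of smaller degree has d(u)³ ≤ T d(u)².
    M1³≤ : M G 1 ^ 3 ≤ 64 * M G 0 ^ 4
    M1³≤ with approx-∛ S
    ... | T , S≤T³ , T³≤8S = begin
      M G 1 ^ 3                              ≡⟨ x^3 (M G 1) ⟩
      M G 1 * (M G 1 * M G 1)                ≤⟨ *-mono-≤ M1≤ (*-mono-≤ M1≤ M1≤) ⟩
      2 * (T * S) * (2 * (T * S) * (2 * (T * S)))   ≡⟨ eq₁ T S ⟩
      8 * (T * (T * T)) * (S * (S * S))      ≤⟨ *-monoˡ-≤ (S * (S * S)) (*-monoʳ-≤ 8 T³≤8S) ⟩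
      8 * (8 * S) * (S * (S * S))            ≡⟨ eq₂ S ⟩
      64 * (S * (S * (S * (S * 1))))         ≡⟨ cong (λ s → 64 * s ^ 4) M0≡S ⟨
      64 * M G 0 ^ 4                         ∎
      where
      open ≤-Reasoning
      eq₁ : ∀ T S → 2 * (T * S) * (2 * (T * S) * (2 * (T * S))) ≡ 8 * (T * (T * T)) * (S * (S * S))
      eq₁ = solve-∀

      eq₂ : ∀ S → 8 * (8 * S) * (S * (S * S)) ≡ 64 * (S * (S * (S * (S * 1))))
      eq₂ = solve-∀

      heavy light : Fin order → ℕ
      heavy u with T ≤? d u
      ... | yes _ = d u
      ... | no  _ = 0
      light u with T ≤? d u
      ... | yes _ = 0
      ... | no  _ = d u

      -- The product d(u) d(v) over an edge is charged to its ends: a heavy end pays all of it, and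
      -- if both ends are light each pays the square of its own degree.
      P : Fin order → Fin order → ℕ
      P u v = heavy u * d v + light u * light u

      dd≤P+P : ∀ u v → d u * d v ≤ P u v + P v u
      dd≤P+P u v with T ≤? d u | T ≤? d v
      ... | yes _ | _     = ≤-trans (m≤m+n (d u * d v) 0) (m≤m+n _ _)
      ... | no  _ | yes _ = ≤-trans (≤-trans (≤-reflexive (*-comm (d u) (d v))) (m≤m+n _ 0)) (m≤n+m _ (d u * d u))
      ... | no  _ | no  _ = ≤-trans (m≤m*n (d u * d v) 2)
        (≤-trans (≤-reflexive (*-comm (d u * d v) 2)) (2ab≤a²+b² (d u) (d v)))

      regroup₁ : ∀ d T → d * (T * (T * T)) ≡ d * T * (T * T)
      regroup₁ = solve-∀

      regroup₂ : ∀ d T → d * d * (T * T) ≡ d * T * (d * T)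
      regroup₂ = solve-∀

      regroup₃ : ∀ d T → d * (d * T) ≡ T * (d * d)
      regroup₃ = solve-∀

      regroup₄ : ∀ d T → d * d * T ≡ T * (d * d)
      regroup₄ = solve-∀

      w≤dT : ∀ u → T ≤ d u → w u ≤ d u * T
      w≤dT u T≤d = m*m≤n*n⇒m≤n (begin
        w u * w u                  ≤⟨ w²≤dS u ⟩
        d u * S                    ≤⟨ *-monoʳ-≤ (d u) S≤T³ ⟩
        d u * (T * (T * T))        ≡⟨ regroup₁ (d u) T ⟩
        d u * T * (T * T)          ≤⟨ *-monoˡ-≤ (T * T) (*-monoʳ-≤ (d u) T≤d) ⟩
        d u * d u * (T * T)        ≡⟨ regroup₂ (d u) T ⟩
        d u * T * (d u * T)        ∎)

      row : ∀ u → heavy u * w u + light u * light u * d u ≤ T * (d u * d u)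
      row u with T ≤? d u
      ... | yes T≤d = begin
        d u * w u + 0    ≡⟨ +-identityʳ (d u * w u) ⟩
        d u * w u        ≤⟨ *-monoʳ-≤ (d u) (w≤dT u T≤d) ⟩
        d u * (d u * T)  ≡⟨ regroup₃ (d u) T ⟩
        T * (d u * d u)  ∎
      ... | no  T≰d = begin
        d u * d u * d u  ≤⟨ *-monoʳ-≤ (d u * d u) (<⇒≤ (≰⇒> T≰d)) ⟩
        d u * d u * T    ≡⟨ regroup₄ (d u) T ⟩
        T * (d u * d u)  ∎

      regroup₅ : ∀ a h d l → a * (h * d + l) ≡ h * (a * d) + l * a
      regroup₅ = solve-∀

      regroup₆ : ∀ d a e → d * 1 * (a * e) ≡ a * (d * e)
      regroup₆ = solve-∀

      ∑AP : ∑[ u < order ] ∑[ v < order ] (A u v * P u v) ≤ T * S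
      ∑AP = begin
        ∑[ u < order ] ∑[ v < order ] (A u v * P u v)
          ≡⟨ ∑-cong (λ u → trans (∑-cong λ v → regroup₅ (A u v) (heavy u) (d v) (light u * light u))
               (trans (∑-distrib-+ (λ v → heavy u * (A u v * d v)) (λ v → light u * light u * A u v))
                 (sym (cong₂ _+_ (*-distribˡ-∑ (heavy u) _) (*-distribˡ-∑ (light u * light u) _))))) ⟩
        ∑[ u < order ] (heavy u * w u + light u * light u * d u)
          ≤⟨ ∑-mono-≤ row ⟩
        ∑[ u < order ] (T * (d u * d u))
          ≡⟨ *-distribˡ-∑ T _ ⟨
        T * S ∎

      M1≤ : M G 1 ≤ 2 * (T * S)
      M1≤ = begin
        M G 1
          ≡⟨ ∑-cong (λ u → trans (*-distribˡ-∑ (d u ^ 1) _) (∑-cong λ v → regroup₆ (d u) (A u v) (d v))) ⟩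
        ∑[ u < order ] ∑[ v < order ] (A u v * (d u * d v))
          ≤⟨ ∑-mono-≤ (λ u → ∑-mono-≤ λ v → *-monoʳ-≤ (A u v) (dd≤P+P u v)) ⟩
        ∑[ u < order ] ∑[ v < order ] (A u v * (P u v + P v u))
          ≡⟨ ∑-cong (λ u → trans (∑-cong λ v → *-distribˡ-+ (A u v) (P u v) (P v u))
               (∑-distrib-+ (λ v → A u v * P u v) (λ v → A u v * P v u))) ⟩
        ∑[ u < order ] (∑[ v < order ] (A u v * P u v) + ∑[ v < order ] (A u v * P v u))
          ≡⟨ ∑-distrib-+ (λ u → ∑[ v < order ] (A u v * P u v)) (λ u → ∑[ v < order ] (A u v * P v u)) ⟩
        ∑[ u < order ] ∑[ v < order ] (A u v * P u v) + ∑[ u < order ] ∑[ v < order ] (A u v * P v u)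
          ≡⟨ cong (∑[ u < order ] ∑[ v < order ] (A u v * P u v) +_) (adj-swap P) ⟨
        ∑[ u < order ] ∑[ v < order ] (A u v * P u v) + ∑[ u < order ] ∑[ v < order ] (A u v * P u v)
          ≤⟨ +-mono-≤ ∑AP ∑AP ⟩
        T * S + T * S
          ≡⟨ cong (T * S +_) (+-identityʳ (T * S)) ⟨
        2 * (T * S) ∎

-- Disjoint unions and the three-layer graph

module GraphConstructions where

  open FiniteSums
  open HomCount
  open import Data.Nat.Base
  open import Data.Nat.Properties
  open import Data.Empty using (⊥)
  open import Data.Fin.Base using (Fin; zero; suc; splitAt; remQuot)
  import Data.Fin.Properties as Fin
  open import Data.Product.Base using (_×_; _,_)
  open import Data.Sum.Base using (_⊎_; inj₁; inj₂) renaming (map to ⊎-map; map₂ to ⊎-map₂)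
  open import Data.Unit.Base using (⊤; tt)
  open import Function.Base using (_∘_; id)
  open import Relation.Binary.Core using (Rel)
  open import Relation.Binary.Definitions using (Symmetric; Decidable)
  open import Relation.Binary.PropositionalEquality
  open import Relation.Nullary using (yes; no; ¬_)
  open import Level using (0ℓ)
  open import Defs using (Graph)

  -- M k and the order are the cases F d w = d ^ k * w and F d w = 1.
  Φ : Graph → (ℕ → ℕ → ℕ) → ℕ
  Φ G F = ∑[ u < Graph.order G ] F (deg G u) (walks₂ G u)

  Φ-order : ∀ G → Φ G (λ _ _ → 1) ≡ Graph.order G
  Φ-order G = trans (∑-const (Graph.order G) 1) (*-identityʳ _)

  private
    ∑-zero′ : ∀ n {f : Fin n → ℕ} → (∀ i → f i ≡ 0) → ∑ f ≡ 0
    ∑-zero′ n f≡0 = trans (∑-cong f≡0) (trans (∑-const n 0) (*-zeroʳ n))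

    ∑-const′ : ∀ n {c} {f : Fin n → ℕ} → (∀ i → f i ≡ c) → ∑ f ≡ n * c
    ∑-const′ n f≡c = trans (∑-cong f≡c) (∑-const n _)

    ∑-δ : ∀ {n} (i : Fin n) c → ∑[ j < n ] (⟦ i Fin.≟ j ⟧ * c) ≡ c
    ∑-δ {suc n} zero c = trans (∑-suc _)
      (trans (cong₂ _+_ (*-identityˡ c) (∑-zero′ n λ _ → refl)) (+-identityʳ c))
    ∑-δ {suc n} (suc i) c = trans (∑-suc _) (trans (∑-cong λ j →
      cong (_* c) (⟦⟧-cong (suc i Fin.≟ suc j) (i Fin.≟ j) Fin.suc-injective (cong suc))) (∑-δ i c))

  edgeless : ℕ → Graph
  edgeless n = record
    { order = n ; _~_ = λ _ _ → ⊥ ; ~-sym = id ; ~-irrefl = λ _ () ; _~?_ = λ _ _ → no id }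

  Φ-edgeless : ∀ n F → Φ (edgeless n) F ≡ n * F 0 0
  Φ-edgeless n F = ∑-const′ n λ u → cong₂ F (∑-zero′ n λ _ → refl) (∑-zero′ n λ _ → refl)

  module _ (G H : Graph) where
    private
      module G = Graph G
      module H = Graph H

      X : Set
      X = Fin G.order ⊎ Fin H.order

      -- Adjacency is defined on the structured vertex set and pulled back along `decode`, so that
      -- sums over vertices split along the constructors of `X`.
      _≈_ : Rel X 0ℓ
      inj₁ u ≈ inj₁ v = u G.~ v
      inj₂ u ≈ inj₂ v = u H.~ v
      inj₁ _ ≈ inj₂ _ = ⊥
      inj₂ _ ≈ inj₁ _ = ⊥

      ≈-sym : Symmetric _≈_
      ≈-sym {inj₁ _} {inj₁ _} = G.~-sym
      ≈-sym {inj₂ _} {inj₂ _} = H.~-sym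

      ≈-irrefl : ∀ x → ¬ x ≈ x
      ≈-irrefl (inj₁ u) = G.~-irrefl refl
      ≈-irrefl (inj₂ u) = H.~-irrefl refl

      _≈?_ : Decidable _≈_
      inj₁ u ≈? inj₁ v = u G.~? v
      inj₂ u ≈? inj₂ v = u H.~? v
      inj₁ _ ≈? inj₂ _ = no id
      inj₂ _ ≈? inj₁ _ = no id

      decode : Fin (G.order + H.order) → X
      decode = splitAt G.order

    disjointUnion : Graph
    disjointUnion = record
      { order    = G.order + H.order
      ; _~_      = λ u v → decode u ≈ decode v
      ; ~-sym    = λ {u} {v} → ≈-sym {decode u} {decode v}
      ; ~-irrefl = λ { {u} refl → ≈-irrefl (decode u) }
      ; _~?_     = λ u v → decode u ≈? decode v
      }

    private
      deg′ : X → ℕ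
      deg′ x = ∑ λ v → ⟦ x ≈? decode v ⟧

      walks₂′ : X → ℕ
      walks₂′ x = ∑ λ v → ⟦ x ≈? decode v ⟧ * deg′ (decode v)

      deg-inj₁ : ∀ u → deg′ (inj₁ u) ≡ deg G u
      deg-inj₁ u = trans (∑-splitAt G.order λ y → ⟦ inj₁ u ≈? y ⟧)
        (trans (cong (deg G u +_) (∑-zero′ H.order λ _ → refl)) (+-identityʳ _))

      deg-inj₂ : ∀ u → deg′ (inj₂ u) ≡ deg H u
      deg-inj₂ u = trans (∑-splitAt G.order λ y → ⟦ inj₂ u ≈? y ⟧)
        (cong (_+ deg H u) (∑-zero′ G.order λ _ → refl))

      walks₂-inj₁ : ∀ u → walks₂′ (inj₁ u) ≡ walks₂ G u
      walks₂-inj₁ u = trans (∑-splitAt G.order λ y → ⟦ inj₁ u ≈? y ⟧ * deg′ y)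
        (trans (cong₂ _+_ (∑-cong λ v → cong (adj G u v *_) (deg-inj₁ v)) (∑-zero′ H.order λ _ → refl)) (+-identityʳ _))

      walks₂-inj₂ : ∀ u → walks₂′ (inj₂ u) ≡ walks₂ H u
      walks₂-inj₂ u = trans (∑-splitAt G.order λ y → ⟦ inj₂ u ≈? y ⟧ * deg′ y)
        (cong₂ _+_ (∑-zero′ G.order λ _ → refl) (∑-cong λ v → cong (adj H u v *_) (deg-inj₂ v)))

    Φ-disjointUnion : ∀ F → Φ disjointUnion F ≡ Φ G F + Φ H F
    Φ-disjointUnion F = trans (∑-splitAt G.order λ x → F (deg′ x) (walks₂′ x))
      (cong₂ _+_ (∑-cong λ u → cong₂ F (deg-inj₁ u) (walks₂-inj₁ u))
                 (∑-cong λ u → cong₂ F (deg-inj₂ u) (walks₂-inj₂ u)))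

  ⨆ : ∀ {n} → (Fin n → Graph) → Graph
  ⨆ {zero}  G = edgeless 0
  ⨆ {suc n} G = disjointUnion (G zero) (⨆ (G ∘ suc))

  Φ-⨆ : ∀ {n} (G : Fin n → Graph) F → Φ (⨆ G) F ≡ ∑ (λ i → Φ (G i) F)
  Φ-⨆ {zero}  G F = trans (∑-zero _) (sym (∑-zero _))
  Φ-⨆ {suc n} G F = trans (Φ-disjointUnion (G zero) (⨆ (G ∘ suc)) F)
    (trans (cong (Φ (G zero) F +_) (Φ-⨆ (G ∘ suc) F)) (sym (∑-suc _)))

  copies : ℕ → Graph → Graph
  copies n G = ⨆ {n} λ _ → G

  Φ-copies : ∀ n G F → Φ (copies n G) F ≡ n * Φ G F
  Φ-copies n G F = trans (Φ-⨆ {n} (λ _ → G) F) (∑-const n _)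

  -- g disjoint copies of K_{f,e}, together with a further vertices joined to
  -- every vertex on the f-side of every copy.
  module _ (a g f e : ℕ) where
    private
      pattern top x   = inj₁ x
      pattern mid i x = inj₂ (inj₁ (i , x))
      pattern bot i x = inj₂ (inj₂ (i , x))

      X : Set
      X = Fin a ⊎ (Fin g × Fin f ⊎ Fin g × Fin e)

      _≈_ : Rel X 0ℓ
      top _   ≈ mid _ _ = ⊤
      mid _ _ ≈ top _   = ⊤
      mid i _ ≈ bot j _ = i ≡ j
      bot i _ ≈ mid j _ = i ≡ j
      top _   ≈ top _   = ⊥
      top _   ≈ bot _ _ = ⊥
      mid _ _ ≈ mid _ _ = ⊥
      bot _ _ ≈ top _   = ⊥
      bot _ _ ≈ bot _ _ = ⊥

      ≈-sym : Symmetric _≈_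
      ≈-sym {top _}   {mid _ _} = id
      ≈-sym {mid _ _} {top _}   = id
      ≈-sym {mid _ _} {bot _ _} = sym
      ≈-sym {bot _ _} {mid _ _} = sym

      ≈-irrefl : ∀ x → ¬ x ≈ x
      ≈-irrefl (top _)   ()
      ≈-irrefl (mid _ _) ()
      ≈-irrefl (bot _ _) ()

      _≈?_ : Decidable _≈_
      top _   ≈? mid _ _ = yes tt
      mid _ _ ≈? top _   = yes tt
      mid i _ ≈? bot j _ = i Fin.≟ j
      bot i _ ≈? mid j _ = i Fin.≟ j
      top _   ≈? top _   = no id
      top _   ≈? bot _ _ = no id
      mid _ _ ≈? mid _ _ = no id
      bot _ _ ≈? top _   = no id
      bot _ _ ≈? bot _ _ = no id

      decode : Fin (a + (g * f + g * e)) → X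
      decode = ⊎-map₂ (⊎-map (remQuot f) (remQuot e) ∘ splitAt (g * f)) ∘ splitAt a

      ∑-decode : ∀ (h : X → ℕ) → ∑ (h ∘ decode) ≡
        ∑ (λ x → h (top x)) +
        (∑[ i < g ] ∑[ x < f ] h (mid i x) + ∑[ i < g ] ∑[ x < e ] h (bot i x))
      ∑-decode h = trans (∑-splitAt a (h ∘ ⊎-map₂ (⊎-map (remQuot f) (remQuot e) ∘ splitAt (g * f))))
        (cong (∑ (h ∘ inj₁) +_) (trans (∑-splitAt (g * f) (h ∘ inj₂ ∘ ⊎-map (remQuot f) (remQuot e)))
          (cong₂ _+_ (∑-remQuot g f (h ∘ inj₂ ∘ inj₁)) (∑-remQuot g e (h ∘ inj₂ ∘ inj₂)))))

      ∑∑-const : ∀ m n {c} {h : Fin m → Fin n → ℕ} → (∀ i j → h i j ≡ c) →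
        ∑[ i < m ] ∑[ j < n ] h i j ≡ m * (n * c)
      ∑∑-const m n h≡c = ∑-const′ m λ i → ∑-const′ n (h≡c i)

      ∑∑-zero : ∀ m n {h : Fin m → Fin n → ℕ} → (∀ i j → h i j ≡ 0) → ∑[ i < m ] ∑[ j < n ] h i j ≡ 0
      ∑∑-zero m n h≡0 = ∑-zero′ m λ i → ∑-zero′ n (h≡0 i)

      ∑∑-δ : ∀ (i : Fin g) n {c} {h : Fin n → ℕ} → (∀ y → h y ≡ c) →
        ∑[ j < g ] ∑[ y < n ] (⟦ i Fin.≟ j ⟧ * h y) ≡ n * c
      ∑∑-δ i n h≡c = trans (∑-cong λ j →
        trans (sym (*-distribˡ-∑ ⟦ i Fin.≟ j ⟧ _)) (cong (⟦ i Fin.≟ j ⟧ *_) (∑-const′ n h≡c))) (∑-δ i _)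

    core : Graph
    core = record
      { order    = a + (g * f + g * e)
      ; _~_      = λ u v → decode u ≈ decode v
      ; ~-sym    = λ {u} {v} → ≈-sym {decode u} {decode v}
      ; ~-irrefl = λ { {u} refl → ≈-irrefl (decode u) }
      ; _~?_     = λ u v → decode u ≈? decode v
      }

    private
      deg′ : X → ℕ
      deg′ x = ∑ λ v → ⟦ x ≈? decode v ⟧

      walks₂′ : X → ℕ
      walks₂′ x = ∑ λ v → ⟦ x ≈? decode v ⟧ * deg′ (decode v)

      deg-top : ∀ x → deg′ (top x) ≡ g * f
      deg-top x = trans (∑-decode λ y → ⟦ top x ≈? y ⟧)
        (cong₂ _+_ (∑-zero′ a λ _ → refl)
          (trans (cong₂ _+_ (trans (∑∑-const g f λ _ _ → refl) (cong (g *_) (*-identityʳ f)))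
                            (∑∑-zero g e λ _ _ → refl))
                 (+-identityʳ (g * f))))

      deg-mid : ∀ i x → deg′ (mid i x) ≡ a + e
      deg-mid i x = trans (∑-decode λ y → ⟦ mid i x ≈? y ⟧)
        (cong₂ _+_ (trans (∑-const′ a λ _ → refl) (*-identityʳ a))
          (cong₂ _+_ (∑∑-zero g f λ _ _ → refl)
            (trans (∑-cong λ j → ∑-cong λ y → sym (*-identityʳ ⟦ i Fin.≟ j ⟧))
              (trans (∑∑-δ i e λ _ → refl) (*-identityʳ e)))))

      deg-bot : ∀ i x → deg′ (bot i x) ≡ f
      deg-bot i x = trans (∑-decode λ y → ⟦ bot i x ≈? y ⟧)
        (cong₂ _+_ (∑-zero′ a λ _ → refl)
          (trans (cong₂ _+_ (trans (∑-cong λ j → ∑-cong λ y → sym (*-identityʳ ⟦ i Fin.≟ j ⟧))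
                               (trans (∑∑-δ i f λ _ → refl) (*-identityʳ f)))
                            (∑∑-zero g e λ _ _ → refl))
                 (+-identityʳ f)))

      walks₂-top : ∀ x → walks₂′ (top x) ≡ g * (f * (a + e))
      walks₂-top x = trans (∑-decode λ y → ⟦ top x ≈? y ⟧ * deg′ y)
        (cong₂ _+_ (∑-zero′ a λ _ → refl)
          (trans (cong₂ _+_ (∑∑-const g f λ j y → trans (*-identityˡ _) (deg-mid j y))
                            (∑∑-zero g e λ _ _ → refl))
                 (+-identityʳ _)))

      walks₂-mid : ∀ i x → walks₂′ (mid i x) ≡ a * (g * f) + e * f
      walks₂-mid i x = trans (∑-decode λ y → ⟦ mid i x ≈? y ⟧ * deg′ y)
        (cong₂ _+_ (∑-const′ a λ y → trans (*-identityˡ _) (deg-top y))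
          (cong₂ _+_ (∑∑-zero g f λ _ _ → refl)
            (trans (∑-cong λ j → ∑-cong λ y → cong (⟦ i Fin.≟ j ⟧ *_) (deg-bot j y))
              (∑∑-δ i e λ _ → refl))))

      walks₂-bot : ∀ i x → walks₂′ (bot i x) ≡ f * (a + e)
      walks₂-bot i x = trans (∑-decode λ y → ⟦ bot i x ≈? y ⟧ * deg′ y)
        (cong₂ _+_ (∑-zero′ a λ _ → refl)
          (trans (cong₂ _+_ (trans (∑-cong λ j → ∑-cong λ y → cong (⟦ i Fin.≟ j ⟧ *_) (deg-mid j y))
                               (∑∑-δ i f λ _ → refl))
                            (∑∑-zero g e λ _ _ → refl))
                 (+-identityʳ _)))

    Φ-core : ∀ F → Φ core F ≡
      a * F (g * f) (g * (f * (a + e))) +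
      (g * (f * F (a + e) (a * (g * f) + e * f)) + g * (e * F f (f * (a + e))))
    Φ-core F = trans (∑-decode λ x → F (deg′ x) (walks₂′ x))
      (cong₂ _+_ (∑-const′ a λ x → cong₂ F (deg-top x) (walks₂-top x))
        (cong₂ _+_ (∑∑-const g f λ i x → cong₂ F (deg-mid i x) (walks₂-mid i x))
                   (∑∑-const g e λ i x → cong₂ F (deg-bot i x) (walks₂-bot i x))))

-- Choice of the exponents: supporting lines and the blocks that realise them

module Exponents where

  open import Data.Nat.Base
  open import Data.Nat.Properties
  open import Data.Nat.Tactic.RingSolver using (solve; solve-∀)
  open import Data.List.Base using ([]; _∷_)
  open import Data.Product.Base using (∃; _×_; _,_)
  open import Data.Sum.Base using (_⊎_; inj₁; inj₂)
  open import Relation.Binary.PropositionalEquality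
  open import Relation.Nullary using (yes; no)

  private
    infixr 5 _⊕_
    _⊕_ : ∀ {a b c d} → a ≤ b → c ≤ d → a + c ≤ b + d
    _⊕_ = +-mono-≤

    _⊗_ : ∀ k {a b} → a ≤ b → k * a ≤ k * b
    k ⊗ p = *-monoʳ-≤ k p

    -- Certificate for a linear inequality over ℕ: once the right combination l ≤ r of known
    -- inequalities is given, what remains is a ring identity, with r and l moved across to avoid
    -- subtraction.
    by : ∀ {x y l r} → l ≤ r → x + r ≡ y + l → x ≤ y
    by {x} {y} {l} {r} l≤r e = +-cancelʳ-≤ r x y (≤-trans (≤-reflexive e) (+-monoʳ-≤ y l≤r))

    -- Naming the difference keeps truncated subtraction away from the ring solver.
    split : ∀ {a b} → a ≤ b → ∃ λ d → b ≡ a + d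
    split {a} {b} p = b ∸ a , sym (m+[n∸m]≡n p)

  -- The inequalities of Q for m = K + 2, with ν = y₀ and Y k = y_{k+1}.
  record QNat (K ν : ℕ) (Y : ℕ → ℕ) : Set where
    field
      K≥2    : 2 ≤ K
      ineq₁  : Y 0 ≤ Y 1
      ineq₂  : 3 * Y 1 ≤ 4 * Y 0
      ineq₃  : 3 * Y 2 ≤ 3 * Y 0 + Y 3
      ineq₄  : 2 * Y (suc K) ≤ Y 0 + 2 * Y K
      ineq₅  : Y (suc K) ≤ ν + Y K
      ineq₆  : 2 * Y 0 ≤ ν + Y 2
      ineq₇  : ∀ i → i < K → 2 * Y (suc i) ≤ Y i + Y (2+ i)
      ineq₈  : suc K * Y (suc K) ≤ (2+ K) * Y K

  -- For a large n, the block stands for n^α copies of core n^a n^g n^f n^e.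
  record Block : Set where
    constructor block
    field α a g f e : ℕ

    -- exponents of the contributions to M l of the three kinds of vertices
    top mid₁ mid₂ bot : ℕ → ℕ
    top  l = α + a + l * (g + f) + (g + f + e)
    mid₁ l = α + (g + f) + l * e + (a + (g + f))
    mid₂ l = α + (g + f) + l * e + (e + f)
    bot  l = α + (g + e) + l * f + (f + e)

  -- `a≤e` makes n^a + n^e of order n^e; the exponents in `Block` presuppose this.
  record Fits (L ν : ℕ) (Y : ℕ → ℕ) (b : Block) : Set where
    open Block b
    field
      a≤e       : a ≤ e
      top-order : α + a ≤ ν
      mid-order : α + (g + f) ≤ ν
      bot-order : α + (g + e) ≤ ν
      top≤      : ∀ l → l ≤ L → top l ≤ Y l
      mid₁≤     : ∀ l → l ≤ L → mid₁ l ≤ Y l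
      mid₂≤     : ∀ l → l ≤ L → mid₂ l ≤ Y l
      bot≤      : ∀ l → l ≤ L → bot l ≤ Y l

  -- Line blocks touch Y with their top vertices, the initial block with its middle vertices.
  Hits : (ℕ → ℕ) → Block → ℕ → Set
  Hits Y b l = Y l ≤ Block.top b l ⊎ Y l ≤ Block.mid₁ b l

  private
    -- n^s is going to be the degree of the top vertices, so `s≤ν` and `2s≤Y₀` reflect Δ ≤ order and
    -- Δ² ≤ M_0. `c≤Y₀` and `s≤c` concern the values c and c - s of the line at 0 and -1.
    -- `2c+3s≤3Y₀` becomes 2z ≤ s + x in the steep case of `lineBlock`, and `c≤ν+2s` limits the
    -- number of copies in the flat case.
    record LineBounds (ν Y₀ c s : ℕ) : Set where
      field
        s≤ν      : s ≤ ν
        2s≤Y₀    : 2 * s ≤ Y₀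
        c≤Y₀     : c ≤ Y₀
        s≤c      : s ≤ c
        2c+3s≤3Y₀ : 2 * c + 3 * s ≤ 3 * Y₀
        c≤ν+2s   : c ≤ ν + 2 * s

    -- Blocks that realise the line l ↦ c + l s.  Their exponents are doubled,
    -- because one of them would otherwise be (c − s) / 2.
    record LineBlock (ν Y₀ c s : ℕ) : Set where
      field
        α a g f e : ℕ
        slope  : g + f ≡ 2 * s
        height : α + a + (g + f) + e ≡ 2 * c
        e≤gf   : e ≤ g + f
        e+f≤   : e + f ≤ a + (g + f)
        a≤e    : a ≤ e
        M₀-mid : α + a + 2 * (g + f) ≤ 2 * Y₀
        M₀-bot : α + (g + f) + 2 * e ≤ 2 * Y₀
        N-mid  : α + (g + f) ≤ 2 * ν
        N-bot  : α + (g + e) ≤ 2 * ν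

    -- Complete bipartite graphs work if 3s ≤ c or c + 3s ≤ 2 Y₀. Otherwise the middle vertices
    -- would overload M_0: `a` is lowered until they just fit, `e` is raised to keep the height, and
    -- then `e+f≤`, which amounts to e ≤ a + g, calls for several parts.
    lineBlock : ∀ ν Y₀ c s → LineBounds ν Y₀ c s → LineBlock ν Y₀ c s
    lineBlock ν Y₀ c s B with 3 * s ≤? c
    ... | yes 3s≤c with split 3s≤c
    -- n^(2t) complete bipartite graphs with sides of order n^(2s): as g = 0, the layers of
    -- exponents `a` and `e` are joined to the same vertices and form one side.
    ...   | t , refl = record
      { α = 2 * t ; a = 2 * s ; g = 0 ; f = 2 * s ; e = 2 * s
      ; slope  = refl
      ; height = solve (t ∷ s ∷ [])
      ; e≤gf   = ≤-refl
      ; e+f≤   = ≤-refl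
      ; a≤e    = ≤-refl
      ; M₀-mid = by (2 ⊗ c≤Y₀) (solve (t ∷ s ∷ Y₀ ∷ []))
      ; M₀-bot = by (2 ⊗ c≤Y₀) (solve (t ∷ s ∷ Y₀ ∷ []))
      ; N-mid  = by (2 ⊗ c≤ν+2s) (solve (t ∷ s ∷ ν ∷ []))
      ; N-bot  = by (2 ⊗ c≤ν+2s) (solve (t ∷ s ∷ ν ∷ []))
      }
      where open LineBounds B
    lineBlock ν Y₀ c s B | no 3s≰c with c + 3 * s ≤? 2 * Y₀
    ... | yes c+3s≤2Y₀ with split (LineBounds.s≤c B)
    -- A single complete bipartite graph. The remainder 2 (c - s) of the height is shared equally by
    -- `a` and `e`; here halves would appear without the doubling.
    ...   | r , refl = record
      { α = 0 ; a = r ; g = 0 ; f = 2 * s ; e = r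
      ; slope  = refl
      ; height = solve (r ∷ s ∷ [])
      ; e≤gf   = r≤2s
      ; e+f≤   = ≤-refl
      ; a≤e    = ≤-refl
      ; M₀-mid = by c+3s≤2Y₀ (solve (r ∷ s ∷ Y₀ ∷ []))
      ; M₀-bot = by (2 ⊗ c≤Y₀) (solve (r ∷ s ∷ Y₀ ∷ []))
      ; N-mid  = 2 ⊗ s≤ν
      ; N-bot  = ≤-trans r≤2s (2 ⊗ s≤ν)
      }
      where
      open LineBounds B
      r≤2s : r ≤ 2 * s
      r≤2s = by (<⇒≤ (≰⇒> 3s≰c)) (solve (r ∷ s ∷ []))
    -- x = Y₀ - 2s makes `M₀-mid` an equality for a = 2x, and z = c + s - Y₀ is what `height` then
    -- requires for e = 2z.
    lineBlock ν Y₀ c s B | no 3s≰c | no c+3s≰2Y₀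
      with split (LineBounds.2s≤Y₀ B)
    ... | x , refl = at-z (split (by {2 * s + x} {c + s} (<⇒≤ (≰⇒> c+3s≰2Y₀) ⊕ LineBounds.2s≤Y₀ B) (solve (s ∷ x ∷ c ∷ []))))
      where
      open LineBounds B
      at-z : (∃ λ z → c + s ≡ 2 * s + x + z) → LineBlock ν (2 * s + x) c s
      at-z (z , e) = subst (λ c → LineBlock ν (2 * s + x) c s) (sym c≡) result
        where
        c≡ : c ≡ s + x + z
        c≡ = +-cancelʳ-≡ s c (s + x + z) (trans e (solve (s ∷ x ∷ z ∷ [])))

        z≤s : z ≤ s
        z≤s = by (subst (_≤ 2 * s + x) c≡ c≤Y₀) (solve (s ∷ x ∷ z ∷ []))

        2z≤s+x : 2 * z ≤ s + x
        2z≤s+x = by (subst (λ c → 2 * c + 3 * s ≤ 3 * (2 * s + x)) c≡ 2c+3s≤3Y₀) (solve (s ∷ x ∷ z ∷ []))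

        x≤z : x ≤ z
        x≤z = by (<⇒≤ (subst (λ c → 2 * (2 * s + x) < c + 3 * s) c≡ (≰⇒> c+3s≰2Y₀))) (solve (s ∷ x ∷ z ∷ []))

        result : LineBlock ν (2 * s + x) (s + x + z) s
        result with z + s ≤? ν
        -- The whole slope goes into `g`: n^(2s) stars whose centres are joined to n^(2x) common
        -- vertices.
        ... | yes z+s≤ν = record
          { α = 0 ; a = 2 * x ; g = 2 * s ; f = 0 ; e = 2 * z
          ; slope  = +-identityʳ _
          ; height = solve (s ∷ x ∷ z ∷ [])
          ; e≤gf   = by (2 ⊗ z≤s) (solve (s ∷ z ∷ []))
          ; e+f≤   = by (2 ⊗ z≤s ⊕ z≤n {2 * x}) (solve (s ∷ x ∷ z ∷ []))
          ; a≤e    = 2 ⊗ x≤z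
          ; M₀-mid = by (≤-refl {0}) (solve (s ∷ x ∷ []))
          ; M₀-bot = by (2 ⊗ 2z≤s+x) (solve (s ∷ x ∷ z ∷ []))
          ; N-mid  = by (2 ⊗ s≤ν) (solve (s ∷ ν ∷ []))
          ; N-bot  = by (2 ⊗ z+s≤ν) (solve (s ∷ z ∷ ν ∷ []))
          }
        -- The leaves of that many stars would exceed the order. Hence `g` is capped at 2γ with γ =
        -- ν - z, where `N-bot` is an equality, and `f` supplies the rest of the slope.
        ... | no z+s≰ν = at-γ (split (≤-trans z≤s s≤ν))
          where
          at-γ : (∃ λ γ → ν ≡ z + γ) → LineBlock ν (2 * s + x) (s + x + z) s
          at-γ (γ , refl) = at-φ (split (+-cancelˡ-≤ z γ s (<⇒≤ (≰⇒> z+s≰ν))))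
            where
            at-φ : (∃ λ φ → s ≡ γ + φ) → LineBlock (z + γ) (2 * s + x) (s + x + z) s
            at-φ (φ , refl) = record
              { α = 0 ; a = 2 * x ; g = 2 * γ ; f = 2 * φ ; e = 2 * z
              ; slope  = solve (γ ∷ φ ∷ [])
              ; height = solve (x ∷ γ ∷ φ ∷ z ∷ [])
              ; e≤gf   = by (2 ⊗ z≤s) (solve (γ ∷ φ ∷ z ∷ []))
              ; e+f≤   = by (2 ⊗ 2z≤s+x ⊕ 2 ⊗ s≤ν) (solve (x ∷ γ ∷ φ ∷ z ∷ []))
              ; a≤e    = 2 ⊗ x≤z
              ; M₀-mid = by (≤-refl {0}) (solve (x ∷ γ ∷ φ ∷ []))
              ; M₀-bot = by (2 ⊗ 2z≤s+x) (solve (x ∷ γ ∷ φ ∷ z ∷ []))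
              ; N-mid  = by (2 ⊗ s≤ν) (solve (γ ∷ φ ∷ z ∷ []))
              ; N-bot  = by (≤-refl {0}) (solve (γ ∷ z ∷ []))
              }

    -- The top layer lies on the line by `slope` and `height`. For l ≥ 1 the other layers stay below
    -- it by `e≤gf` and `e+f≤`; at l = 0 they may lie above the line, hence the separate bounds
    -- `M₀-mid` and `M₀-bot`.
    fits : ∀ {ν c s L} {Y : ℕ → ℕ} (b : LineBlock ν (Y 0) c s) →
      (∀ l → l ≤ L → c + l * s ≤ Y l) →
      Fits L (2 * ν) (λ l → 2 * Y l) (block (LineBlock.α b) (LineBlock.a b) (LineBlock.g b) (LineBlock.f b) (LineBlock.e b))
    fits {ν} {c} {s} {L} {Y}
      record { α = α ; a = a ; g = g ; f = f ; e = e ; slope = slope ; height = height ; e≤gf = e≤gf ; e+f≤ = e+f≤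
             ; a≤e = a≤e ; M₀-mid = M₀-mid ; M₀-bot = M₀-bot ; N-mid = N-mid ; N-bot = N-bot } support = record
      { a≤e       = a≤e
      ; top-order = ≤-trans (+-monoʳ-≤ α (≤-trans a≤e e≤gf)) N-mid
      ; mid-order = N-mid
      ; bot-order = N-bot
      ; top≤      = λ l l≤L → ≤-trans (≤-reflexive (top≡ l)) (2 ⊗ support l l≤L)
      ; mid₁≤     = mid₁≤
      ; mid₂≤     = λ l l≤L → ≤-trans (+-monoʳ-≤ (α + (g + f) + l * e) e+f≤) (mid₁≤ l l≤L)
      ; bot≤      = bot≤
      }
      where
      B : Block
      B = block α a g f e

      top≡ : ∀ l → Block.top B l ≡ 2 * (c + l * s)
      top≡ l = begin
        α + a + l * (g + f) + (g + f + e)   ≡⟨ solve (α ∷ a ∷ l ∷ g ∷ f ∷ e ∷ []) ⟩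
        α + a + (g + f) + e + l * (g + f)   ≡⟨ cong₂ (λ x y → x + l * y) height slope ⟩
        2 * c + l * (2 * s)                 ≡⟨ solve (c ∷ l ∷ s ∷ []) ⟩
        2 * (c + l * s)                     ∎
        where open ≡-Reasoning

      mid₁≤ : ∀ l → l ≤ L → Block.mid₁ B l ≤ 2 * Y l
      mid₁≤ zero _ = ≤-trans (≤-reflexive (eq α a (g + f) e)) M₀-mid
        where
        eq : ∀ α a s e → α + s + 0 * e + (a + s) ≡ α + a + 2 * s
        eq = solve-∀
      mid₁≤ (suc k) k<L = ≤-trans mid≤top
        (≤-trans (≤-reflexive (top≡ (suc k))) (2 ⊗ support (suc k) k<L))
        where
        mid≤top : α + (g + f) + suc k * e + (a + (g + f)) ≤ α + a + suc k * (g + f) + (g + f + e)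
        mid≤top = by (k ⊗ e≤gf) (solve (α ∷ a ∷ k ∷ g ∷ f ∷ e ∷ []))

      bot≤ : ∀ l → l ≤ L → Block.bot B l ≤ 2 * Y l
      bot≤ zero _ = ≤-trans (≤-reflexive (eq α g f e)) M₀-bot
        where
        eq : ∀ α g f e → α + (g + e) + 0 * f + (f + e) ≡ α + (g + f) + 2 * e
        eq = solve-∀
      bot≤ (suc k) k<L = ≤-trans bot≤top
        (≤-trans (≤-reflexive (top≡ (suc k))) (2 ⊗ support (suc k) k<L))
        where
        bot≤top : α + (g + e) + suc k * f + (f + e) ≤ α + a + suc k * (g + f) + (g + f + e)
        bot≤top = by (e+f≤ ⊕ z≤n {k * g}) (solve (α ∷ a ∷ k ∷ g ∷ f ∷ e ∷ []))

    -- `Y₀≡` puts the line of slope t on the points 0 and 1 of Y. The line of slope e through (1, Y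
    -- 1) is kept below Y at 0 by `t≤e`, and from 2 on by `Y₁+e≤Y₂` and convexity.
    record InitialBounds (ν Y₀ Y₂ t : ℕ) : Set where
      field
        α e     : ℕ
        Y₀≡     : Y₀ ≡ α + 2 * e + t
        t≤e     : t ≤ e
        α+e≤ν   : α + e ≤ ν
        Y₁+e≤Y₂ : Y₀ + t + e ≤ Y₂

  module _ {K ν : ℕ} {Y : ℕ → ℕ} (q : QNat K ν Y) where
    open QNat q

    private
      slopes-increase : ∀ {i j} → i ≤ j → j ≤ K → Y (suc i) + Y j ≤ Y i + Y (suc j)
      slopes-increase {i} {j} i≤j j≤K with split i≤j
      ... | t , refl = subst (λ j → Y (suc i) + Y j ≤ Y i + Y (suc j)) (+-comm t i)
            (go t (≤-trans (≤-reflexive (+-comm t i)) j≤K))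
        where
        step : ∀ a b c d e → b + c ≤ a + d → 2 * d ≤ c + e → b + d ≤ a + e
        step a b c d e p r = by (p ⊕ r) (solve (a ∷ b ∷ c ∷ d ∷ e ∷ []))

        go : ∀ t → t + i ≤ K → Y (suc i) + Y (t + i) ≤ Y i + Y (suc (t + i))
        go zero    _ = ≤-reflexive (+-comm (Y (suc i)) (Y i))
        go (suc t) t+i<K = step (Y i) (Y (suc i)) (Y (t + i)) (Y (suc (t + i))) (Y (2+ (t + i)))
          (go t (<⇒≤ t+i<K)) (ineq₇ (t + i) t+i<K)

      -- (i + 2) Y i - (i + 1) Y (i + 1) is the value at -1 of the line through i and i + 1. By
      -- convexity it decreases with i, so `ineq₈`, the case i = K, implies all others. It yields
      -- `s≤c` for every line.
      tangent-nonneg-at-−1 : ∀ i → i ≤ K → suc i * Y (suc i) ≤ (2+ i) * Y i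
      tangent-nonneg-at-−1 i i≤K with split i≤K
      ... | t , e = go t i (sym e)
        where
        step : ∀ i a b c → (2+ i) * c ≤ suc (2+ i) * b → 2 * b ≤ a + c → suc i * b ≤ (2+ i) * a
        step i a b c p r = by (p ⊕ (2+ i) ⊗ r) (solve (i ∷ a ∷ b ∷ c ∷ []))

        go : ∀ t i → i + t ≡ K → suc i * Y (suc i) ≤ (2+ i) * Y i
        go zero    i e = subst (λ k → suc k * Y (suc k) ≤ (2+ k) * Y k) (trans (sym e) (+-identityʳ i)) ineq₈
        go (suc t) i e = step i (Y i) (Y (suc i)) (Y (2+ i))
          (go t (suc i) (trans (sym (+-suc i t)) e))
          (ineq₇ i (≤-trans (s≤s (m≤m+n i t)) (≤-reflexive (trans (sym (+-suc i t)) e))))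

      record Line (i : ℕ) : Set where
        field
          c s     : ℕ
          at-i    : Y i ≡ c + i * s
          at-1+i  : Y (suc i) ≡ c + suc i * s
          s≤c     : s ≤ c
          support : ∀ l → l ≤ suc K → c + l * s ≤ Y l

      line : ∀ i → i ≤ K → Line i
      line i i≤K = at-s (split Yi≤Y1+i)
        where
        nondecreasing : ∀ a b c d → a ≤ b → b + c ≤ a + d → c ≤ d
        nondecreasing a b c d p r = by (p ⊕ r) (solve (a ∷ b ∷ c ∷ d ∷ []))

        Yi≤Y1+i : Y i ≤ Y (suc i)
        Yi≤Y1+i = nondecreasing (Y 0) (Y 1) (Y i) (Y (suc i)) ineq₁ (slopes-increase z≤n i≤K)

        at-s : (∃ λ s → Y (suc i) ≡ Y i + s) → Line i
        at-s (s , Y1+i≡) = at-c (split is≤Yi)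
          where
          bound : ∀ i y s → suc i * (y + s) ≤ (2+ i) * y → s + i * s ≤ y
          bound i y s p = by p (solve (i ∷ y ∷ s ∷ []))

          s+is≤Yi : s + i * s ≤ Y i
          s+is≤Yi = bound i (Y i) s (subst (λ y → suc i * y ≤ (2+ i) * Y i) Y1+i≡ (tangent-nonneg-at-−1 i i≤K))

          is≤Yi : i * s ≤ Y i
          is≤Yi = ≤-trans (m≤n+m (i * s) s) s+is≤Yi

          at-c : (∃ λ c → Y i ≡ i * s + c) → Line i
          at-c (c , Yi≡) = record
            { c = c ; s = s ; at-i = at-i ; at-1+i = at-1+i
            ; s≤c = +-cancelˡ-≤ (i * s) s c (subst₂ _≤_ (+-comm s (i * s)) Yi≡ s+is≤Yi)
            ; support = support }
            where
            at-i : Y i ≡ c + i * s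
            at-i = trans Yi≡ (+-comm (i * s) c)

            at-1+i : Y (suc i) ≡ c + suc i * s
            at-1+i = trans Y1+i≡ (trans (cong (_+ s) at-i) (solve (c ∷ i ∷ s ∷ [])))

            step-up : ∀ c s k yi yl yl′ → yi + s + yl ≤ yi + yl′ → c + k * s ≤ yl → c + suc k * s ≤ yl′
            step-up c s k yi yl yl′ p r = by (p ⊕ r) (solve (c ∷ s ∷ k ∷ yi ∷ yl ∷ yl′ ∷ []))

            up : ∀ t → i + t ≤ suc K → c + (i + t) * s ≤ Y (i + t)
            up zero    _ = subst (λ k → c + k * s ≤ Y k) (sym (+-identityʳ i)) (≤-reflexive (sym at-i))
            up (suc t) p = subst (λ k → c + k * s ≤ Y k) (sym (+-suc i t))
              (step-up c s (i + t) (Y i) (Y (i + t)) (Y (suc (i + t)))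
                (subst (λ y → y + Y (i + t) ≤ Y i + Y (suc (i + t))) Y1+i≡ (slopes-increase (m≤m+n i t) i+t≤K))
                (up t (m≤n⇒m≤1+n i+t≤K)))
              where
              i+t≤K : i + t ≤ K
              i+t≤K = ≤-pred (≤-trans (≤-reflexive (sym (+-suc i t))) p)

            step-down : ∀ c s k yi yl yl′ → yl′ + yi ≤ yl + (yi + s) → c + suc k * s ≤ yl′ → c + k * s ≤ yl
            step-down c s k yi yl yl′ p r = by (p ⊕ r) (solve (c ∷ s ∷ k ∷ yi ∷ yl ∷ yl′ ∷ []))

            down : ∀ t l → l + t ≡ i → c + l * s ≤ Y l
            down zero    l e = subst (λ k → c + k * s ≤ Y k) (trans (sym e) (+-identityʳ l)) (≤-reflexive (sym at-i))
            down (suc t) l e = step-down c s l (Y i) (Y l) (Y (suc l))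
              (subst (λ y → Y (suc l) + Y i ≤ Y l + y) Y1+i≡
                (slopes-increase (≤-trans (m≤m+n l (suc t)) (≤-reflexive e)) i≤K))
              (down t (suc l) (trans (sym (+-suc l t)) e))

            support : ∀ l → l ≤ suc K → c + l * s ≤ Y l
            support l l≤ with ≤-total i l
            ... | inj₁ i≤l with split i≤l
            ...   | t , refl = up t l≤
            support l l≤ | inj₂ l≤i with split l≤i
            ...   | t , e = down t l (sym e)

      -- As slopes increase, s is at most the last slope, which `ineq₄` and `ineq₅` bound, and at
      -- least each slope up to i. For i ≥ 2 this includes Y 3 - Y 2, the one that meets `ineq₃`;
      -- the two initial slopes go with `ineq₆`.
      lineBounds : ∀ i → 2 ≤ i → i ≤ K → (ℓ : Line i) → LineBounds ν (Y 0) (Line.c ℓ) (Line.s ℓ)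
      lineBounds i 2≤i i≤K ℓ = record
        { s≤ν   = b₁ c s i (Y K) (Y (suc K)) ν slope-K ineq₅
        ; 2s≤Y₀ = b₂ c s i (Y K) (Y (suc K)) (Y 0) slope-K ineq₄
        ; c≤Y₀  = c≤Y₀
        ; s≤c   = s≤c
        ; 2c+3s≤3Y₀ = b₃ c s i (Y 0) (Y 2) (Y 3) (support 3 (s≤s K≥2)) (slope 2≤i) ineq₃
        ; c≤ν+2s = b₄ c s i ν (Y 0) (Y 1) (Y 2) c≤Y₀ (slope z≤n) (slope (≤-trans (s≤s z≤n) 2≤i)) ineq₆
        }
        where
        open Line ℓ
        slope : ∀ {j} → j ≤ i → Y (suc j) + (c + i * s) ≤ Y j + (c + suc i * s)
        slope {j} j≤i = subst₂ (λ y y′ → Y (suc j) + y ≤ Y j + y′) at-i at-1+i (slopes-increase j≤i i≤K)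

        slope-K : (c + suc i * s) + Y K ≤ (c + i * s) + Y (suc K)
        slope-K = subst₂ (λ y y′ → y′ + Y K ≤ y + Y (suc K)) at-i at-1+i (slopes-increase i≤K ≤-refl)

        c≤Y₀ : c ≤ Y 0
        c≤Y₀ = ≤-trans (≤-reflexive (sym (+-identityʳ c))) (support 0 z≤n)

        b₁ : ∀ c s i y y′ ν → (c + suc i * s) + y ≤ (c + i * s) + y′ → y′ ≤ ν + y → s ≤ ν
        b₁ c s i y y′ ν p r = by (p ⊕ r) (solve (c ∷ s ∷ i ∷ y ∷ y′ ∷ ν ∷ []))

        b₂ : ∀ c s i y y′ y₀ → (c + suc i * s) + y ≤ (c + i * s) + y′ → 2 * y′ ≤ y₀ + 2 * y → 2 * s ≤ y₀
        b₂ c s i y y′ y₀ p r = by (2 ⊗ p ⊕ r) (solve (c ∷ s ∷ i ∷ y ∷ y′ ∷ y₀ ∷ []))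

        b₃ : ∀ c s i y₀ y₂ y₃ → c + 3 * s ≤ y₃ → y₃ + (c + i * s) ≤ y₂ + (c + suc i * s) →
          3 * y₂ ≤ 3 * y₀ + y₃ → 2 * c + 3 * s ≤ 3 * y₀
        b₃ c s i y₀ y₂ y₃ p r t = by (2 ⊗ p ⊕ 3 ⊗ r ⊕ t) (solve (c ∷ s ∷ i ∷ y₀ ∷ y₂ ∷ y₃ ∷ []))

        b₄ : ∀ c s i ν y₀ y₁ y₂ → c ≤ y₀ → y₁ + (c + i * s) ≤ y₀ + (c + suc i * s) →
          y₂ + (c + i * s) ≤ y₁ + (c + suc i * s) → 2 * y₀ ≤ ν + y₂ → c ≤ ν + 2 * s
        b₄ c s i ν y₀ y₁ y₂ p r t u = by (p ⊕ r ⊕ t ⊕ u) (solve (c ∷ s ∷ i ∷ ν ∷ y₀ ∷ y₁ ∷ y₂ ∷ []))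

      line-block : ∀ i → 2 ≤ i → i ≤ K → ∃ λ b → Fits (suc K) (2 * ν) (λ l → 2 * Y l) b
        × Hits (λ l → 2 * Y l) b i × Hits (λ l → 2 * Y l) b (suc i)
      line-block i 2≤i i≤K = block α a g f e , fits B support ,
        inj₁ (hit i at-i) , inj₁ (hit (suc i) at-1+i)
        where
        ℓ = line i i≤K
        open Line ℓ
        B = lineBlock ν (Y 0) c s (lineBounds i 2≤i i≤K ℓ)
        open LineBlock B

        hit : ∀ l → Y l ≡ c + l * s → 2 * Y l ≤ Block.top (block α a g f e) l
        hit l e′ = ≤-reflexive (begin
          2 * Y l                             ≡⟨ cong (2 *_) e′ ⟩
          2 * (c + l * s)                     ≡⟨ distrib c l s ⟩
          2 * c + l * (2 * s)                 ≡⟨ cong₂ (λ x y → x + l * y) height slope ⟨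
          α + a + (g + f) + e + l * (g + f)   ≡⟨ rearrange α a l (g + f) e ⟩
          α + a + l * (g + f) + (g + f + e)   ∎)
          where
          open ≡-Reasoning
          distrib : ∀ c l s → 2 * (c + l * s) ≡ 2 * c + l * (2 * s)
          distrib = solve-∀

          rearrange : ∀ α a l s e → α + a + s + e + l * s ≡ α + a + l * s + (s + e)
          rearrange = solve-∀

      -- Disjoint copies of K_{n^t,n^e} with t the initial slope of Y; the lines
      -- through (0, Y 0) of slope t and through (1, Y 1) of slope e both lie
      -- below Y.
      initial-block : ∃ λ b → Fits (suc K) (2 * ν) (λ l → 2 * Y l) b
        × Hits (λ l → 2 * Y l) b 0 × Hits (λ l → 2 * Y l) b 1
      initial-block = at-t (split ineq₁)
        where
        at-t : (∃ λ t → Y 1 ≡ Y 0 + t) → ∃ λ b → Fits (suc K) (2 * ν) (λ l → 2 * Y l) b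
          × Hits (λ l → 2 * Y l) b 0 × Hits (λ l → 2 * Y l) b 1
        at-t (t , Y1≡) = build params
          where
          1≤K : 1 ≤ K
          1≤K = ≤-trans (s≤s z≤n) K≥2

          3t≤Y₀ : 3 * t ≤ Y 0
          3t≤Y₀ = arith (Y 0) t (subst (λ y → 3 * y ≤ 4 * Y 0) Y1≡ ineq₂)
            where
            arith : ∀ y t → 3 * (y + t) ≤ 4 * y → 3 * t ≤ y
            arith y t p = by p (solve (y ∷ t ∷ []))

          convex : 2 * (Y 0 + t) ≤ Y 0 + Y 2
          convex = subst (λ y → 2 * y ≤ Y 0 + Y 2) Y1≡ (ineq₇ 0 1≤K)

          Y2≤ : Y 2 ≤ Y 0 + t + ν
          Y2≤ = subst (λ y → Y 2 ≤ y + ν) Y1≡ (arith (Y 1) (Y 2) (Y K) (Y (suc K)) ν (slopes-increase 1≤K ≤-refl) ineq₅)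
            where
            arith : ∀ a b c d ν → b + c ≤ a + d → d ≤ ν + c → b ≤ a + ν
            arith a b c d ν p r = by (p ⊕ r) (solve (a ∷ b ∷ c ∷ d ∷ ν ∷ []))

          Params = InitialBounds ν (Y 0) (Y 2) t

          params : Params
          params with Y 0 ≤? 2 * t + ν
          -- Balanced bipartite graphs, e = t, as long as their order α + e = Y 0 - 2t fits.
          ... | yes Y₀≤ = at-α (split 3t≤Y₀)
            where
            a₁ : ∀ α t → 3 * t + α ≡ α + 2 * t + t
            a₁ = solve-∀

            a₂ : ∀ α t ν → 3 * t + α ≤ 2 * t + ν → α + t ≤ ν
            a₂ α t ν p = by p (solve (α ∷ t ∷ ν ∷ []))

            a₃ : ∀ y t y₂ → 2 * (y + t) ≤ y + y₂ → y + t + t ≤ y₂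
            a₃ y t y₂ p = by p (solve (y ∷ t ∷ y₂ ∷ []))

            at-α : (∃ λ α → Y 0 ≡ 3 * t + α) → Params
            at-α (α , e) = record
              { α = α ; e = t
              ; Y₀≡ = trans e (a₁ α t)
              ; t≤e = ≤-refl
              ; α+e≤ν = a₂ α t ν (subst (_≤ 2 * t + ν) e Y₀≤)
              ; Y₁+e≤Y₂ = a₃ (Y 0) t (Y 2) convex }
          -- Otherwise e is raised until the order constraint is tight: α + e = ν forces e = Y 0 - ν
          -- - t = t + δ, and Y 1 + e = 2 Y 0 - ν ≤ Y 2 is `ineq₆`.
          ... | no Y₀≰ = at-δ (split (<⇒≤ (≰⇒> Y₀≰)))
            where
            at-δ : (∃ λ δ → Y 0 ≡ 2 * t + ν + δ) → Params
            at-δ (δ , e) = at-α (split t+δ≤ν)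
              where
              a₁ : ∀ t ν δ y₂ → 2 * (2 * t + ν + δ) ≤ ν + y₂ → 2 * t + ν + δ + t + (t + δ) ≤ y₂
              a₁ t ν δ y₂ p = by p (solve (t ∷ ν ∷ δ ∷ y₂ ∷ []))

              Y₁+t+δ≤Y₂ : Y 0 + t + (t + δ) ≤ Y 2
              Y₁+t+δ≤Y₂ = subst (λ y → y + t + (t + δ) ≤ Y 2) (sym e)
                (a₁ t ν δ (Y 2) (subst (λ y → 2 * y ≤ ν + Y 2) e ineq₆))

              t+δ≤ν : t + δ ≤ ν
              t+δ≤ν = +-cancelˡ-≤ (Y 0 + t) (t + δ) ν (≤-trans Y₁+t+δ≤Y₂ Y2≤)

              a₂ : ∀ t δ α → 2 * t + (t + δ + α) + δ ≡ α + 2 * (t + δ) + t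
              a₂ = solve-∀

              at-α : (∃ λ α → ν ≡ t + δ + α) → Params
              at-α (α , e′) = record
                { α = α ; e = t + δ
                ; Y₀≡ = trans e (trans (cong (λ ν → 2 * t + ν + δ) e′) (a₂ t δ α))
                ; t≤e = m≤m+n t δ
                ; α+e≤ν = ≤-reflexive (trans (+-comm α (t + δ)) (sym e′))
                ; Y₁+e≤Y₂ = Y₁+t+δ≤Y₂ }

          build : Params → _
          build record { α = α ; e = e ; Y₀≡ = Y₀≡ ; t≤e = t≤e ; α+e≤ν = α+e≤ν ; Y₁+e≤Y₂ = Y₁+e≤Y₂ } = b , record
            { a≤e       = ≤-refl
            ; top-order = ≤-trans (+-monoʳ-≤ (2 * α) (2 ⊗ t≤e)) 2α+2e≤2ν
            ; mid-order = 2α+2e≤2ν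
            ; bot-order = ≤-trans (+-monoʳ-≤ (2 * α) (2 ⊗ t≤e)) 2α+2e≤2ν
            ; top≤      = λ l l≤ → ≤-trans (≤-reflexive (steep≡ α e t l)) (2 ⊗ steep l l≤)
            ; mid₁≤     = λ l l≤ → ≤-trans (≤-reflexive (mid₁≡ l)) (2 ⊗ Line.support ℓ l l≤)
            ; mid₂≤     = λ l l≤ → ≤-trans (≤-reflexive (mid₁≡ l)) (2 ⊗ Line.support ℓ l l≤)
            ; bot≤      = λ l l≤ → ≤-trans (≤-reflexive (steep≡ α e t l)) (2 ⊗ steep l l≤)
            } , inj₂ (hit 0 (Line.at-i ℓ)) , inj₂ (hit 1 (Line.at-1+i ℓ))
            where
            b : Block
            b = block (2 * α) (2 * t) 0 (2 * e) (2 * t)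

            2α+2e≤2ν : 2 * α + 2 * e ≤ 2 * ν
            2α+2e≤2ν = ≤-trans (≤-reflexive (sym (*-distribˡ-+ 2 α e))) (2 ⊗ α+e≤ν)

            ℓ = line 0 z≤n

            c≡ : Line.c ℓ ≡ Y 0
            c≡ = sym (trans (Line.at-i ℓ) (+-identityʳ _))

            s≡ : Line.s ℓ ≡ t
            s≡ = +-cancelˡ-≡ (Line.c ℓ) (Line.s ℓ) t (trans (cong (Line.c ℓ +_) (sym (+-identityʳ _)))
              (trans (sym (Line.at-1+i ℓ)) (trans Y1≡ (cong (_+ t) (sym c≡)))))

            mid₁≡ : ∀ l → Block.mid₁ b l ≡ 2 * (Line.c ℓ + l * Line.s ℓ)
            mid₁≡ l = begin
              2 * α + 2 * e + l * (2 * t) + (2 * t + 2 * e) ≡⟨ solve (α ∷ e ∷ t ∷ l ∷ []) ⟩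
              2 * (α + 2 * e + t + l * t)                   ≡⟨ cong₂ (λ c s → 2 * (c + l * s)) (trans (sym Y₀≡) (sym c≡)) (sym s≡) ⟩
              2 * (Line.c ℓ + l * Line.s ℓ)                 ∎
              where open ≡-Reasoning

            steep≡ : ∀ α e t l → 2 * α + 2 * t + l * (2 * e) + (2 * e + 2 * t) ≡ 2 * (α + 2 * t + e + l * e)
            steep≡ = solve-∀

            hit : ∀ l → Y l ≡ Line.c ℓ + l * Line.s ℓ → 2 * Y l ≤ Block.mid₁ b l
            hit l e′ = ≤-reflexive (trans (cong (2 *_) e′) (sym (mid₁≡ l)))

            steep : ∀ l → l ≤ suc K → α + 2 * t + e + l * e ≤ Y l
            steep zero _ = subst (α + 2 * t + e + 0 ≤_) (sym Y₀≡) (arith α t e t≤e)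
              where
              arith : ∀ α t e → t ≤ e → α + 2 * t + e + 0 ≤ α + 2 * e + t
              arith α t e p = by p (solve (α ∷ t ∷ e ∷ []))
            steep (suc zero) _ = subst (α + 2 * t + e + 1 * e ≤_) (trans (cong (_+ t) (sym Y₀≡)) (sym Y1≡))
              (≤-reflexive (solve (α ∷ t ∷ e ∷ [])))
            steep (suc (suc k)) p = arith e k (α + 2 * t + e) (Y 0 + t) (Y 2) (Y (suc k)) (Y (2+ k)) Y₁+e≤Y₂
              (subst (λ y → Y 2 + Y (suc k) ≤ y + Y (2+ k)) Y1≡ (slopes-increase (s≤s z≤n) (≤-pred p)))
              (steep (suc k) (<⇒≤ p))
              where
              arith : ∀ e k z y₁ y₂ y y′ → y₁ + e ≤ y₂ → y₂ + y ≤ y₁ + y′ → z + suc k * e ≤ y →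
                z + (2+ k) * e ≤ y′
              arith e k z y₁ y₂ y y′ p r t = by (p ⊕ r ⊕ t) (solve (e ∷ k ∷ z ∷ y₁ ∷ y₂ ∷ y ∷ y′ ∷ []))

    abstract
      -- Coordinate 2 is served by the line through 2 and 3, for which ineq₃ gives
      -- 2c + 3s ≤ 3 Y 0; the line through 1 and 2 need not satisfy this.
      hitting-block : ∀ k → k ≤ suc K →
        ∃ λ b → Fits (suc K) (2 * ν) (λ l → 2 * Y l) b × Hits (λ l → 2 * Y l) b k
      hitting-block zero _ = let b , fit , hit , _ = initial-block in b , fit , hit
      hitting-block (suc zero) _ = let b , fit , _ , hit = initial-block in b , fit , hit
      hitting-block (suc (suc zero)) _ = let b , fit , hit , _ = line-block 2 ≤-refl K≥2 in b , fit , hit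
      hitting-block (suc (suc (suc k))) p =
        let b , fit , _ , hit = line-block (2+ k) (s≤s (s≤s z≤n)) (≤-pred p) in b , fit , hit

-- Graphs with prescribed exponents up to a constant factor

module Realisation where

  open FiniteSums
  open HomCount
  open GraphConstructions
  open Exponents
  open import Data.Nat.Base
  open import Data.Nat.Properties
  open import Data.Nat.Tactic.RingSolver using (solve-∀)
  open import Data.Fin.Base using (Fin; toℕ; fromℕ<)
  open import Data.Fin.Properties using (toℕ<n; toℕ-fromℕ<)
  open import Data.Product.Base using (∃; _×_; _,_; proj₁; proj₂)
  open import Data.Sum.Base using (inj₁; inj₂)
  open import Relation.Binary.PropositionalEquality
  open import Defs using (Graph)
  open ≤-Reasoning

  private
    module _ (n : ℕ) .{{_ : NonZero n}} (b : Block) where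
      open Block b

      P A G F E : ℕ
      P = n ^ α
      A = n ^ a
      G = n ^ g
      F = n ^ f
      E = n ^ e

      blockGraph : Graph
      blockGraph = copies P (core A G F E)

      ^-+ : ∀ i j → n ^ (i + j) ≡ n ^ i * n ^ j
      ^-+ = ^-distribˡ-+-* n

      ^-l* : ∀ l i → n ^ (l * i) ≡ (n ^ i) ^ l
      ^-l* l i = trans (cong (n ^_) (*-comm l i)) (sym (^-*-assoc n i l))

      top-^ : ∀ l → n ^ top l ≡ P * A * (G * F) ^ l * (G * F * E)
      top-^ l = trans (^-+ (α + a + l * (g + f)) (g + f + e)) (cong₂ _*_
        (trans (^-+ (α + a) (l * (g + f))) (cong₂ _*_ (^-+ α a) (trans (^-l* l (g + f)) (cong (_^ l) (^-+ g f)))))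
        (trans (^-+ (g + f) e) (cong (_* E) (^-+ g f))))

      mid₁-^ : ∀ l → n ^ mid₁ l ≡ P * (G * F) * E ^ l * (A * (G * F))
      mid₁-^ l = trans (^-+ (α + (g + f) + l * e) (a + (g + f))) (cong₂ _*_
        (trans (^-+ (α + (g + f)) (l * e)) (cong₂ _*_ (trans (^-+ α (g + f)) (cong (P *_) (^-+ g f))) (^-l* l e)))
        (trans (^-+ a (g + f)) (cong (A *_) (^-+ g f))))

      mid₂-^ : ∀ l → n ^ mid₂ l ≡ P * (G * F) * E ^ l * (E * F)
      mid₂-^ l = trans (^-+ (α + (g + f) + l * e) (e + f)) (cong₂ _*_
        (trans (^-+ (α + (g + f)) (l * e)) (cong₂ _*_ (trans (^-+ α (g + f)) (cong (P *_) (^-+ g f))) (^-l* l e)))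
        (^-+ e f))

      bot-^ : ∀ l → n ^ bot l ≡ P * (G * E) * F ^ l * (F * E)
      bot-^ l = trans (^-+ (α + (g + e) + l * f) (f + e)) (cong₂ _*_
        (trans (^-+ (α + (g + e)) (l * f)) (cong₂ _*_ (trans (^-+ α (g + e)) (cong (P *_) (^-+ g e))) (^-l* l f)))
        (^-+ f e))

      topTerm midTerm botTerm : ℕ → ℕ
      topTerm l = P * (A * ((G * F) ^ l * (G * (F * (A + E)))))
      midTerm l = P * (G * (F * ((A + E) ^ l * (A * (G * F) + E * F))))
      botTerm l = P * (G * (E * (F ^ l * (F * (A + E)))))

      M-blockGraph : ∀ l → M blockGraph l ≡ topTerm l + (midTerm l + botTerm l)
      M-blockGraph l = trans (Φ-copies P (core A G F E) (λ d w → d ^ l * w))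
        (trans (cong (P *_) (Φ-core A G F E (λ d w → d ^ l * w)))
          (trans (*-distribˡ-+ P _ _) (cong (topTerm l +_) (*-distribˡ-+ P _ _))))

      order-blockGraph : Graph.order blockGraph ≡ n ^ (α + a) + (n ^ (α + (g + f)) + n ^ (α + (g + e)))
      order-blockGraph = begin-equality
        Graph.order blockGraph                      ≡⟨ Φ-order blockGraph ⟨
        Φ blockGraph (λ _ _ → 1)                    ≡⟨ trans (Φ-copies P (core A G F E) (λ _ _ → 1))
                                                         (cong (P *_) (Φ-core A G F E (λ _ _ → 1))) ⟩
        P * (A * 1 + (G * (F * 1) + G * (E * 1)))   ≡⟨ eq P A G F E ⟩
        P * A + (P * (G * F) + P * (G * E))         ≡⟨ cong₂ _+_ (^-+ α a) (cong₂ _+_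
                                                         (trans (^-+ α (g + f)) (cong (P *_) (^-+ g f)))
                                                         (trans (^-+ α (g + e)) (cong (P *_) (^-+ g e)))) ⟨
        n ^ (α + a) + (n ^ (α + (g + f)) + n ^ (α + (g + e))) ∎
        where
        eq : ∀ p a g f e → p * (a * 1 + (g * (f * 1) + g * (e * 1))) ≡ p * a + (p * (g * f) + p * (g * e))
        eq = solve-∀

      module _ {L ν : ℕ} {Y : ℕ → ℕ} (fits : Fits L ν Y b) where
        open Fits fits

        n^≤ : ∀ {i j} → i ≤ j → n ^ i ≤ n ^ j
        n^≤ = ^-monoʳ-≤ n

        A+E≤2E : A + E ≤ 2 * E
        A+E≤2E = +-mono-≤ (n^≤ a≤e) (≤-reflexive (sym (+-identityʳ E)))

        order-blockGraph≤ : Graph.order blockGraph ≤ 3 * n ^ ν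
        order-blockGraph≤ = begin
          Graph.order blockGraph                                  ≡⟨ order-blockGraph ⟩
          n ^ (α + a) + (n ^ (α + (g + f)) + n ^ (α + (g + e)))   ≤⟨ +-mono-≤ (n^≤ top-order)
                                                                       (+-mono-≤ (n^≤ mid-order) (n^≤ bot-order)) ⟩
          n ^ ν + (n ^ ν + n ^ ν)                                 ≡⟨ eq (n ^ ν) ⟩
          3 * n ^ ν                                               ∎
          where
          eq : ∀ x → x + (x + x) ≡ 3 * x
          eq = solve-∀

        topTerm≤ : ∀ l → l ≤ L → topTerm l ≤ 2 * n ^ Y l
        topTerm≤ l l≤L = begin
          topTerm l                                            ≤⟨ *-monoʳ-≤ P (*-monoʳ-≤ A (*-monoʳ-≤ ((G * F) ^ l)
                                                                    (*-monoʳ-≤ G (*-monoʳ-≤ F A+E≤2E)))) ⟩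
          P * (A * ((G * F) ^ l * (G * (F * (2 * E)))))        ≡⟨ eq P A G F E ((G * F) ^ l) ⟩
          2 * (P * A * (G * F) ^ l * (G * F * E))              ≡⟨ cong (2 *_) (top-^ l) ⟨
          2 * n ^ top l                                        ≤⟨ *-monoʳ-≤ 2 (n^≤ (top≤ l l≤L)) ⟩
          2 * n ^ Y l                                          ∎
          where
          eq : ∀ p a g f e x → p * (a * (x * (g * (f * (2 * e))))) ≡ 2 * (p * a * x * (g * f * e))
          eq = solve-∀

        midTerm≤ : ∀ l → l ≤ L → midTerm l ≤ 2 ^ l * (2 * n ^ Y l)
        midTerm≤ l l≤L = begin
          midTerm l
            ≤⟨ *-monoʳ-≤ P (*-monoʳ-≤ G (*-monoʳ-≤ F (*-monoˡ-≤ (A * (G * F) + E * F)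
                 (≤-trans (^-monoˡ-≤ l A+E≤2E) (≤-reflexive (^-distribʳ-* 2 E l)))))) ⟩
          P * (G * (F * (2 ^ l * E ^ l * (A * (G * F) + E * F))))
            ≡⟨ eq P A G F E (2 ^ l) (E ^ l) ⟩
          2 ^ l * (P * (G * F) * E ^ l * (A * (G * F)) + P * (G * F) * E ^ l * (E * F))
            ≡⟨ cong (2 ^ l *_) (cong₂ _+_ (mid₁-^ l) (mid₂-^ l)) ⟨
          2 ^ l * (n ^ mid₁ l + n ^ mid₂ l)
            ≤⟨ *-monoʳ-≤ (2 ^ l) (+-mono-≤ (n^≤ (mid₁≤ l l≤L)) (≤-trans (n^≤ (mid₂≤ l l≤L)) (m≤m+n _ 0))) ⟩
          2 ^ l * (2 * n ^ Y l) ∎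
          where
          eq : ∀ p a g f e t x → p * (g * (f * (t * x * (a * (g * f) + e * f))))
            ≡ t * (p * (g * f) * x * (a * (g * f)) + p * (g * f) * x * (e * f))
          eq = solve-∀

        botTerm≤ : ∀ l → l ≤ L → botTerm l ≤ 2 * n ^ Y l
        botTerm≤ l l≤L = begin
          botTerm l                                            ≤⟨ *-monoʳ-≤ P (*-monoʳ-≤ G (*-monoʳ-≤ E (*-monoʳ-≤ (F ^ l)
                                                                    (*-monoʳ-≤ F A+E≤2E)))) ⟩
          P * (G * (E * (F ^ l * (F * (2 * E)))))              ≡⟨ eq P G F E (F ^ l) ⟩
          2 * (P * (G * E) * F ^ l * (F * E))                  ≡⟨ cong (2 *_) (bot-^ l) ⟨
          2 * n ^ bot l                                        ≤⟨ *-monoʳ-≤ 2 (n^≤ (bot≤ l l≤L)) ⟩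
          2 * n ^ Y l                                          ∎
          where
          eq : ∀ p g f e x → p * (g * (e * (x * (f * (2 * e))))) ≡ 2 * (p * (g * e) * x * (f * e))
          eq = solve-∀

        -- The top and bottom terms lose a factor 2 through A + E ≤ 2E. The middle term loses 2^l
        -- through it, because A + E is a degree there, and 2 for its two summands.
        M-blockGraph≤ : ∀ l → l ≤ L → M blockGraph l ≤ 6 * 2 ^ L * n ^ Y l
        M-blockGraph≤ l l≤L = begin
          M blockGraph l                          ≡⟨ M-blockGraph l ⟩
          topTerm l + (midTerm l + botTerm l)     ≤⟨ +-mono-≤ (topTerm≤ l l≤L) (+-mono-≤ (midTerm≤ l l≤L) (botTerm≤ l l≤L)) ⟩
          2 * y + (2 ^ l * (2 * y) + 2 * y)       ≤⟨ +-mono-≤ (m≤m*1 (2 * y)) (+-mono-≤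
                                                       (*-monoˡ-≤ (2 * y) (^-monoʳ-≤ 2 l≤L)) (m≤m*1 (2 * y))) ⟩
          t * (2 * y) + (t * (2 * y) + t * (2 * y)) ≡⟨ eq t y ⟩
          6 * t * y                               ∎
          where
          t y : ℕ
          t = 2 ^ L
          y = n ^ Y l

          m≤m*1 : ∀ m → m ≤ t * m
          m≤m*1 m = m≤n*m m t {{m^n≢0 2 L}}

          eq : ∀ t y → t * (2 * y) + (t * (2 * y) + t * (2 * y)) ≡ 6 * t * y
          eq = solve-∀

        ≤M-blockGraph : ∀ l → Hits Y b l → n ^ Y l ≤ M blockGraph l
        ≤M-blockGraph l (inj₁ Y≤top) = begin
          n ^ Y l                                        ≤⟨ n^≤ Y≤top ⟩
          n ^ top l                                      ≡⟨ top-^ l ⟩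
          P * A * (G * F) ^ l * (G * F * E)              ≡⟨ eq P A G F E ((G * F) ^ l) ⟩
          P * (A * ((G * F) ^ l * (G * (F * E))))        ≤⟨ *-monoʳ-≤ P (*-monoʳ-≤ A (*-monoʳ-≤ ((G * F) ^ l)
                                                              (*-monoʳ-≤ G (*-monoʳ-≤ F (m≤n+m E A))))) ⟩
          topTerm l                                      ≤⟨ m≤m+n (topTerm l) _ ⟩
          topTerm l + (midTerm l + botTerm l)            ≡⟨ M-blockGraph l ⟨
          M blockGraph l                                 ∎
          where
          eq : ∀ p a g f e x → p * a * x * (g * f * e) ≡ p * (a * (x * (g * (f * e))))
          eq = solve-∀
        ≤M-blockGraph l (inj₂ Y≤mid₁) = begin
          n ^ Y l                                        ≤⟨ n^≤ Y≤mid₁ ⟩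
          n ^ mid₁ l                                     ≡⟨ mid₁-^ l ⟩
          P * (G * F) * E ^ l * (A * (G * F))            ≡⟨ eq P A G F (E ^ l) ⟩
          P * (G * (F * (E ^ l * (A * (G * F)))))        ≤⟨ *-monoʳ-≤ P (*-monoʳ-≤ G (*-monoʳ-≤ F
                                                              (*-mono-≤ (^-monoˡ-≤ l (m≤n+m E A)) (m≤m+n (A * (G * F)) (E * F))))) ⟩
          midTerm l                                      ≤⟨ ≤-trans (m≤m+n (midTerm l) (botTerm l)) (m≤n+m _ (topTerm l)) ⟩
          topTerm l + (midTerm l + botTerm l)            ≡⟨ M-blockGraph l ⟨
          M blockGraph l                                 ∎
          where
          eq : ∀ p a g f x → p * (g * f) * x * (a * (g * f)) ≡ p * (g * (f * (x * (a * (g * f)))))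
          eq = solve-∀

  record Realises (n C L ν : ℕ) (Y : ℕ → ℕ) (G : Graph) : Set where
    field
      ≤order : n ^ ν ≤ Graph.order G
      order≤ : Graph.order G ≤ C * n ^ ν
      ≤M     : ∀ k → k ≤ L → n ^ Y k ≤ M G k
      M≤     : ∀ k → k ≤ L → M G k ≤ C * n ^ Y k

  private
    module Assemble {r c L ν : ℕ} {Y : ℕ → ℕ} (b : Fin r → Block) (fit : ∀ i → Fits L ν Y (b i))
      (hit : ∀ k → k ≤ L → ∃ λ i → Hits Y (b i) k) (c≡ : c ≡ 6 * 2 ^ L) (n : ℕ) .{{_ : NonZero n}} where

      bg : Fin r → Graph
      bg i = blockGraph n (b i)

      rest graph : Graph
      rest  = ⨆ bg
      graph = disjointUnion (edgeless (n ^ ν)) rest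

      M-graph : ∀ k → M graph k ≡ ∑ (λ i → M (bg i) k)
      M-graph k = begin-equality
        M graph k
          ≡⟨ Φ-disjointUnion (edgeless (n ^ ν)) rest (λ d w → d ^ k * w) ⟩
        Φ (edgeless (n ^ ν)) (λ d w → d ^ k * w) + M rest k
          -- Isolated vertices have w = 0, so they contribute nothing even for k = 0, where 0 ^ k is
          -- 1.
          ≡⟨ cong (_+ M rest k) (trans (Φ-edgeless (n ^ ν) (λ d w → d ^ k * w))
               (trans (cong (n ^ ν *_) (*-zeroʳ (0 ^ k))) (*-zeroʳ (n ^ ν)))) ⟩
        M rest k
          ≡⟨ Φ-⨆ bg (λ d w → d ^ k * w) ⟩
        ∑ (λ i → M (bg i) k) ∎

      ∑-bound : ∀ {f : Fin r → ℕ} {x} → (∀ i → f i ≤ c * x) → ∑ f ≤ r * c * x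
      ∑-bound {f} {x} f≤ = begin
        ∑ f                     ≤⟨ ∑-mono-≤ f≤ ⟩
        ∑[ _ < r ] (c * x)      ≡⟨ ∑-const r (c * x) ⟩
        r * (c * x)             ≡⟨ *-assoc r c x ⟨
        r * c * x               ∎

      3≤c : 3 ≤ c
      3≤c = subst (3 ≤_) (sym c≡) (*-mono-≤ {3} {6} (s≤s (s≤s (s≤s z≤n))) (m^n>0 2 L))

      -- The unit added to r * c accounts for the n^ν isolated vertices, which ensure the lower
      -- bound on the order.
      realises : Realises n (suc (r * c)) L ν Y graph
      realises = record
        { ≤order = m≤m+n (n ^ ν) _
        ; order≤ = +-monoʳ-≤ (n ^ ν) (begin
            Graph.order rest                    ≡⟨ Φ-order rest ⟨
            Φ rest (λ _ _ → 1)                  ≡⟨ Φ-⨆ bg (λ _ _ → 1) ⟩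
            ∑ (λ i → Φ (bg i) (λ _ _ → 1))      ≤⟨ ∑-bound (λ i → ≤-trans (≤-reflexive (Φ-order (bg i)))
                                                     (≤-trans (order-blockGraph≤ n (b i) (fit i)) (*-monoˡ-≤ (n ^ ν) 3≤c))) ⟩
            r * c * n ^ ν                       ∎)
        ; ≤M = λ k k≤ → let i , h = hit k k≤ in begin
            n ^ Y k                    ≤⟨ ≤M-blockGraph n (b i) (fit i) k h ⟩
            M (bg i) k                 ≤⟨ term≤∑ (λ i → M (bg i) k) i ⟩
            ∑ (λ i → M (bg i) k)       ≡⟨ M-graph k ⟨
            M graph k                  ∎
        ; M≤ = λ k k≤ → begin
            M graph k                  ≡⟨ M-graph k ⟩
            ∑ (λ i → M (bg i) k)       ≤⟨ ∑-bound (λ i → subst (λ c → M (bg i) k ≤ c * n ^ Y k) (sym c≡)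
                                            (M-blockGraph≤ n (b i) (fit i) k k≤)) ⟩
            r * c * n ^ Y k            ≤⟨ m≤n+m _ (n ^ Y k) ⟩
            suc (r * c) * n ^ Y k      ∎
        }

  abstract
    -- One block per coordinate. `C` is chosen before `n`, since the threshold for τ depends on it;
    -- the doubled exponents stem from the blocks.
    realise : ∀ {K ν Y} → QNat K ν Y → ∃ λ C → ∀ n .{{_ : NonZero n}} →
      ∃ (Realises n C (suc K) (2 * ν) (λ k → 2 * Y k))
    realise {K} {ν} {Y} q = _ , λ n → _ , Assemble.realises b fit hit refl n
      where
      hb : (i : Fin (2+ K)) → ∃ λ b → Fits (suc K) (2 * ν) (λ k → 2 * Y k) b × Hits (λ k → 2 * Y k) b (toℕ i)
      hb i = hitting-block q (toℕ i) (≤-pred (toℕ<n i))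

      b : Fin (2+ K) → Block
      b i = proj₁ (hb i)

      fit : ∀ i → Fits (suc K) (2 * ν) (λ k → 2 * Y k) (b i)
      fit i = proj₁ (proj₂ (hb i))

      hit : ∀ k → k ≤ suc K → ∃ λ i → Hits (λ k → 2 * Y k) (b i) k
      hit k k≤ = fromℕ< (s≤s k≤) , subst (Hits (λ k → 2 * Y k) (b (fromℕ< (s≤s k≤))))
        (toℕ-fromℕ< (s≤s k≤)) (proj₂ (proj₂ (hb (fromℕ< (s≤s k≤)))))

-- Natural numbers as rationals

module RationalEmbedding where

  open import Data.Nat.Base as ℕ using (ℕ; suc)
  import Data.Nat.Properties as ℕ
  import Data.Nat.Coprimality as Coprime
  open import Data.Integer.Base as ℤ using (ℤ; +_; -[1+_])
  import Data.Integer.Properties as ℤ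
  open import Data.Rational
  open import Data.Rational.Properties
  open import Data.Product.Base using (∃; _,_)
  open import Relation.Binary.PropositionalEquality

  -- Abstract, because + n / 1 unfolds to a quotient by a gcd.
  abstract
    ι : ℕ → ℚ
    ι n = + n / 1

    ι-def : ∀ n → ι n ≡ + n / 1
    ι-def n = refl

    private
      -- The reduced fraction with denominator 1, written without a gcd, so that numerators and
      -- order relations can be read off.
      ι′ : ℤ → ℚ
      ι′ z = mkℚ z 0 (Coprime.sym (Coprime.1-coprimeTo ℤ.∣ z ∣))

      ι≡ι′ : ∀ n → ι n ≡ ι′ (+ n)
      ι≡ι′ n = ↥p/↧p≡p (ι′ (+ n))

    ι-+ : ∀ m n → ι (m ℕ.+ n) ≡ ι m + ι n
    ι-+ m n = sym (trans (cong₂ _+_ (ι≡ι′ m) (ι≡ι′ n))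
      (cong (_/ 1) (cong₂ ℤ._+_ (ℤ.*-identityʳ (+ m)) (ℤ.*-identityʳ (+ n)))))

    ι-* : ∀ m n → ι (m ℕ.* n) ≡ ι m * ι n
    ι-* m n = sym (trans (cong₂ _*_ (ι≡ι′ m) (ι≡ι′ n)) (cong (_/ 1) (sym (ℤ.pos-* m n))))

    ι-mono-≤ : ∀ {m n} → m ℕ.≤ n → ι m ≤ ι n
    ι-mono-≤ {m} {n} m≤n = subst₂ _≤_ (sym (ι≡ι′ m)) (sym (ι≡ι′ n))
      (*≤* (ℤ.*-monoʳ-≤-nonNeg (+ 1) (ℤ.+≤+ m≤n)))

    ι-cancel-≤ : ∀ {m n} → ι m ≤ ι n → m ℕ.≤ n
    ι-cancel-≤ {m} {n} p = ℤ.drop‿+≤+ (subst₂ ℤ._≤_ (ℤ.*-identityʳ (+ m)) (ℤ.*-identityʳ (+ n))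
      (drop-*≤* (subst₂ _≤_ (ι≡ι′ m) (ι≡ι′ n) p)))

    archimedean : ∀ p → ∃ λ n → p ≤ ι n
    archimedean p@(mkℚ z d _) = ℤ.∣ z ∣ , subst (p ≤_) (sym (ι≡ι′ ℤ.∣ z ∣)) (*≤* (begin
      z ℤ.* + 1                 ≡⟨ ℤ.*-identityʳ z ⟩
      z                         ≤⟨ i≤∣i∣ z ⟩
      + ℤ.∣ z ∣                 ≤⟨ ℤ.+≤+ (ℕ.m≤m*n ℤ.∣ z ∣ (suc d)) ⟩
      + (ℤ.∣ z ∣ ℕ.* suc d)     ≡⟨ ℤ.pos-* ℤ.∣ z ∣ (suc d) ⟩
      + ℤ.∣ z ∣ ℤ.* + suc d     ∎))
      where
      open ℤ.≤-Reasoning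
      i≤∣i∣ : ∀ i → i ℤ.≤ + ℤ.∣ i ∣
      i≤∣i∣ (+ n)     = ℤ.≤-refl
      i≤∣i∣ -[1+ n ]  = ℤ.-≤+

-- Ordered-field lemmas, powers and Bernoulli bounds

module Rationals where

  open RationalEmbedding public
  open import Data.Nat.Base as ℕ using (ℕ; zero; suc)
  import Data.Nat.Properties as ℕ
  open import Data.Integer.Base using (+_)
  open import Data.Rational
  open import Data.Rational.Properties
  open import Data.Rational.Solver using (module +-*-Solver)
  open import Data.Product.Base using (∃; _×_; _,_; proj₁; proj₂)
  open import Data.Sum.Base using (inj₁; inj₂)
  open import Algebra.Bundles using (CommutativeRing)
  open import Relation.Binary.PropositionalEquality
  open import Relation.Nullary using (yes; no)
  open import Algebra.Properties.Semiring.Exp (CommutativeRing.semiring +-*-commutativeRing) public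
    using () renaming (_^_ to _↑_; ^-homo-* to ↑-homo-*; ^-assocʳ to ↑-assocʳ)
  open import Algebra.Properties.CommutativeSemiring.Exp (CommutativeRing.commutativeSemiring +-*-commutativeRing) public
    using () renaming (^-distrib-* to ↑-distrib-*)

  -- A linear inequality follows from another once the difference of the two
  -- sides is the same.
  by : ∀ {x y l r} → l ≤ r → x + r ≡ y + l → x ≤ y
  by {x} {y} {l} {r} l≤r e = subst₂ _≤_ (cancel x r) (cancel y r)
    (+-monoˡ-≤ (- r) (≤-trans (≤-reflexive e) (+-monoʳ-≤ y l≤r)))
    where
    open +-*-Solver
    cancel : ∀ x r → x + r + - r ≡ x
    cancel = solve 2 (λ x r → x :+ r :+ (:- r) := x) refl

  ι-0 : ι 0 ≡ 0ℚ
  ι-0 = ι-def 0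

  ι-1 : ι 1 ≡ 1ℚ
  ι-1 = ι-def 1

  1≤ι : ∀ n → 1ℚ ≤ ι (suc n)
  1≤ι n = subst (_≤ ι (suc n)) ι-1 (ι-mono-≤ (ℕ.s≤s ℕ.z≤n))

  ι-suc : ∀ n → ι (suc n) ≡ 1ℚ + ι n
  ι-suc n = trans (ι-+ 1 n) (cong (_+ ι n) ι-1)

  ι-mono-< : ∀ {m n} → m ℕ.< n → ι m < ι n
  ι-mono-< m<n = ≰⇒> λ p → ℕ.<⇒≱ m<n (ι-cancel-≤ p)

  0≤ι : ∀ n → 0ℚ ≤ ι n
  0≤ι n = subst (_≤ ι n) ι-0 (ι-mono-≤ ℕ.z≤n)

  0<ι : ∀ n → 0ℚ < ι (suc n)
  0<ι n = subst (_< ι (suc n)) ι-0 (ι-mono-< (ℕ.s≤s ℕ.z≤n))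

  ι-^ : ∀ m n → ι (m ℕ.^ n) ≡ ι m ↑ n
  ι-^ m zero    = ι-1
  ι-^ m (suc n) = trans (ι-* m (m ℕ.^ n)) (cong (ι m *_) (ι-^ m n))

  *-monoˡ-≤ : ∀ {x} → 0ℚ ≤ x → ∀ {y z} → y ≤ z → x * y ≤ x * z
  *-monoˡ-≤ {x} 0≤x = *-monoˡ-≤-nonNeg x {{nonNegative 0≤x}}

  *-monoʳ-≤ : ∀ {x} → 0ℚ ≤ x → ∀ {y z} → y ≤ z → y * x ≤ z * x
  *-monoʳ-≤ {x} 0≤x = *-monoʳ-≤-nonNeg x {{nonNegative 0≤x}}

  *-mono-≤ : ∀ {x y u v} → 0ℚ ≤ u → 0ℚ ≤ y → x ≤ y → u ≤ v → x * u ≤ y * v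
  *-mono-≤ 0≤u 0≤y x≤y u≤v = ≤-trans (*-monoʳ-≤ 0≤u x≤y) (*-monoˡ-≤ 0≤y u≤v)

  0≤* : ∀ {x y} → 0ℚ ≤ x → 0ℚ ≤ y → 0ℚ ≤ x * y
  0≤* {x} 0≤x 0≤y = ≤-trans (≤-reflexive (sym (*-zeroʳ x))) (*-monoˡ-≤ 0≤x 0≤y)

  *-cancelˡ-≤ : ∀ {x} → 0ℚ < x → ∀ {y z} → x * y ≤ x * z → y ≤ z
  *-cancelˡ-≤ {x} 0<x = *-cancelˡ-≤-pos x {{positive 0<x}}

  *-monoʳ-< : ∀ {x} → 0ℚ < x → ∀ {y z} → y < z → x * y < x * z
  *-monoʳ-< {x} 0<x = *-monoʳ-<-pos x {{positive 0<x}}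

  0<* : ∀ {x y} → 0ℚ < x → 0ℚ < y → 0ℚ < x * y
  0<* {x} 0<x 0<y = ≤-<-trans (≤-reflexive (sym (*-zeroʳ x))) (*-monoʳ-< 0<x 0<y)

  abstract
    inverse : ∀ {x} → 0ℚ < x → ∃ λ y → 0ℚ < y × x * y ≡ 1ℚ
    inverse {x} 0<x = (1/ x) {{≢0}} , positive⁻¹ _ {{1/pos⇒pos x {{positive 0<x}}}} , *-inverseʳ x {{≢0}}
      where
      ≢0 : NonZero x
      ≢0 = pos⇒nonZero x {{positive 0<x}}

  large-denominator : ∀ {ε} → 0ℚ < ε → ∀ c → ∃ λ q → ι c ≤ ι (suc q) * ε
  large-denominator {ε} 0<ε c with inverse 0<ε
  ... | ε⁻¹ , 0<ε⁻¹ , εε⁻¹≡1 with archimedean (ι c * ε⁻¹)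
  ...   | q , p = q , (begin
    ι c                ≡⟨ *-identityʳ (ι c) ⟨
    ι c * 1ℚ           ≡⟨ cong (ι c *_) (trans (sym εε⁻¹≡1) (*-comm ε ε⁻¹)) ⟩
    ι c * (ε⁻¹ * ε)    ≡⟨ *-assoc (ι c) ε⁻¹ ε ⟨
    ι c * ε⁻¹ * ε      ≤⟨ *-monoʳ-≤ (<⇒≤ 0<ε) p ⟩
    ι q * ε            ≤⟨ *-monoʳ-≤ (<⇒≤ 0<ε) (ι-mono-≤ (ℕ.n≤1+n q)) ⟩
    ι (suc q) * ε      ∎)
    where open ≤-Reasoning

  -- The integer part of p, encoded as a difference u − v of natural numbers.
  abstract
    floor-pair : ∀ p → ∃ λ u → ∃ λ v → ι u ≤ p + ι v × p + ι v ≤ ι u + 1ℚ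
    floor-pair p with archimedean (- p)
    ... | v , -p≤v = let u , lo , hi = search (proj₁ (archimedean (p + ι v))) (proj₂ (archimedean (p + ι v)))
                     in u , v , lo , hi
      where
      open +-*-Solver
      0≤p+v : 0ℚ ≤ p + ι v
      0≤p+v = by -p≤v (solve 2 (λ p v → con 0ℚ :+ v := (p :+ v) :+ (:- p)) refl p (ι v))

      search : ∀ M → p + ι v ≤ ι M → ∃ λ u → ι u ≤ p + ι v × p + ι v ≤ ι u + 1ℚ
      search zero    p≤ = zero , subst (_≤ p + ι v) (sym ι-0) 0≤p+v , ≤-trans p≤ (by (<⇒≤ (positive⁻¹ 1ℚ))
        (solve 1 (λ z → z :+ con 1ℚ := (z :+ con 1ℚ) :+ con 0ℚ) refl (ι 0)))
      search (suc M) p≤ with ι M ≤? p + ι v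
      ... | yes M≤p = M , M≤p , ≤-trans p≤ (≤-reflexive (trans (ι-suc M) (+-comm 1ℚ (ι M))))
      ... | no  M≰p = search M (<⇒≤ (≰⇒> M≰p))

  0≤↑ : ∀ {x} → 0ℚ ≤ x → ∀ n → 0ℚ ≤ x ↑ n
  0≤↑ 0≤x zero    = <⇒≤ (positive⁻¹ 1ℚ)
  0≤↑ 0≤x (suc n) = 0≤* 0≤x (0≤↑ 0≤x n)

  0<↑ : ∀ {x} → 0ℚ < x → ∀ n → 0ℚ < x ↑ n
  0<↑ 0<x zero    = positive⁻¹ 1ℚ
  0<↑ 0<x (suc n) = 0<* 0<x (0<↑ 0<x n)

  ↑-monoˡ-≤ : ∀ {x y} → 0ℚ ≤ x → x ≤ y → ∀ n → x ↑ n ≤ y ↑ n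
  ↑-monoˡ-≤ 0≤x x≤y zero    = ≤-refl
  ↑-monoˡ-≤ 0≤x x≤y (suc n) = *-mono-≤ (0≤↑ 0≤x n) (≤-trans 0≤x x≤y) x≤y (↑-monoˡ-≤ 0≤x x≤y n)

  0<1 : 0ℚ < 1ℚ
  0<1 = positive⁻¹ 1ℚ

  ↑-grow : ∀ {x} → 1ℚ ≤ x → ∀ n → x ↑ n ≤ x ↑ suc n
  ↑-grow {x} 1≤x n = ≤-trans (≤-reflexive (sym (*-identityˡ (x ↑ n))))
    (*-monoʳ-≤ (0≤↑ (≤-trans (<⇒≤ 0<1) 1≤x) n) 1≤x)

  ↑-monoʳ-≤ : ∀ {x} → 1ℚ ≤ x → ∀ {m n} → m ℕ.≤ n → x ↑ m ≤ x ↑ n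
  ↑-monoʳ-≤ 1≤x {n = zero}  ℕ.z≤n = ≤-refl
  ↑-monoʳ-≤ 1≤x {n = suc n} ℕ.z≤n = ≤-trans (↑-monoʳ-≤ 1≤x (ℕ.z≤n {n})) (↑-grow 1≤x n)
  ↑-monoʳ-≤ 1≤x (ℕ.s≤s m≤n) = *-monoˡ-≤ (≤-trans (<⇒≤ 0<1) 1≤x) (↑-monoʳ-≤ 1≤x m≤n)

  ↑-cancel-< : ∀ {x} → 1ℚ ≤ x → ∀ {m n} → x ↑ m < x ↑ n → m ℕ.< n
  ↑-cancel-< 1≤x x^m<x^n = ℕ.≰⇒> λ n≤m → <-irrefl refl (<-≤-trans x^m<x^n (↑-monoʳ-≤ 1≤x n≤m))

  ↑-grow-< : ∀ {x} → 1ℚ < x → ∀ n → x ↑ n < x ↑ suc n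
  ↑-grow-< {x} 1<x n = begin-strict
    x ↑ n         ≡⟨ *-identityʳ (x ↑ n) ⟨
    x ↑ n * 1ℚ    <⟨ *-monoʳ-< (0<↑ (<-trans 0<1 1<x) n) 1<x ⟩
    x ↑ n * x     ≡⟨ *-comm (x ↑ n) x ⟩
    x * x ↑ n     ∎
    where open ≤-Reasoning

  ↑-cancel-≤ : ∀ {x} → 1ℚ < x → ∀ {m n} → x ↑ m ≤ x ↑ n → m ℕ.≤ n
  ↑-cancel-≤ 1<x {m} {n} x^m≤x^n = ℕ.≤-pred (↑-cancel-< (<⇒≤ 1<x) (≤-<-trans x^m≤x^n (↑-grow-< 1<x n)))

  1≤↑ : ∀ {x} → 1ℚ ≤ x → ∀ n → 1ℚ ≤ x ↑ n
  1≤↑ 1≤x n = ↑-monoʳ-≤ 1≤x (ℕ.z≤n {n})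

  ↑-cancelˡ-≤ : ∀ {x y} → 0ℚ ≤ y → ∀ n → x ↑ suc n ≤ y ↑ suc n → x ≤ y
  ↑-cancelˡ-≤ {x} {y} 0≤y n x^n≤y^n = ≮⇒≥ λ y<x → <-irrefl refl (<-≤-trans (strict y<x n) x^n≤y^n)
    where
    strict : y < x → ∀ n → y ↑ suc n < x ↑ suc n
    strict y<x zero    = subst₂ _<_ (sym (*-identityʳ y)) (sym (*-identityʳ x)) y<x
    strict y<x (suc n) = ≤-<-trans (*-monoʳ-≤ (0≤↑ 0≤y (suc n)) (<⇒≤ y<x)) (*-monoʳ-< (≤-<-trans 0≤y y<x) (strict y<x n))

  -- A crude counterpart to Bernoulli. The constant c triples at each step because η, cη and cη² are
  -- all at most cη.
  1+η↑≤ : ∀ {η} → 0ℚ ≤ η → η ≤ 1ℚ → ∀ n → (1ℚ + η) ↑ n ≤ 1ℚ + ι (3 ℕ.^ n) * η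
  1+η↑≤ {η} 0≤η η≤1 zero = subst (λ x → 1ℚ ≤ 1ℚ + x * η) (sym ι-1)
    (by 0≤η (solve 1 (λ η → con 1ℚ :+ η := (con 1ℚ :+ con 1ℚ :* η) :+ con 0ℚ) refl η))
    where open +-*-Solver
  1+η↑≤ {η} 0≤η η≤1 (suc n) = begin
    (1ℚ + η) * (1ℚ + η) ↑ n         ≤⟨ *-monoˡ-≤ {1ℚ + η} 0≤1+η (1+η↑≤ 0≤η η≤1 n) ⟩
    (1ℚ + η) * (1ℚ + c * η)         ≤⟨ by (+-mono-≤ (*-monoʳ-≤ 0≤η 1≤c) (*-monoˡ-≤ (0≤* 0≤c 0≤η) η≤1))
                                        (solve 2 (λ c η → (con 1ℚ :+ η) :* (con 1ℚ :+ c :* η) :+ (c :* η :+ c :* η :* con 1ℚ)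
                                           := (con 1ℚ :+ con (+ 3 / 1) :* c :* η) :+ (con 1ℚ :* η :+ c :* η :* η)) refl c η) ⟩
    1ℚ + + 3 / 1 * c * η            ≡⟨ cong (λ x → 1ℚ + x * η) (trans (ι-* 3 (3 ℕ.^ n)) (cong (_* c) (ι-def 3))) ⟨
    1ℚ + ι (3 ℕ.^ suc n) * η        ∎
    where
    open ≤-Reasoning
    open +-*-Solver
    0≤1+η : 0ℚ ≤ 1ℚ + η
    0≤1+η = +-mono-≤ {0ℚ} {1ℚ} {0ℚ} {η} (<⇒≤ 0<1) 0≤η

    c = ι (3 ℕ.^ n)
    1≤c : 1ℚ ≤ c
    1≤c = subst (_≤ c) ι-1 (ι-mono-≤ (ℕ.m^n>0 3 n))
    0≤c : 0ℚ ≤ c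
    0≤c = 0≤ι (3 ℕ.^ n)

  bernoulli : ∀ {δ} → 0ℚ ≤ δ → ∀ n → 1ℚ + ι n * δ ≤ (1ℚ + δ) ↑ n
  bernoulli {δ} 0≤δ zero = ≤-reflexive (trans (cong (λ x → 1ℚ + x * δ) ι-0)
    (solve 1 (λ δ → con 1ℚ :+ con 0ℚ :* δ := con 1ℚ) refl δ))
    where open +-*-Solver
  bernoulli {δ} 0≤δ (suc n) = begin
    1ℚ + ι (suc n) * δ            ≡⟨ cong (λ x → 1ℚ + x * δ) (ι-suc n) ⟩
    1ℚ + (1ℚ + ι n) * δ           ≤⟨ by (0≤* (0≤* (0≤ι n) 0≤δ) 0≤δ)
                                       (solve 2 (λ n δ → con 1ℚ :+ (con 1ℚ :+ n) :* δ :+ n :* δ :* δ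
                                          := (con 1ℚ :+ δ) :* (con 1ℚ :+ n :* δ) :+ con 0ℚ) refl (ι n) δ) ⟩
    (1ℚ + δ) * (1ℚ + ι n * δ)     ≤⟨ *-monoˡ-≤ {1ℚ + δ} (+-mono-≤ {0ℚ} {1ℚ} {0ℚ} {δ} (<⇒≤ 0<1) 0≤δ) (bernoulli 0≤δ n) ⟩
    (1ℚ + δ) * (1ℚ + δ) ↑ n       ∎
    where
    open ≤-Reasoning
    open +-*-Solver

  abstract
    -- Stands in for the M-th root of 1 + δ: η = 1/q with q δ ≥ 3^M suffices by `1+η↑≤`.
    small-step : ∀ {δ} → 0ℚ < δ → ∀ M → ∃ λ η → 0ℚ < η × (1ℚ + η) ↑ M ≤ 1ℚ + δ
    small-step {δ} 0<δ M = η , 0<η , ≤-trans (1+η↑≤ (<⇒≤ 0<η) η≤1 M) (+-monoʳ-≤ 1ℚ 3^Mη≤δ)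
      where
      open ≤-Reasoning
      q : ℕ
      q = suc (proj₁ (large-denominator 0<δ (3 ℕ.^ M)))

      η : ℚ
      η = proj₁ (inverse (0<ι (proj₁ (large-denominator 0<δ (3 ℕ.^ M)))))

      0<η : 0ℚ < η
      0<η = proj₁ (proj₂ (inverse (0<ι _)))

      qη≡1 : ι q * η ≡ 1ℚ
      qη≡1 = proj₂ (proj₂ (inverse (0<ι _)))

      rotate : ∀ x y z → x * y * z ≡ x * z * y
      rotate = solve 3 (λ x y z → x :* y :* z := x :* z :* y) refl
        where open +-*-Solver

      3^Mη≤δ : ι (3 ℕ.^ M) * η ≤ δ
      3^Mη≤δ = begin
        ι (3 ℕ.^ M) * η     ≤⟨ *-monoʳ-≤ (<⇒≤ 0<η) (proj₂ (large-denominator 0<δ (3 ℕ.^ M))) ⟩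
        ι q * δ * η         ≡⟨ rotate (ι q) δ η ⟩
        ι q * η * δ         ≡⟨ cong (_* δ) qη≡1 ⟩
        1ℚ * δ              ≡⟨ *-identityˡ δ ⟩
        δ                   ∎

      η≤1 : η ≤ 1ℚ
      η≤1 = begin
        η                 ≡⟨ *-identityˡ η ⟨
        1ℚ * η            ≤⟨ *-monoʳ-≤ (<⇒≤ 0<η) (1≤ι _) ⟩
        ι q * η           ≡⟨ qη≡1 ⟩
        1ℚ                ∎

  ∣∣<ε : ∀ {x ε} → x < ε → - x < ε → ∣ x ∣ < ε
  ∣∣<ε {x} x<ε -x<ε with ∣p∣≡p∨∣p∣≡-p x
  ... | inj₁ e = subst (_< _) (sym e) x<ε
  ... | inj₂ e = subst (_< _) (sym e) -x<ε

  x≤∣x∣ : ∀ x → x ≤ ∣ x ∣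
  x≤∣x∣ x with ∣p∣≡p∨∣p∣≡-p x
  ... | inj₁ e = ≤-reflexive (sym e)
  ... | inj₂ e = ≤-trans (by (subst (0ℚ ≤_) e (0≤∣p∣ x)) (solve 1 (λ x → x :+ (:- x) := con 0ℚ :+ con 0ℚ) refl x)) (0≤∣p∣ x)
    where open +-*-Solver

-- Logarithms of natural numbers to a real base

module Logarithm where

  open Rationals
  open import Data.Nat.Base as ℕ using (ℕ; zero; suc)
  import Data.Nat.Properties as ℕ
  open import Data.Nat.Tactic.RingSolver using (solve-∀)
  open import Data.Rational
  open import Data.Rational.Properties
  open import Data.Rational.Solver using (module +-*-Solver)
  open import Data.Product.Base using (∃; _×_; _,_; proj₁; proj₂)
  open import Relation.Binary.PropositionalEquality
  open import Relation.Nullary using (yes; no)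
  open import Defs as D using (ℝ; mkℝ; seq; cauchy; fromℕ; IsLog; IsCauchy; 1ℝ)

  Eventually : (ℕ → Set) → Set
  Eventually P = ∃ λ N → ∀ n → N ℕ.≤ n → P n

  private variable
    P P′ P″ : ℕ → Set

  ev-map : (∀ n → P n → P′ n) → Eventually P → Eventually P′
  ev-map f (N , p) = N , λ n N≤n → f n (p n N≤n)

  ev-map₂ : (∀ n → P n → P′ n → P″ n) → Eventually P → Eventually P′ → Eventually P″
  ev-map₂ f (M , p) (N , p′) = M ℕ.⊔ N , λ n h →
    f n (p n (ℕ.m⊔n≤o⇒m≤o M N h)) (p′ n (ℕ.m⊔n≤o⇒n≤o M N h))

  ev-× : Eventually P → Eventually P′ → Eventually (λ n → P n × P′ n)
  ev-× = ev-map₂ λ _ → _,_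

  ev-≥ : ∀ N → Eventually (N ℕ.≤_)
  ev-≥ N = N , λ _ h → h

  ev-witness : Eventually P → ∃ P
  ev-witness (N , p) = N , p N ℕ.≤-refl

  ev-const : ∀ {A : Set} → Eventually (λ _ → A) → A
  ev-const e = proj₂ (ev-witness e)

  seq-^ : ∀ x a n → seq (x D.^ a) n ≡ seq x n ↑ a
  seq-^ x zero    n = refl
  seq-^ x (suc a) n = cong (seq x n *_) (seq-^ x a n)

  private
    -- A spare factor t between high powers becomes an additive gap η between the bases, by X + η ≤
    -- X (1 + η) for X ≥ 1. As η depends on δ and M alone, it serves all terms of the sequences, as
    -- `<` on reals demands.
    root-gap : ∀ {X Y t δ} M → 1ℚ ≤ X → 0ℚ ≤ Y → 1ℚ + δ ≤ t → X ↑ suc M * t ≤ Y ↑ suc M →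
      ∀ {η} → 0ℚ < η → (1ℚ + η) ↑ suc M ≤ 1ℚ + δ → X + η ≤ Y
    root-gap {X} {Y} {t} {δ} M 1≤X 0≤Y 1+δ≤t X^Mt≤Y^M {η} 0<η step = ↑-cancelˡ-≤ 0≤Y M (begin
      (X + η) ↑ suc M                    ≤⟨ ↑-monoˡ-≤ {X + η} 0≤X+η X+η≤ (suc M) ⟩
      (X * (1ℚ + η)) ↑ suc M             ≡⟨ ↑-distrib-* X (1ℚ + η) (suc M) ⟩
      X ↑ suc M * (1ℚ + η) ↑ suc M       ≤⟨ *-monoˡ-≤ (0≤↑ 0≤X (suc M)) (≤-trans step 1+δ≤t) ⟩
      X ↑ suc M * t                      ≤⟨ X^Mt≤Y^M ⟩
      Y ↑ suc M                          ∎)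
      where
      open ≤-Reasoning
      open +-*-Solver
      0≤X : 0ℚ ≤ X
      0≤X = ≤-trans (<⇒≤ 0<1) 1≤X

      0≤X+η : 0ℚ ≤ X + η
      0≤X+η = +-mono-≤ {0ℚ} {X} {0ℚ} {η} 0≤X (<⇒≤ 0<η)

      X+η≤ : X + η ≤ X * (1ℚ + η)
      X+η≤ = by (*-monoʳ-≤ (<⇒≤ 0<η) 1≤X) (solve 2 (λ X η → X :+ η :+ X :* η := X :* (con 1ℚ :+ η) :+ con 1ℚ :* η) refl X η)

    -- Descending search for the integer part of the logarithm of X to base t; its default 0 is
    -- correct because X ≥ 1 in all uses.
    search : ℚ → ℚ → ℕ → ℕ
    search t X zero    = zero
    search t X (suc k) with t ↑ suc k ≤? X
    ... | yes _ = suc k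
    ... | no  _ = search t X k

    search-≤ : ∀ t X k → search t X k ℕ.≤ k
    search-≤ t X zero    = ℕ.z≤n
    search-≤ t X (suc k) with t ↑ suc k ≤? X
    ... | yes _ = ℕ.≤-refl
    ... | no  _ = ℕ.m≤n⇒m≤1+n (search-≤ t X k)

    search-lower : ∀ t X → 1ℚ ≤ X → ∀ k → t ↑ search t X k ≤ X
    search-lower t X 1≤X zero    = 1≤X
    search-lower t X 1≤X (suc k) with t ↑ suc k ≤? X
    ... | yes t^k≤X = t^k≤X
    ... | no  _     = search-lower t X 1≤X k

    search-upper : ∀ t X k → X < t ↑ suc k → X < t ↑ suc (search t X k)
    search-upper t X zero    X<t = X<t
    search-upper t X (suc k) X<t with t ↑ suc k ≤? X
    ... | yes _     = X<t
    ... | no  t^k≰X = search-upper t X k (≰⇒> t^k≰X)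

  -- log_τ V is the limit of a n / (n + 1), where a n is the integer part of
  -- the logarithm of V^(n+1) to the rational base seq τ n.
  module Log (τ : ℝ) (1<τ : 1ℝ D.< τ) (V : ℕ) (1≤V : 1 ℕ.≤ V) where
    private
      t : ℕ → ℚ
      t = seq τ

      δ : ℚ
      δ = proj₁ 1<τ

      0<δ : 0ℚ < δ
      0<δ = proj₁ (proj₂ 1<τ)

      ev-1+δ≤t : Eventually (λ n → 1ℚ + δ ≤ t n)
      ev-1+δ≤t = proj₂ (proj₂ 1<τ)

      1<1+δ : 1ℚ < 1ℚ + δ
      1<1+δ = subst (_< 1ℚ + δ) (+-identityʳ 1ℚ) (+-monoʳ-< 1ℚ 0<δ)

      0≤1+δ : 0ℚ ≤ 1ℚ + δ
      0≤1+δ = <⇒≤ (<-trans 0<1 1<1+δ)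

      v : ℚ
      v = ι V

      1≤v : 1ℚ ≤ v
      1≤v = subst (_≤ v) ι-1 (ι-mono-≤ 1≤V)

      0≤v : 0ℚ ≤ v
      0≤v = 0≤ι V

      -- V ≤ (1 + δ)^B by Bernoulli, so log_τ V ≤ B and the search for the logarithm of V^(n+1) can
      -- start at B (n + 1).
      B : ℕ
      B = suc (proj₁ (large-denominator 0<δ V))

      v≤[1+δ]^B : v ≤ (1ℚ + δ) ↑ B
      v≤[1+δ]^B = ≤-trans (proj₂ (large-denominator 0<δ V)) (≤-trans
        (by (<⇒≤ 0<1) (solve 1 (λ x → x :+ con 1ℚ := (con 1ℚ :+ x) :+ con 0ℚ) refl (ι B * δ)))
        (bernoulli (<⇒≤ 0<δ) B))
        where open +-*-Solver

      a : ℕ → ℕ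
      a n = search (t n) (v ↑ suc n) (B ℕ.* suc n)

      inv : ℕ → ℚ
      inv n = proj₁ (inverse (0<ι n))

      x : ℕ → ℚ
      x n = ι (a n) * inv n

      x*[1+n]≡a : ∀ n → x n * ι (suc n) ≡ ι (a n)
      x*[1+n]≡a n = trans (*-assoc (ι (a n)) (inv n) (ι (suc n)))
        (trans (cong (ι (a n) *_) (trans (*-comm (inv n) (ι (suc n))) (proj₂ (proj₂ (inverse (0<ι n))))))
          (*-identityʳ (ι (a n))))

      x≤B : ∀ n → x n ≤ ι B
      x≤B n = *-cancelˡ-≤ (0<ι n) (begin
        ι (suc n) * x n          ≡⟨ trans (*-comm (ι (suc n)) (x n)) (x*[1+n]≡a n) ⟩
        ι (a n)                  ≤⟨ ι-mono-≤ (search-≤ (t n) (v ↑ suc n) (B ℕ.* suc n)) ⟩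
        ι (B ℕ.* suc n)          ≡⟨ trans (ι-* B (suc n)) (*-comm (ι B) (ι (suc n))) ⟩
        ι (suc n) * ι B          ∎)
        where open ≤-Reasoning

      1<t⇒ : ∀ {n} → 1ℚ + δ ≤ t n → 1ℚ < t n
      1<t⇒ = <-≤-trans 1<1+δ

      lower : ∀ n → t n ↑ a n ≤ v ↑ suc n
      lower n = search-lower (t n) (v ↑ suc n) (1≤↑ 1≤v (suc n)) (B ℕ.* suc n)

      upper : ∀ n → 1ℚ + δ ≤ t n → v ↑ suc n < t n ↑ suc (a n)
      upper n 1+δ≤t = search-upper (t n) (v ↑ suc n) (B ℕ.* suc n) (begin-strict
        v ↑ suc n                        ≤⟨ ↑-monoˡ-≤ 0≤v v≤[1+δ]^B (suc n) ⟩
        ((1ℚ + δ) ↑ B) ↑ suc n           ≡⟨ ↑-assocʳ (1ℚ + δ) B (suc n) ⟩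
        (1ℚ + δ) ↑ (B ℕ.* suc n)         ≤⟨ ↑-monoˡ-≤ 0≤1+δ 1+δ≤t (B ℕ.* suc n) ⟩
        t n ↑ (B ℕ.* suc n)              <⟨ ↑-grow-< (1<t⇒ 1+δ≤t) (B ℕ.* suc n) ⟩
        t n ↑ suc (B ℕ.* suc n)          ∎)
        where open ≤-Reasoning

      -- a n / (n + 1) ≤ (1 + 1/M) (a k + 1) / (k + 1)
      compare : ∀ M n k → 1ℚ + δ ≤ t n → 1ℚ + δ ≤ t k → t k ↑ M ≤ t n ↑ suc M →
        a n ℕ.* (suc k ℕ.* M) ℕ.≤ suc M ℕ.* (suc (a k) ℕ.* suc n)
      compare M n k tn tk near = ↑-cancel-≤ (1<t⇒ tn) (begin
        t n ↑ (a n ℕ.* (suc k ℕ.* M))             ≡⟨ ↑-assocʳ (t n) (a n) (suc k ℕ.* M) ⟨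
        (t n ↑ a n) ↑ (suc k ℕ.* M)               ≤⟨ ↑-monoˡ-≤ (0≤↑ (0≤t tn) (a n)) (lower n) (suc k ℕ.* M) ⟩
        (v ↑ suc n) ↑ (suc k ℕ.* M)               ≡⟨ ↑-assocʳ v (suc n) (suc k ℕ.* M) ⟩
        v ↑ (suc n ℕ.* (suc k ℕ.* M))             ≡⟨ cong (v ↑_) (e₁ (suc n) (suc k) M) ⟩
        v ↑ (suc k ℕ.* (suc n ℕ.* M))             ≡⟨ ↑-assocʳ v (suc k) (suc n ℕ.* M) ⟨
        (v ↑ suc k) ↑ (suc n ℕ.* M)               ≤⟨ ↑-monoˡ-≤ (0≤↑ 0≤v (suc k)) (<⇒≤ (upper k tk)) (suc n ℕ.* M) ⟩
        (t k ↑ suc (a k)) ↑ (suc n ℕ.* M)         ≡⟨ ↑-assocʳ (t k) (suc (a k)) (suc n ℕ.* M) ⟩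
        t k ↑ (suc (a k) ℕ.* (suc n ℕ.* M))       ≡⟨ cong (t k ↑_) (e₂ (suc (a k)) (suc n) M) ⟩
        t k ↑ (M ℕ.* (suc (a k) ℕ.* suc n))       ≡⟨ ↑-assocʳ (t k) M (suc (a k) ℕ.* suc n) ⟨
        (t k ↑ M) ↑ (suc (a k) ℕ.* suc n)         ≤⟨ ↑-monoˡ-≤ (0≤↑ (0≤t tk) M) near (suc (a k) ℕ.* suc n) ⟩
        (t n ↑ suc M) ↑ (suc (a k) ℕ.* suc n)     ≡⟨ ↑-assocʳ (t n) (suc M) (suc (a k) ℕ.* suc n) ⟩
        t n ↑ (suc M ℕ.* (suc (a k) ℕ.* suc n))   ∎)
        where
        open ≤-Reasoning
        0≤t : ∀ {n} → 1ℚ + δ ≤ t n → 0ℚ ≤ t n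
        0≤t p = <⇒≤ (<-trans 0<1 (1<t⇒ p))

        e₁ : ∀ n k M → n ℕ.* (k ℕ.* M) ≡ k ℕ.* (n ℕ.* M)
        e₁ = solve-∀

        e₂ : ∀ a n M → a ℕ.* (n ℕ.* M) ≡ M ℕ.* (a ℕ.* n)
        e₂ = solve-∀

      x-cauchy : IsCauchy x
      -- Beyond K the bases are η-close, beyond N they are at least 1 + δ, and n ≥ M makes (M +
      -- 1)/(n + 1) at most 1.
      x-cauchy ε 0<ε = K ℕ.⊔ (N ℕ.⊔ M) , λ m n m≥ n≥ →
        ∣∣<ε (close m n m≥ n≥) (subst (_< ε) (solve 2 (λ a b → b :- a := :- (a :- b)) refl (x m) (x n)) (close n m n≥ m≥))
        where
        open +-*-Solver
        -- `compare` gives M (x m - x n) ≤ x n + (M + 1)/(n + 1) ≤ B + 1; asking for B + 2 ≤ M ε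
        -- makes the final inequality strict.
        ld = large-denominator 0<ε (2 ℕ.+ B)
        M′ M : ℕ
        M′ = proj₁ ld
        M = suc M′

        st = small-step 0<δ M
        η = proj₁ st
        0<η = proj₁ (proj₂ st)

        K = proj₁ (cauchy τ η 0<η)
        N = proj₁ ev-1+δ≤t

        near : ∀ m n → K ℕ.≤ m → K ℕ.≤ n → 1ℚ + δ ≤ t m → 1ℚ + δ ≤ t n → t n ↑ M ≤ t m ↑ suc M
        near m n Km Kn tm tn = begin
          t n ↑ M                         ≤⟨ ↑-monoˡ-≤ (<⇒≤ (<-trans 0<1 (1<t⇒ tn))) tn≤ M ⟩
          ((1ℚ + η) * t m) ↑ M            ≡⟨ ↑-distrib-* (1ℚ + η) (t m) M ⟩
          (1ℚ + η) ↑ M * t m ↑ M          ≤⟨ *-monoʳ-≤ (0≤↑ (<⇒≤ (<-trans 0<1 (1<t⇒ tm))) M) (≤-trans (proj₂ (proj₂ st)) tm) ⟩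
          t m * t m ↑ M                   ∎
          where
          open ≤-Reasoning
          tn≤ : t n ≤ (1ℚ + η) * t m
          tn≤ = by (+-mono-≤ (≤-trans (x≤∣x∣ (t n - t m)) (<⇒≤ (proj₂ (cauchy τ η 0<η) n m Kn Km)))
                     (*-monoˡ-≤ (<⇒≤ 0<η) (<⇒≤ (1<t⇒ tm))))
            (solve 3 (λ n m η → n :+ (η :+ η :* m) := (con 1ℚ :+ η) :* m :+ ((n :- m) :+ η :* con 1ℚ)) refl (t n) (t m) η)

        close : ∀ m n → K ℕ.⊔ (N ℕ.⊔ M) ℕ.≤ m → K ℕ.⊔ (N ℕ.⊔ M) ℕ.≤ n → x m - x n < ε
        close m n m≥ n≥ = *-cancelˡ-<-nonNeg (ι (M ℕ.* suc n)) {{nonNegative (0≤ι (M ℕ.* suc n))}} (begin-strict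
          ι (M ℕ.* suc n) * (x m - x n)            ≤⟨ *-cancelˡ-≤ (0<ι m) scaled ⟩
          ι (suc B) * ι (suc n)                    <⟨ subst₂ _<_ (*-comm (ι (suc n)) (ι (suc B))) (*-comm (ι (suc n)) (ι (2 ℕ.+ B)))
                                                        (*-monoʳ-< (0<ι n) B+1<B+2) ⟩
          ι (2 ℕ.+ B) * ι (suc n)                  ≤⟨ *-monoʳ-≤ (0≤ι (suc n)) (proj₂ ld) ⟩
          ι M * ε * ι (suc n)                      ≡⟨ solve 3 (λ M ε n → M :* ε :* n := M :* n :* ε) refl (ι M) ε (ι (suc n)) ⟩
          ι M * ι (suc n) * ε                      ≡⟨ cong (_* ε) (ι-* M (suc n)) ⟨
          ι (M ℕ.* suc n) * ε                      ∎)
          where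
          open ≤-Reasoning
          Km = ℕ.m⊔n≤o⇒m≤o K (N ℕ.⊔ M) m≥
          Kn = ℕ.m⊔n≤o⇒m≤o K (N ℕ.⊔ M) n≥
          tm = proj₂ ev-1+δ≤t m (ℕ.m⊔n≤o⇒m≤o N M (ℕ.m⊔n≤o⇒n≤o K (N ℕ.⊔ M) m≥))
          tn = proj₂ ev-1+δ≤t n (ℕ.m⊔n≤o⇒m≤o N M (ℕ.m⊔n≤o⇒n≤o K (N ℕ.⊔ M) n≥))
          M≤n : M ℕ.≤ n
          M≤n = ℕ.m⊔n≤o⇒n≤o N M (ℕ.m⊔n≤o⇒n≤o K (N ℕ.⊔ M) n≥)

          B+1<B+2 : ι (suc B) < ι (2 ℕ.+ B)
          B+1<B+2 = ≰⇒> λ p → ℕ.<-irrefl refl (ι-cancel-≤ p)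

          counts : ι (a m) * (ι (suc n) * ι M) ≤ (1ℚ + ι M) * ((1ℚ + ι (a n)) * ι (suc m))
          counts = subst₂ _≤_
            (trans (ι-* (a m) (suc n ℕ.* M)) (cong (ι (a m) *_) (ι-* (suc n) M)))
            (trans (ι-* (suc M) (suc (a n) ℕ.* suc m)) (cong₂ _*_ (ι-suc M)
              (trans (ι-* (suc (a n)) (suc m)) (cong (_* ι (suc m)) (ι-suc (a n))))))
            (ι-mono-≤ (compare M m n tm tn (near m n Km Kn tm tn)))

          1+M≤1+n : 1ℚ + ι M ≤ ι (suc n)
          1+M≤1+n = subst (_≤ ι (suc n)) (ι-suc M) (ι-mono-≤ (ℕ.s≤s M≤n))

          core-ineq : ∀ (M xm xn B k l : ℚ) → 0ℚ ≤ k → 0ℚ ≤ l →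
            xm * k * (l * M) ≤ (1ℚ + M) * ((1ℚ + xn * l) * k) → xn ≤ B → 1ℚ + M ≤ l →
            k * (M * l * (xm - xn)) ≤ k * ((1ℚ + B) * l)
          core-ineq M xm xn B k l 0≤k 0≤l p q r = by
            (+-mono-≤ p (+-mono-≤ (*-monoˡ-≤ (0≤* 0≤k 0≤l) q) (*-monoˡ-≤ 0≤k r)))
            (solve 6 (λ M xm xn B k l →
               k :* (M :* l :* (xm :- xn)) :+ ((con 1ℚ :+ M) :* ((con 1ℚ :+ xn :* l) :* k) :+ (k :* l :* B :+ k :* l))
               := k :* ((con 1ℚ :+ B) :* l) :+ (xm :* k :* (l :* M) :+ (k :* l :* xn :+ k :* (con 1ℚ :+ M))))
               refl M xm xn B k l)

          scaled : ι (suc m) * (ι (M ℕ.* suc n) * (x m - x n)) ≤ ι (suc m) * (ι (suc B) * ι (suc n))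
          scaled = subst₂ (λ p q → ι (suc m) * (p * (x m - x n)) ≤ ι (suc m) * (q * ι (suc n)))
            (sym (ι-* M (suc n))) (sym (ι-suc B))
            (core-ineq (ι M) (x m) (x n) (ι B) (ι (suc m)) (ι (suc n)) (0≤ι (suc m)) (0≤ι (suc n))
              (subst₂ (λ p q → p * (ι (suc n) * ι M) ≤ (1ℚ + ι M) * ((1ℚ + q) * ι (suc m)))
                (sym (x*[1+n]≡a m)) (sym (x*[1+n]≡a n)) counts)
              (x≤B n) 1+M≤1+n)

    log : ℝ
    log = mkℝ x x-cauchy

    -- The numerical content of `log`: at each late index, an integer exponent that brackets
    -- V^(n+1). Estimates of the distance to a point of Q start from here instead of from `IsLog`.
    log-bracket : Eventually λ n → ∃ λ a → seq log n * ι (suc n) ≡ ι a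
      × seq τ n ↑ a ≤ ι V ↑ suc n × ι V ↑ suc n ≤ seq τ n ↑ suc a
    log-bracket = ev-map (λ n 1+δ≤t → a n , x*[1+n]≡a n , lower n , <⇒≤ (upper n 1+δ≤t)) ev-1+δ≤t

    private
      power : ∀ t c b M k → ((t ↑ c * v ↑ b) ↑ M) ↑ k ≡ t ↑ (c ℕ.* M ℕ.* k) * v ↑ (b ℕ.* M ℕ.* k)
      power t c b M k = begin
        ((t ↑ c * v ↑ b) ↑ M) ↑ k                          ≡⟨ cong (_↑ k) (↑-distrib-* (t ↑ c) (v ↑ b) M) ⟩
        ((t ↑ c) ↑ M * (v ↑ b) ↑ M) ↑ k                    ≡⟨ ↑-distrib-* ((t ↑ c) ↑ M) ((v ↑ b) ↑ M) k ⟩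
        ((t ↑ c) ↑ M) ↑ k * ((v ↑ b) ↑ M) ↑ k              ≡⟨ cong₂ _*_ (assoc₃ t c) (assoc₃ v b) ⟩
        t ↑ (c ℕ.* M ℕ.* k) * v ↑ (b ℕ.* M ℕ.* k)          ∎
        where
        open ≡-Reasoning
        assoc₃ : ∀ x c → ((x ↑ c) ↑ M) ↑ k ≡ x ↑ (c ℕ.* M ℕ.* k)
        assoc₃ x c = trans (cong (_↑ k) (↑-assocʳ x c M)) (↑-assocʳ x (c ℕ.* M) k)

      module _ (α b c : ℕ) (ε : ℚ) (0<ε : 0ℚ < ε) where
        private
          M′ M : ℕ
          M′ = proj₁ (large-denominator 0<ε 2)
          M = suc M′

          2≤Mε : 1ℚ + 1ℚ ≤ ι M * ε
          2≤Mε = subst (_≤ ι M * ε) (trans (ι-suc 1) (cong (_+_ 1ℚ) ι-1)) (proj₂ (large-denominator 0<ε 2))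

          η = proj₁ (small-step 0<δ M)
          0<η = proj₁ (proj₂ (small-step 0<δ M))
          step = proj₂ (proj₂ (small-step 0<δ M))

        -- After raising to the power M (n + 1), the exponents differ by at least ε M (n + 1) ≥ n +
        -- 1. This supplies the factor t that `root-gap` consumes, while `lower` trades powers of t
        -- for powers of V.
        below : Eventually (λ n → ι α + ε ≤ ι c + ι b * x n) →
          Eventually (λ n → t n ↑ α + η ≤ t n ↑ c * v ↑ b)
        below = ev-map₂ (λ n 1+δ≤t h → root-gap {t n ↑ α} {t n ↑ c * v ↑ b} {t n} {δ} M′
            (1≤↑ (<⇒≤ (1<t⇒ 1+δ≤t)) α) (0≤* (0≤↑ (0≤t 1+δ≤t) c) (0≤↑ 0≤v b)) 1+δ≤t
            (↑-cancelˡ-≤ (0≤↑ (0≤* (0≤↑ (0≤t 1+δ≤t) c) (0≤↑ 0≤v b)) M) n (powers n 1+δ≤t h)) 0<η step) ev-1+δ≤t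
          where
          open ≤-Reasoning
          open +-*-Solver
          0≤t : ∀ {n} → 1ℚ + δ ≤ t n → 0ℚ ≤ t n
          0≤t p = <⇒≤ (<-trans 0<1 (1<t⇒ p))

          arith : ∀ (α c b M x k ε : ℚ) → 0ℚ ≤ M → 0ℚ ≤ k → α + ε ≤ c + b * x → 1ℚ ≤ M * ε →
            (α * M + 1ℚ) * k ≤ c * M * k + (x * k) * (b * M)
          arith α c b M x k ε 0≤M 0≤k p q = by (+-mono-≤ (*-monoˡ-≤ (0≤* 0≤M 0≤k) p) (*-monoˡ-≤ 0≤k q))
            (solve 7 (λ α c b M x k ε →
              (α :* M :+ con 1ℚ) :* k :+ (M :* k :* (c :+ b :* x) :+ k :* (M :* ε))
              := c :* M :* k :+ (x :* k) :* (b :* M) :+ (M :* k :* (α :+ ε) :+ k :* con 1ℚ)) refl α c b M x k ε)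

          exponents : ∀ n → ι α + ε ≤ ι c + ι b * x n →
            (α ℕ.* M ℕ.+ 1) ℕ.* suc n ℕ.≤ c ℕ.* M ℕ.* suc n ℕ.+ a n ℕ.* (b ℕ.* M)
          exponents n h = ι-cancel-≤ (subst₂ _≤_
            (sym (trans (ι-* (α ℕ.* M ℕ.+ 1) (suc n)) (cong (_* ι (suc n)) (trans (ι-+ (α ℕ.* M) 1) (cong₂ _+_ (ι-* α M) ι-1)))))
            (sym (trans (ι-+ (c ℕ.* M ℕ.* suc n) (a n ℕ.* (b ℕ.* M))) (cong₂ _+_
              (trans (ι-* (c ℕ.* M) (suc n)) (cong (_* ι (suc n)) (ι-* c M)))
              (trans (ι-* (a n) (b ℕ.* M)) (cong₂ _*_ (sym (x*[1+n]≡a n)) (ι-* b M))))))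
            (arith (ι α) (ι c) (ι b) (ι M) (x n) (ι (suc n)) ε (0≤ι M) (0≤ι (suc n)) h
              (≤-trans (+-monoʳ-≤ 1ℚ {0ℚ} {1ℚ} (<⇒≤ 0<1)) 2≤Mε)))

          e₁ : ∀ n b M → n ℕ.* (b ℕ.* M) ≡ b ℕ.* M ℕ.* n
          e₁ = solve-∀

          powers : ∀ n → 1ℚ + δ ≤ t n → ι α + ε ≤ ι c + ι b * x n →
            ((t n ↑ α) ↑ M * t n) ↑ suc n ≤ ((t n ↑ c * v ↑ b) ↑ M) ↑ suc n
          powers n tn h = begin
            ((t n ↑ α) ↑ M * t n) ↑ suc n
              ≡⟨ cong (_↑ suc n) (trans (cong₂ _*_ (↑-assocʳ (t n) α M) (sym (*-identityʳ (t n))))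
                   (sym (↑-homo-* (t n) (α ℕ.* M) 1))) ⟩
            (t n ↑ (α ℕ.* M ℕ.+ 1)) ↑ suc n
              ≡⟨ ↑-assocʳ (t n) (α ℕ.* M ℕ.+ 1) (suc n) ⟩
            t n ↑ ((α ℕ.* M ℕ.+ 1) ℕ.* suc n)
              ≤⟨ ↑-monoʳ-≤ (<⇒≤ (1<t⇒ tn)) (exponents n h) ⟩
            t n ↑ (c ℕ.* M ℕ.* suc n ℕ.+ a n ℕ.* (b ℕ.* M))
              ≡⟨ trans (↑-homo-* (t n) (c ℕ.* M ℕ.* suc n) (a n ℕ.* (b ℕ.* M)))
                   (cong (t n ↑ (c ℕ.* M ℕ.* suc n) *_) (sym (↑-assocʳ (t n) (a n) (b ℕ.* M)))) ⟩
            t n ↑ (c ℕ.* M ℕ.* suc n) * (t n ↑ a n) ↑ (b ℕ.* M)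
              ≤⟨ *-monoˡ-≤ (0≤↑ (0≤t tn) (c ℕ.* M ℕ.* suc n)) (↑-monoˡ-≤ (0≤↑ (0≤t tn) (a n)) (lower n) (b ℕ.* M)) ⟩
            t n ↑ (c ℕ.* M ℕ.* suc n) * (v ↑ suc n) ↑ (b ℕ.* M)
              ≡⟨ cong (t n ↑ (c ℕ.* M ℕ.* suc n) *_) (trans (↑-assocʳ v (suc n) (b ℕ.* M)) (cong (v ↑_) (e₁ (suc n) b M))) ⟩
            t n ↑ (c ℕ.* M ℕ.* suc n) * v ↑ (b ℕ.* M ℕ.* suc n)
              ≡⟨ power (t n) c b M (suc n) ⟨
            ((t n ↑ c * v ↑ b) ↑ M) ↑ suc n ∎

        -- In contrast to `lower`, `upper` has a n + 1 as exponent, an excess of b M altogether,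
        -- which is below n + 1 once n ≥ b M. Hence M ε ≥ 2: one unit for this excess and one for
        -- the factor t.
        above : Eventually (λ n → ι c + ι b * x n + ε ≤ ι α) →
          Eventually (λ n → t n ↑ c * v ↑ b + η ≤ t n ↑ α)
        above h = ev-map₂ (λ n (1+δ≤t , large) h → root-gap {t n ↑ c * v ↑ b} {t n ↑ α} {t n} {δ} M′
            (1≤* (1≤↑ (<⇒≤ (1<t⇒ 1+δ≤t)) c) (1≤↑ 1≤v b)) (0≤↑ (0≤t 1+δ≤t) α) 1+δ≤t
            (↑-cancelˡ-≤ (0≤↑ (0≤↑ (0≤t 1+δ≤t) α) M) n (powers n 1+δ≤t large h)) 0<η step)
            (ev-× ev-1+δ≤t (ev-≥ (b ℕ.* M))) h
          where
          open ≤-Reasoning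
          open +-*-Solver
          0≤t : ∀ {n} → 1ℚ + δ ≤ t n → 0ℚ ≤ t n
          0≤t p = <⇒≤ (<-trans 0<1 (1<t⇒ p))

          1≤* : ∀ {x y} → 1ℚ ≤ x → 1ℚ ≤ y → 1ℚ ≤ x * y
          1≤* {x} {y} 1≤x 1≤y = *-mono-≤ {1ℚ} {x} {1ℚ} {y} (<⇒≤ 0<1) (≤-trans (<⇒≤ 0<1) 1≤x) 1≤x 1≤y

          arith : ∀ (α c b M x k ε : ℚ) → 0ℚ ≤ M → 0ℚ ≤ k → c + b * x + ε ≤ α → 1ℚ + 1ℚ ≤ M * ε → b * M ≤ k →
            c * M * k + (1ℚ + x * k) * (b * M) + k ≤ α * M * k
          arith α c b M x k ε 0≤M 0≤k p q r = by (+-mono-≤ (*-monoˡ-≤ (0≤* 0≤M 0≤k) p) (+-mono-≤ (*-monoˡ-≤ 0≤k q) r))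
            (solve 7 (λ α c b M x k ε →
              c :* M :* k :+ (con 1ℚ :+ x :* k) :* (b :* M) :+ k :+ (M :* k :* α :+ (k :* (M :* ε) :+ k))
              := α :* M :* k :+ (M :* k :* (c :+ b :* x :+ ε) :+ (k :* (con 1ℚ :+ con 1ℚ) :+ b :* M))) refl α c b M x k ε)

          exponents : ∀ n → b ℕ.* M ℕ.≤ n → ι c + ι b * x n + ε ≤ ι α →
            c ℕ.* M ℕ.* suc n ℕ.+ suc (a n) ℕ.* (b ℕ.* M) ℕ.+ suc n ℕ.≤ α ℕ.* M ℕ.* suc n
          exponents n large h = ι-cancel-≤ (subst₂ _≤_
            (sym (trans (ι-+ (c ℕ.* M ℕ.* suc n ℕ.+ suc (a n) ℕ.* (b ℕ.* M)) (suc n)) (cong (_+ ι (suc n))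
              (trans (ι-+ (c ℕ.* M ℕ.* suc n) (suc (a n) ℕ.* (b ℕ.* M))) (cong₂ _+_
                (trans (ι-* (c ℕ.* M) (suc n)) (cong (_* ι (suc n)) (ι-* c M)))
                (trans (ι-* (suc (a n)) (b ℕ.* M)) (cong₂ _*_
                  (trans (ι-suc (a n)) (cong (_+_ 1ℚ) (sym (x*[1+n]≡a n)))) (ι-* b M))))))))
            (sym (trans (ι-* (α ℕ.* M) (suc n)) (cong (_* ι (suc n)) (ι-* α M))))
            (arith (ι α) (ι c) (ι b) (ι M) (x n) (ι (suc n)) ε (0≤ι M) (0≤ι (suc n)) h 2≤Mε
              (subst (_≤ ι (suc n)) (ι-* b M) (ι-mono-≤ (ℕ.m≤n⇒m≤1+n large)))))

          e₁ : ∀ n b M → b ℕ.* M ℕ.* n ≡ n ℕ.* (b ℕ.* M)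
          e₁ = solve-∀

          powers : ∀ n → 1ℚ + δ ≤ t n → b ℕ.* M ℕ.≤ n → ι c + ι b * x n + ε ≤ ι α →
            ((t n ↑ c * v ↑ b) ↑ M * t n) ↑ suc n ≤ ((t n ↑ α) ↑ M) ↑ suc n
          powers n tn large h = begin
            ((t n ↑ c * v ↑ b) ↑ M * t n) ↑ suc n
              ≡⟨ ↑-distrib-* ((t n ↑ c * v ↑ b) ↑ M) (t n) (suc n) ⟩
            ((t n ↑ c * v ↑ b) ↑ M) ↑ suc n * t n ↑ suc n
              ≡⟨ cong (_* t n ↑ suc n) (power (t n) c b M (suc n)) ⟩
            t n ↑ (c ℕ.* M ℕ.* suc n) * v ↑ (b ℕ.* M ℕ.* suc n) * t n ↑ suc n
              ≡⟨ cong (λ y → t n ↑ (c ℕ.* M ℕ.* suc n) * y * t n ↑ suc n)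
                   (trans (cong (v ↑_) (e₁ (suc n) b M)) (sym (↑-assocʳ v (suc n) (b ℕ.* M)))) ⟩
            t n ↑ (c ℕ.* M ℕ.* suc n) * (v ↑ suc n) ↑ (b ℕ.* M) * t n ↑ suc n
              ≤⟨ *-monoʳ-≤ (0≤↑ (0≤t tn) (suc n)) (*-monoˡ-≤ (0≤↑ (0≤t tn) (c ℕ.* M ℕ.* suc n))
                   (↑-monoˡ-≤ (0≤↑ 0≤v (suc n)) (<⇒≤ (upper n tn)) (b ℕ.* M))) ⟩
            t n ↑ (c ℕ.* M ℕ.* suc n) * (t n ↑ suc (a n)) ↑ (b ℕ.* M) * t n ↑ suc n
              ≡⟨ cong (λ y → t n ↑ (c ℕ.* M ℕ.* suc n) * y * t n ↑ suc n) (↑-assocʳ (t n) (suc (a n)) (b ℕ.* M)) ⟩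
            t n ↑ (c ℕ.* M ℕ.* suc n) * t n ↑ (suc (a n) ℕ.* (b ℕ.* M)) * t n ↑ suc n
              ≡⟨ trans (cong (_* t n ↑ suc n) (sym (↑-homo-* (t n) (c ℕ.* M ℕ.* suc n) (suc (a n) ℕ.* (b ℕ.* M)))))
                   (sym (↑-homo-* (t n) (c ℕ.* M ℕ.* suc n ℕ.+ suc (a n) ℕ.* (b ℕ.* M)) (suc n))) ⟩
            t n ↑ (c ℕ.* M ℕ.* suc n ℕ.+ suc (a n) ℕ.* (b ℕ.* M) ℕ.+ suc n)
              ≤⟨ ↑-monoʳ-≤ (<⇒≤ (1<t⇒ tn)) (exponents n large h) ⟩
            t n ↑ (α ℕ.* M ℕ.* suc n)
              ≡⟨ trans (cong (_↑ suc n) (↑-assocʳ (t n) α M)) (↑-assocʳ (t n) (α ℕ.* M) (suc n)) ⟨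
            ((t n ↑ α) ↑ M) ↑ suc n ∎

    private
      seq-fromℕ : ∀ b n → seq (fromℕ V D.^ b) n ≡ v ↑ b
      seq-fromℕ b n = trans (seq-^ (fromℕ V) b n) (cong (_↑ b) (sym (ι-def V)))

      real-below : ∀ α c b ε n → seq (fromℕ α) n + ε ≤ seq (fromℕ c D.+ b D.· log) n → ι α + ε ≤ ι c + ι b * x n
      real-below α c b ε n = subst₂ _≤_ (cong (_+ ε) (sym (ι-def α)))
        (sym (cong₂ (λ c b → c + b * x n) (ι-def c) (ι-def b)))

      real-above : ∀ α c b ε n → seq (fromℕ c D.+ b D.· log) n + ε ≤ seq (fromℕ α) n → ι c + ι b * x n + ε ≤ ι α
      real-above α c b ε n = subst₂ _≤_
        (sym (cong₂ (λ c b → c + b * x n + ε) (ι-def c) (ι-def b))) (sym (ι-def α))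

    log-isLog : IsLog τ (fromℕ V) log
    log-isLog α b c =
        (λ (ε , 0<ε , h) → proj₁ (step ε 0<ε) , proj₁ (proj₂ (step ε 0<ε)) ,
          ev-map (λ n → subst₂ _≤_ (cong (_+ proj₁ (step ε 0<ε)) (sym (seq-^ τ α n)))
            (sym (cong₂ _*_ (seq-^ τ c n) (seq-fromℕ b n))))
            (below α b c ε 0<ε (ev-map (real-below α c b ε) h)))
      , (λ (ε , 0<ε , h) → proj₁ (step ε 0<ε) , proj₁ (proj₂ (step ε 0<ε)) ,
          ev-map (λ n → subst₂ _≤_
            (cong (_+ proj₁ (step ε 0<ε)) (sym (cong₂ _*_ (seq-^ τ c n) (seq-fromℕ b n))))
            (sym (seq-^ τ α n)))
            (above α b c ε 0<ε (ev-map (real-above α c b ε) h)))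
      where
      step : ∀ ε (0<ε : 0ℚ < ε) → ∃ λ η → 0ℚ < η × (1ℚ + η) ↑ suc (proj₁ (large-denominator 0<ε 2)) ≤ 1ℚ + δ
      step ε 0<ε = small-step 0<δ (suc (proj₁ (large-denominator 0<ε 2)))

-- A uniform format for the inequalities of Q, and an interior point

module Constraints where

  open Rationals
  open Logarithm
  open HomCount
  open HomInequalities
  open Exponents using (QNat)
  open import Data.Nat.Base as ℕ using (ℕ; zero; suc; 2+; z≤n; s≤s)
  import Data.Nat.Properties as ℕ
  open import Data.Nat.Tactic.RingSolver using (solve-∀)
  open import Data.Integer.Base using (+_)
  open import Data.Rational
  open import Data.Rational.Properties
  open import Data.Rational.Solver using (module +-*-Solver)
  open import Data.Product.Base using (_×_; _,_; proj₁; proj₂)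
  open import Function.Base using (_∘_)
  open import Relation.Binary.PropositionalEquality
  open import Defs as D using (ℝ; ℝ^; seq; 0ℝ; _!_; Q; Graph)

  -- Constraint K A i B j C k says that A y_i ≤ B y_j + C y_k is one of the
  -- inequalities that define Q for m = K + 2.
  data Constraint (K : ℕ) : (A i B j C k : ℕ) → Set where
    c₁ : Constraint K 1 1 1 2 0 0
    c₂ : Constraint K 3 2 4 1 0 0
    c₃ : Constraint K 3 3 3 1 1 4
    c₄ : Constraint K 2 (2+ K) 1 1 2 (suc K)
    c₅ : Constraint K 1 (2+ K) 1 0 1 (suc K)
    c₆ : Constraint K 2 1 1 0 1 3
    c₇ : ∀ i → i ℕ.< K → Constraint K 2 (2+ i) 1 (suc i) 1 (suc (2+ i))
    c₈ : Constraint K (suc K) (2+ K) (2+ K) (suc K) 0 0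

  -- `c₈` attains the bound; K ≥ 2 makes it cover the sum 7 of `c₂` and `c₃`. The effect of rounding
  -- on a constraint is proportional to this sum.
  coefficients≤ : ∀ {K A i B j C k} → 2 ℕ.≤ K → Constraint K A i B j C k →
    A ℕ.+ B ℕ.+ C ℕ.≤ 2 ℕ.* K ℕ.+ 3
  coefficients≤ {K} 2≤K c = go c
    where
    7≤ : 7 ℕ.≤ 2 ℕ.* K ℕ.+ 3
    7≤ = ℕ.+-monoˡ-≤ 3 (ℕ.*-monoʳ-≤ 2 2≤K)

    small : ∀ n → n ℕ.≤ 7 → n ℕ.≤ 2 ℕ.* K ℕ.+ 3
    small n n≤7 = ℕ.≤-trans n≤7 7≤

    go : ∀ {A i B j C k} → Constraint K A i B j C k → A ℕ.+ B ℕ.+ C ℕ.≤ 2 ℕ.* K ℕ.+ 3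
    go c₁       = small 2 (ℕ.m≤m+n 2 5)
    go c₂       = 7≤
    go c₃       = 7≤
    go c₄       = small 5 (ℕ.m≤m+n 5 2)
    go c₅       = small 3 (ℕ.m≤m+n 3 4)
    go c₆       = small 4 (ℕ.m≤m+n 4 3)
    go (c₇ _ _) = small 4 (ℕ.m≤m+n 4 3)
    go c₈       = ℕ.≤-reflexive (eq K)
      where
      eq : ∀ K → suc K ℕ.+ (2 ℕ.+ K) ℕ.+ 0 ≡ 2 ℕ.* K ℕ.+ 3
      eq = solve-∀

  indices≤ : ∀ {K A i B j C k} → 2 ℕ.≤ K → Constraint K A i B j C k →
    i ℕ.≤ 2+ K × j ℕ.≤ 2+ K × k ℕ.≤ 2+ K
  indices≤ {K} 2≤K c = go c
    where
    4≤ : 4 ℕ.≤ 2+ K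
    4≤ = s≤s (s≤s 2≤K)

    small : ∀ n → n ℕ.≤ 4 → n ℕ.≤ 2+ K
    small n n≤4 = ℕ.≤-trans n≤4 4≤

    go : ∀ {A i B j C k} → Constraint K A i B j C k → i ℕ.≤ 2+ K × j ℕ.≤ 2+ K × k ℕ.≤ 2+ K
    go c₁ = small 1 (ℕ.m≤m+n 1 3) , small 2 (ℕ.m≤m+n 2 2) , z≤n
    go c₂ = small 2 (ℕ.m≤m+n 2 2) , small 1 (ℕ.m≤m+n 1 3) , z≤n
    go c₃ = small 3 (ℕ.m≤m+n 3 1) , small 1 (ℕ.m≤m+n 1 3) , 4≤
    go c₄ = ℕ.≤-refl , small 1 (ℕ.m≤m+n 1 3) , ℕ.n≤1+n (suc K)
    go c₅ = ℕ.≤-refl , z≤n , ℕ.n≤1+n (suc K)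
    go c₆ = small 1 (ℕ.m≤m+n 1 3) , z≤n , small 3 (ℕ.m≤m+n 3 1)
    go (c₇ i i<K) = s≤s (s≤s (ℕ.<⇒≤ i<K)) , s≤s (ℕ.m≤n⇒m≤1+n (ℕ.<⇒≤ i<K)) , s≤s (s≤s i<K)
    go c₈ = ℕ.≤-refl , ℕ.n≤1+n (suc K) , z≤n

  form : (ℕ → ℚ) → (A i B j C k : ℕ) → ℚ
  form s A i B j C k = ι B * s j + ι C * s k - ι A * s i

  -- Nonnegativity of a real, unfolded to its sequence. Two-term inequalities fit in with
  -- coefficient 0 at index 0.
  Holds : ∀ {n} → ℝ^ n → (A i B j C k : ℕ) → Set
  Holds y A i B j C k = ∀ ε → 0ℚ < ε → Eventually λ n →
    0ℚ ≤ form (λ i → seq (y ! i) n) A i B j C k + ε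

  module _ {K : ℕ} (2≤K : 2 ℕ.≤ K) {y : ℝ^ (suc (2+ K))} where
    private
      form≡ : ∀ s A i B j C k → form s A i B j C k ≡ + B / 1 * s j + + C / 1 * s k - + A / 1 * s i
      form≡ s A i B j C k = trans (cong (λ a → ι B * s j + ι C * s k - a * s i) (ι-def A))
        (cong₂ (λ b c → b * s j + c * s k - + A / 1 * s i) (ι-def B) (ι-def C))

      transfer : ∀ {A i B j C k} (e : ℝ) →
        (∀ n → seq e n ≡ + B / 1 * seq (y ! j) n + + C / 1 * seq (y ! k) n - + A / 1 * seq (y ! i) n) →
        (0ℝ D.≤ e → Holds y A i B j C k) × (Holds y A i B j C k → 0ℝ D.≤ e)
      transfer {A} {i} {B} {j} {C} {k} e e≡ =
          (λ h ε 0<ε → ev-map (λ n → subst (λ x → 0ℚ ≤ x + ε) (seq≡form n)) (h ε 0<ε))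
        , (λ h ε 0<ε → ev-map (λ n → subst (λ x → 0ℚ ≤ x + ε) (sym (seq≡form n))) (h ε 0<ε))
        where
        seq≡form : ∀ n → seq e n ≡ form (λ i → seq (y ! i) n) A i B j C k
        seq≡form n = trans (e≡ n) (sym (form≡ (λ i → seq (y ! i) n) A i B j C k))

      open +-*-Solver
      κ : ∀ {n} → ℕ → Polynomial n
      κ n = con (+ n / 1)

      t₁ = transfer {1} {1} {1} {2} {0} {0} (D.- y ! 1 D.+ y ! 2) λ n →
        solve 3 (λ a b c → :- a :+ b := κ 1 :* b :+ κ 0 :* c :- κ 1 :* a) refl
          (seq (y ! 1) n) (seq (y ! 2) n) (seq (y ! 0) n)

      t₂ = transfer {3} {2} {4} {1} {0} {0} (4 D.· y ! 1 D.- 3 D.· y ! 2) λ n →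
        solve 3 (λ a b c → κ 4 :* a :- κ 3 :* b := κ 4 :* a :+ κ 0 :* c :- κ 3 :* b) refl
          (seq (y ! 1) n) (seq (y ! 2) n) (seq (y ! 0) n)

      t₃ = transfer {3} {3} {3} {1} {1} {4} (3 D.· y ! 1 D.- 3 D.· y ! 3 D.+ y ! 4) λ n →
        solve 3 (λ a b c → κ 3 :* a :- κ 3 :* b :+ c := κ 3 :* a :+ κ 1 :* c :- κ 3 :* b) refl
          (seq (y ! 1) n) (seq (y ! 3) n) (seq (y ! 4) n)

      t₄ = transfer {2} {2+ K} {1} {1} {2} {suc K} (y ! 1 D.+ 2 D.· y ! suc K D.- 2 D.· y ! (2+ K)) λ n →
        solve 3 (λ a b c → a :+ κ 2 :* b :- κ 2 :* c := κ 1 :* a :+ κ 2 :* b :- κ 2 :* c) refl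
          (seq (y ! 1) n) (seq (y ! suc K) n) (seq (y ! (2+ K)) n)

      t₅ = transfer {1} {2+ K} {1} {0} {1} {suc K} (y ! 0 D.+ y ! suc K D.- y ! (2+ K)) λ n →
        solve 3 (λ a b c → a :+ b :- c := κ 1 :* a :+ κ 1 :* b :- κ 1 :* c) refl
          (seq (y ! 0) n) (seq (y ! suc K) n) (seq (y ! (2+ K)) n)

      t₆ = transfer {2} {1} {1} {0} {1} {3} (y ! 0 D.- 2 D.· y ! 1 D.+ y ! 3) λ n →
        solve 3 (λ a b c → a :- κ 2 :* b :+ c := κ 1 :* a :+ κ 1 :* c :- κ 2 :* b) refl
          (seq (y ! 0) n) (seq (y ! 1) n) (seq (y ! 3) n)

      t₇ = λ i → transfer {2} {2+ i} {1} {suc i} {1} {suc (2+ i)}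
        (y ! suc i D.- 2 D.· y ! (2+ i) D.+ y ! suc (2+ i)) λ n →
        solve 3 (λ a b c → a :- κ 2 :* b :+ c := κ 1 :* a :+ κ 1 :* c :- κ 2 :* b) refl
          (seq (y ! suc i) n) (seq (y ! (2+ i)) n) (seq (y ! suc (2+ i)) n)

      t₈ = transfer {suc K} {2+ K} {2+ K} {suc K} {0} {0} ((2+ K) D.· y ! suc K D.- suc K D.· y ! (2+ K)) λ n →
        solve 5 (λ M a N b c → M :* a :- N :* b := M :* a :+ κ 0 :* c :- N :* b) refl
          (+ (2+ K) / 1) (seq (y ! suc K) n) (+ suc K / 1) (seq (y ! (2+ K)) n) (seq (y ! 0) n)

    Q⇒Holds : Q (2+ K) y → ∀ {A i B j C k} → Constraint K A i B j C k → Holds y A i B j C k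
    Q⇒Holds q c₁ = proj₁ t₁ (Q.ineq₁ q)
    Q⇒Holds q c₂ = proj₁ t₂ (Q.ineq₂ q)
    Q⇒Holds q c₃ = proj₁ t₃ (Q.ineq₃ q)
    Q⇒Holds q c₄ = proj₁ t₄ (Q.ineq₄ q)
    Q⇒Holds q c₅ = proj₁ t₅ (Q.ineq₅ q)
    Q⇒Holds q c₆ = proj₁ t₆ (Q.ineq₆ q)
    Q⇒Holds q (c₇ i i<K) = proj₁ (t₇ i) (Q.ineq₇ q (2+ i) (s≤s (s≤s z≤n)) (s≤s i<K))
    Q⇒Holds q c₈ = proj₁ t₈ (Q.ineq₈ q)

    Holds⇒Q : (∀ {A i B j C k} → Constraint K A i B j C k → Holds y A i B j C k) → Q (2+ K) y
    Holds⇒Q h = record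
      { ineq₁ = proj₂ t₁ (h c₁)
      ; ineq₂ = proj₂ t₂ (h c₂)
      ; ineq₃ = proj₂ t₃ (h c₃)
      ; ineq₄ = proj₂ t₄ (h c₄)
      ; ineq₅ = proj₂ t₅ (h c₅)
      ; ineq₆ = proj₂ t₆ (h c₆)
      ; ineq₇ = λ { zero () _ ; (suc zero) (s≤s ()) _ ; (suc (suc i)) _ i< → proj₂ (t₇ i) (h (c₇ i (ℕ.≤-pred i<))) }
      ; ineq₈ = proj₂ t₈ (h c₈)
      }

  homs : Graph → ℕ → ℕ
  homs G zero    = Graph.order G
  homs G (suc k) = M G k

  -- The 64 is that of `M1³≤`; the other inequalities are weakened to it so that a single passage to
  -- logarithms serves all of them.
  homs-Constraint : ∀ G {K A i B j C k} → Constraint K A i B j C k →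
    homs G i ℕ.^ A ℕ.≤ 64 ℕ.* (homs G j ℕ.^ B ℕ.* homs G k ℕ.^ C)
  homs-Constraint G {K} = go
    where
    x^1 : ∀ x → x ℕ.^ 1 ≡ x
    x^1 = ℕ.*-identityʳ

    weaken : ∀ {x y} → x ℕ.≤ y → x ℕ.≤ 64 ℕ.* y
    weaken {x} {y} x≤y = ℕ.≤-trans x≤y (ℕ.m≤n*m y 64)

    go : ∀ {A i B j C k} → Constraint K A i B j C k →
      homs G i ℕ.^ A ℕ.≤ 64 ℕ.* (homs G j ℕ.^ B ℕ.* homs G k ℕ.^ C)
    go c₁ = weaken (subst₂ ℕ._≤_ (sym (x^1 (M G 0))) (sym (trans (ℕ.*-identityʳ _) (x^1 (M G 1)))) (M0≤M1 G))
    go c₂ = subst (λ x → M G 1 ℕ.^ 3 ℕ.≤ 64 ℕ.* x) (sym (ℕ.*-identityʳ (M G 0 ℕ.^ 4))) (M1³≤ G)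
    go c₃ = weaken (subst (λ x → M G 2 ℕ.^ 3 ℕ.≤ M G 0 ℕ.^ 3 ℕ.* x) (sym (x^1 (M G 3))) (M2³≤ G))
    go c₄ = weaken (subst (λ x → M G (suc K) ℕ.^ 2 ℕ.≤ x ℕ.* M G K ℕ.^ 2) (sym (x^1 (M G 0))) (M-suc²≤ G K))
    go c₅ = weaken (subst₂ ℕ._≤_ (sym (x^1 (M G (suc K)))) (sym (cong₂ ℕ._*_ (x^1 (Graph.order G)) (x^1 (M G K)))) (M-suc≤order G K))
    go c₆ = weaken (subst (M G 0 ℕ.^ 2 ℕ.≤_) (sym (cong₂ ℕ._*_ (x^1 (Graph.order G)) (x^1 (M G 2)))) (M0²≤ G))
    go (c₇ i _) = weaken (subst (M G (suc i) ℕ.^ 2 ℕ.≤_) (sym (cong₂ ℕ._*_ (x^1 (M G i)) (x^1 (M G (2+ i))))) (M-log-convex G i))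
    go c₈ = weaken (subst (M G (suc K) ℕ.^ suc K ℕ.≤_) (sym (ℕ.*-identityʳ (M G K ℕ.^ 2+ K))) (M-suc^≤ G K))

  Constraints⇒QNat : ∀ {K} → 2 ℕ.≤ K → (p : ℕ → ℕ) →
    (∀ {A i B j C k} → Constraint K A i B j C k → A ℕ.* p i ℕ.≤ B ℕ.* p j ℕ.+ C ℕ.* p k) →
    QNat K (p 0) (p ∘ suc)
  Constraints⇒QNat {K} 2≤K p h = record
    { K≥2   = 2≤K
    ; ineq₁ = subst₂ ℕ._≤_ (1* (p 1)) (trans (ℕ.+-identityʳ (1 ℕ.* p 2)) (1* (p 2))) (h c₁)
    ; ineq₂ = subst (3 ℕ.* p 2 ℕ.≤_) (ℕ.+-identityʳ _) (h c₂)
    ; ineq₃ = subst (λ x → 3 ℕ.* p 3 ℕ.≤ 3 ℕ.* p 1 ℕ.+ x) (1* (p 4)) (h c₃)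
    ; ineq₄ = subst (λ x → 2 ℕ.* p (2+ K) ℕ.≤ x ℕ.+ 2 ℕ.* p (suc K)) (1* (p 1)) (h c₄)
    ; ineq₅ = subst₂ ℕ._≤_ (1* (p (2+ K))) (cong₂ ℕ._+_ (1* (p 0)) (1* (p (suc K)))) (h c₅)
    ; ineq₆ = subst (2 ℕ.* p 1 ℕ.≤_) (cong₂ ℕ._+_ (1* (p 0)) (1* (p 3))) (h c₆)
    ; ineq₇ = λ i i<K → subst (2 ℕ.* p (2+ i) ℕ.≤_) (cong₂ ℕ._+_ (1* (p (suc i))) (1* (p (suc (2+ i))))) (h (c₇ i i<K))
    ; ineq₈ = subst (suc K ℕ.* p (2+ K) ℕ.≤_) (ℕ.+-identityʳ _) (h c₈)
    }
    where
    1* : ∀ n → 1 ℕ.* n ≡ n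
    1* = ℕ.*-identityˡ

  -- At a constant vector b the constraints `c₁`, `c₆` and `c₇` are equalities and the others have
  -- slack b. The strictly convex summand i² makes the former strict, and b = 2 (K + 2)² is large
  -- enough to absorb the squares in the latter.
  interior : ℕ → ℕ → ℕ
  interior K zero    = 2 ℕ.* ((2+ K) ℕ.* (2+ K))
  interior K (suc i) = 2 ℕ.* ((2+ K) ℕ.* (2+ K)) ℕ.+ i ℕ.* i

  interior-Constraint : ∀ {K A i B j C k} → Constraint K A i B j C k →
    suc (A ℕ.* interior K i) ℕ.≤ B ℕ.* interior K j ℕ.+ C ℕ.* interior K k
  interior-Constraint {K} = go
    where
    bound : ∀ {x y} d → x ℕ.+ d ≡ y → x ℕ.≤ y
    bound {x} d e = ℕ.≤-trans (ℕ.m≤m+n x d) (ℕ.≤-reflexive e)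

    e₁ : ∀ K → let b = 2 ℕ.* ((2 ℕ.+ K) ℕ.* (2 ℕ.+ K)) in suc (1 ℕ.* (b ℕ.+ 0)) ℕ.+ 0 ≡ 1 ℕ.* (b ℕ.+ 1 ℕ.* 1) ℕ.+ 0
    e₁ = solve-∀
    e₂ : ∀ K → let b = 2 ℕ.* ((2 ℕ.+ K) ℕ.* (2 ℕ.+ K)) in
      suc (3 ℕ.* (b ℕ.+ 1 ℕ.* 1)) ℕ.+ (4 ℕ.+ (8 ℕ.* K ℕ.+ 2 ℕ.* (K ℕ.* K))) ≡ 4 ℕ.* (b ℕ.+ 0) ℕ.+ 0
    e₂ = solve-∀
    e₃ : ∀ K → let b = 2 ℕ.* ((2 ℕ.+ K) ℕ.* (2 ℕ.+ K)) in
      suc (3 ℕ.* (b ℕ.+ 2 ℕ.* 2)) ℕ.+ (4 ℕ.+ (8 ℕ.* K ℕ.+ 2 ℕ.* (K ℕ.* K))) ≡ 3 ℕ.* (b ℕ.+ 0) ℕ.+ 1 ℕ.* (b ℕ.+ 3 ℕ.* 3)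
    e₃ = solve-∀
    e₄ : ∀ K → let b = 2 ℕ.* ((2 ℕ.+ K) ℕ.* (2 ℕ.+ K)) in
      suc (2 ℕ.* (b ℕ.+ (1 ℕ.+ K) ℕ.* (1 ℕ.+ K))) ℕ.+ (5 ℕ.+ (4 ℕ.* K ℕ.+ 2 ℕ.* (K ℕ.* K))) ≡ 1 ℕ.* (b ℕ.+ 0) ℕ.+ 2 ℕ.* (b ℕ.+ K ℕ.* K)
    e₄ = solve-∀
    e₅ : ∀ K → let b = 2 ℕ.* ((2 ℕ.+ K) ℕ.* (2 ℕ.+ K)) in
      suc (1 ℕ.* (b ℕ.+ (1 ℕ.+ K) ℕ.* (1 ℕ.+ K))) ℕ.+ (6 ℕ.+ (6 ℕ.* K ℕ.+ 2 ℕ.* (K ℕ.* K))) ≡ 1 ℕ.* b ℕ.+ 1 ℕ.* (b ℕ.+ K ℕ.* K)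
    e₅ = solve-∀
    e₆ : ∀ K → let b = 2 ℕ.* ((2 ℕ.+ K) ℕ.* (2 ℕ.+ K)) in
      suc (2 ℕ.* (b ℕ.+ 0)) ℕ.+ 3 ≡ 1 ℕ.* b ℕ.+ 1 ℕ.* (b ℕ.+ 2 ℕ.* 2)
    e₆ = solve-∀
    e₇ : ∀ b i → suc (2 ℕ.* (b ℕ.+ (1 ℕ.+ i) ℕ.* (1 ℕ.+ i))) ℕ.+ 1 ≡ 1 ℕ.* (b ℕ.+ i ℕ.* i) ℕ.+ 1 ℕ.* (b ℕ.+ (2 ℕ.+ i) ℕ.* (2 ℕ.+ i))
    e₇ = solve-∀
    e₈ : ∀ K → let b = 2 ℕ.* ((2 ℕ.+ K) ℕ.* (2 ℕ.+ K)) in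
      suc ((1 ℕ.+ K) ℕ.* (b ℕ.+ (1 ℕ.+ K) ℕ.* (1 ℕ.+ K))) ℕ.+ (6 ℕ.+ (5 ℕ.* K ℕ.+ K ℕ.* K)) ≡ (2 ℕ.+ K) ℕ.* (b ℕ.+ K ℕ.* K) ℕ.+ 0
    e₈ = solve-∀

    go : ∀ {A i B j C k} → Constraint K A i B j C k →
      suc (A ℕ.* interior K i) ℕ.≤ B ℕ.* interior K j ℕ.+ C ℕ.* interior K k
    go c₁       = bound _ (e₁ K)
    go c₂       = bound _ (e₂ K)
    go c₃       = bound _ (e₃ K)
    go c₄       = bound _ (e₄ K)
    go c₅       = bound _ (e₅ K)
    go c₆       = bound _ (e₆ K)
    go (c₇ i _) = bound _ (e₇ (2 ℕ.* ((2+ K) ℕ.* (2+ K))) i)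
    go c₈       = bound _ (e₈ K)

-- Limit points satisfy the inequalities

module Necessity where

  open Rationals
  open Logarithm
  open HomCount
  open Constraints
  open import Data.Nat.Base as ℕ using (ℕ; zero; suc; 2+; z≤n; s≤s)
  import Data.Nat.Properties as ℕ
  open import Data.Integer.Base using (+_)
  open import Data.Fin.Base using (Fin; zero; suc; toℕ; fromℕ<)
  open import Data.Fin.Properties using (toℕ-fromℕ<)
  open import Data.Rational
  open import Data.Rational.Properties
  open import Data.Rational.Solver using (module +-*-Solver)
  open import Data.Product.Base using (∃; _×_; _,_; proj₁; proj₂)
  open import Relation.Binary.PropositionalEquality
  open import Relation.Nullary using (yes; no; contradiction)
  open import Defs as D using (ℝ; ℝ^; seq; cauchy; 0ℝ; 1ℝ; _!_; Q; Graph; fromℕ; fromℚ; IsLog; 𝒩; 𝒰; log[_]; LimSup)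

  inv : ℕ → ℚ
  inv q = proj₁ (inverse (0<ι q))

  0<inv : ∀ q → 0ℚ < inv q
  0<inv q = proj₁ (proj₂ (inverse (0<ι q)))

  q*inv≡1 : ∀ q → ι (suc q) * inv q ≡ 1ℚ
  q*inv≡1 q = proj₂ (proj₂ (inverse (0<ι q)))

  scaled-close : ∀ q {a b} → ∣ a - b ∣ < inv q → ι (suc q) * a ≤ ι (suc q) * b + 1ℚ × ι (suc q) * b ≤ ι (suc q) * a + 1ℚ
  scaled-close q {a} {b} close = half a b close , half b a (subst (_< inv q) (∣-∣-comm a b) close)
    where
    open +-*-Solver
    ∣-∣-comm : ∀ a b → ∣ a - b ∣ ≡ ∣ b - a ∣
    ∣-∣-comm a b = trans (cong ∣_∣ (solve 2 (λ a b → a :- b := :- (b :- a)) refl a b)) (∣-p∣≡∣p∣ (b - a))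

    half : ∀ a b → ∣ a - b ∣ < inv q → ι (suc q) * a ≤ ι (suc q) * b + 1ℚ
    half a b close = subst (λ o → ι (suc q) * a ≤ ι (suc q) * b + o) (q*inv≡1 q)
      (by (*-monoˡ-≤ (0≤ι (suc q)) (≤-trans (x≤∣x∣ (a - b)) (<⇒≤ close)))
        (solve 4 (λ q a b i → q :* a :+ q :* i := (q :* b :+ q :* i) :+ q :* (a :- b)) refl (ι (suc q)) a b (inv q)))

  NearInteger : ℕ → ℕ → ℕ → ℚ → Set
  NearInteger q u w x = ι u ≤ ι (suc q) * x + ι w + (1ℚ + 1ℚ) × ι (suc q) * x + ι w ≤ ι u + (1ℚ + 1ℚ)

  -- The floor of a real cannot be computed, so one late term is rounded instead: an error of 1 from
  -- its floor and 1 from the Cauchy condition make up the 2 in `NearInteger`.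
  real-floor : ∀ (y : ℝ) q → ∃ λ u → ∃ λ w → Eventually λ n → NearInteger q u w (seq y n)
  real-floor y q = u , w , n₀ , λ n n₀≤n →
    let up , down = scaled-close q (proj₂ (cauchy y (inv q) (0<inv q)) n n₀ n₀≤n ℕ.≤-refl)
    in by (+-mono-≤ (+-mono-≤ lo down) (<⇒≤ 0<1)) (solve 4 (λ u x x₀ w →
         u :+ ((x₀ :+ w) :+ (x :+ con 1ℚ) :+ con 1ℚ) := (x :+ w :+ (con 1ℚ :+ con 1ℚ)) :+ (u :+ x₀ :+ con 0ℚ))
         refl (ι u) (ι (suc q) * seq y n) (ι (suc q) * seq y n₀) (ι w))
     , by (+-mono-≤ hi up) (solve 4 (λ u x x₀ w →
         (x :+ w) :+ ((u :+ con 1ℚ) :+ (x₀ :+ con 1ℚ)) := (u :+ (con 1ℚ :+ con 1ℚ)) :+ ((x₀ :+ w) :+ x))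
         refl (ι u) (ι (suc q) * seq y n) (ι (suc q) * seq y n₀) (ι w))
    where
    open +-*-Solver
    n₀ = proj₁ (cauchy y (inv q) (0<inv q))
    fp = floor-pair (ι (suc q) * seq y n₀)
    u = proj₁ fp
    w = proj₁ (proj₂ fp)
    lo = proj₁ (proj₂ (proj₂ fp))
    hi = proj₂ (proj₂ (proj₂ fp))

  -- N^q lies between t^(u - w - 5) and t^(u - w + 5), multiplied out. The 5 consists of 2 for
  -- rounding y, 1 for the distance of x to y, 1 for strictness in `IsLog`, and 1 for replacing v by
  -- N.
  Sandwich : ℚ → (q u w N : ℕ) → Set
  Sandwich t q u w N = t ↑ u ≤ t ↑ (5 ℕ.+ w) * ι N ↑ q × t ↑ w * ι N ↑ q ≤ t ↑ (5 ℕ.+ u)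

  -- The terms of v are only close to N. Since N ≥ 1, a distance of at most ½ is a factor of at most
  -- 2, and its q-th power is absorbed by one factor t.
  half-apart : ∀ V N h → 0ℚ ≤ h → h + h ≡ 1ℚ → V ≤ N + h → N ≤ V + h → 1ℚ ≤ N →
    0ℚ ≤ V × V ≤ ι 2 * N × N ≤ ι 2 * V
  half-apart V N h 0≤h 2h≡1 p r 1≤N =
      by (+-mono-≤ (+-mono-≤ r 2h≤N) 0≤h) (solve 3 (λ V N h →
        con 0ℚ :+ ((V :+ h) :+ N :+ h) := V :+ (N :+ (h :+ h) :+ con 0ℚ)) refl V N h)
    , subst (λ z → V ≤ z * N) (sym ι2)
        (by (+-mono-≤ (+-mono-≤ p 2h≤N) 0≤h) (solve 3 (λ V N h →
           V :+ ((N :+ h) :+ N :+ h) := (con 1ℚ :+ con 1ℚ) :* N :+ (V :+ (h :+ h) :+ con 0ℚ)) refl V N h))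
    , subst (λ z → N ≤ z * V) (sym ι2)
        (by (+-mono-≤ (+-mono-≤ r r) 2h≤N) (solve 3 (λ V N h →
           N :+ ((V :+ h) :+ (V :+ h) :+ N) := (con 1ℚ :+ con 1ℚ) :* V :+ (N :+ N :+ (h :+ h))) refl V N h))
    where
    open +-*-Solver
    2h≤N : h + h ≤ N
    2h≤N = subst (_≤ N) (sym 2h≡1) 1≤N

    ι2 : ι 2 ≡ 1ℚ + 1ℚ
    ι2 = trans (ι-suc 1) (cong (_+_ 1ℚ) ι-1)

  0≤½ : 0ℚ ≤ ½
  0≤½ = <⇒≤ (positive⁻¹ ½)

  private
    scale : ∀ t a b q → ι (2 ℕ.^ q) ≤ t → 0ℚ ≤ a → 0ℚ ≤ b → a ≤ ι 2 * b → a ↑ q ≤ t * b ↑ q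
    scale t a b q 2^q≤t 0≤a 0≤b a≤2b = begin
      a ↑ q                   ≤⟨ ↑-monoˡ-≤ 0≤a a≤2b q ⟩
      (ι 2 * b) ↑ q           ≡⟨ ↑-distrib-* (ι 2) b q ⟩
      ι 2 ↑ q * b ↑ q         ≡⟨ cong (_* b ↑ q) (ι-^ 2 q) ⟨
      ι (2 ℕ.^ q) * b ↑ q     ≤⟨ *-monoʳ-≤ (0≤↑ 0≤b q) 2^q≤t ⟩
      t * b ↑ q               ∎
      where open ≤-Reasoning

    module _ (t V N : ℚ) (q u w : ℕ) (2^q≤t : ι (2 ℕ.^ q) ≤ t) (0≤V : 0ℚ ≤ V) (0≤N : 0ℚ ≤ N) where
      open ≤-Reasoning
      open +-*-Solver

      0≤base : 0ℚ ≤ t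
      0≤base = ≤-trans (0≤ι (2 ℕ.^ q)) 2^q≤t

      lower-sandwich : V ≤ ι 2 * N → t ↑ u ≤ t ↑ (4 ℕ.+ w) * V ↑ q → t ↑ u ≤ t ↑ (5 ℕ.+ w) * N ↑ q
      lower-sandwich V≤2N lo = begin
        t ↑ u                           ≤⟨ lo ⟩
        t ↑ (4 ℕ.+ w) * V ↑ q           ≤⟨ *-monoˡ-≤ (0≤↑ 0≤base (4 ℕ.+ w)) (scale t V N q 2^q≤t 0≤V 0≤N V≤2N) ⟩
        t ↑ (4 ℕ.+ w) * (t * N ↑ q)     ≡⟨ swap (t ↑ (4 ℕ.+ w)) t (N ↑ q) ⟩
        t * t ↑ (4 ℕ.+ w) * N ↑ q       ∎
        where
        swap : ∀ a t b → a * (t * b) ≡ t * a * b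
        swap = solve 3 (λ a t b → a :* (t :* b) := t :* a :* b) refl

      upper-sandwich : N ≤ ι 2 * V → t ↑ w * V ↑ q ≤ t ↑ (4 ℕ.+ u) → t ↑ w * N ↑ q ≤ t ↑ (5 ℕ.+ u)
      upper-sandwich N≤2V hi = begin
        t ↑ w * N ↑ q           ≤⟨ *-monoˡ-≤ (0≤↑ 0≤base w) (scale t N V q 2^q≤t 0≤N 0≤V N≤2V) ⟩
        t ↑ w * (t * V ↑ q)     ≡⟨ swap (t ↑ w) t (V ↑ q) ⟩
        t * (t ↑ w * V ↑ q)     ≤⟨ *-monoˡ-≤ 0≤base hi ⟩
        t * t ↑ (4 ℕ.+ u)       ∎
        where
        swap : ∀ a t b → a * (t * b) ≡ t * (a * b)
        swap = solve 3 (λ a t b → a :* (t :* b) := t :* (a :* b)) refl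

  module _ {τ v x y : ℝ} {N q u w : ℕ} (isLog : IsLog τ v x) (v≃N : v D.≃ fromℕ N) (1≤N : 1 ℕ.≤ N)
    (close : D.∣ x D.- y ∣ D.< fromℚ (inv q)) (near : Eventually λ n → NearInteger q u w (seq y n))
    (large : Eventually λ n → ι (2 ℕ.^ suc q) ≤ seq τ n) where

    private
      ½-bound : Eventually λ n → seq v n ≤ ι N + ½ × ι N ≤ seq v n + ½
      ½-bound = ev-map (λ n → λ (p , r) → subst (λ z → seq v n ≤ z + ½) (sym (ι-def N)) p
          , subst (_≤ seq v n + ½) (sym (ι-def N)) r)
        (ev-× (proj₁ v≃N ½ (positive⁻¹ ½)) (proj₂ v≃N ½ (positive⁻¹ ½)))

      open +-*-Solver
      1≤ιN : 1ℚ ≤ ι N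
      1≤ιN = subst (_≤ ι N) ι-1 (ι-mono-≤ 1≤N)

      2-bound : Eventually λ n → 0ℚ ≤ seq v n × seq v n ≤ ι 2 * ι N × ι N ≤ ι 2 * seq v n
      2-bound = ev-map (λ n (p , r) → half-apart (seq v n) (ι N) ½ 0≤½ refl p r 1≤ιN) ½-bound

      xy-close : Eventually λ n → ι (suc q) * seq x n ≤ ι (suc q) * seq y n + 1ℚ × ι (suc q) * seq y n ≤ ι (suc q) * seq x n + 1ℚ
      xy-close = let ε , 0<ε , h = close in ev-map (λ n p → scaled-close q (<-≤-trans
          (subst (_< ∣ seq x n - seq y n ∣ + ε) (+-identityʳ _) (+-monoʳ-< ∣ seq x n - seq y n ∣ 0<ε)) p)) h

      4≡ : ∀ k → ι (4 ℕ.+ k) ≡ 1ℚ + (1ℚ + (1ℚ + (1ℚ + ι k)))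
      4≡ k = trans (ι-suc _) (cong (_+_ 1ℚ) (trans (ι-suc _) (cong (_+_ 1ℚ) (trans (ι-suc _) (cong (_+_ 1ℚ) (ι-suc k))))))

      lower-hyp : fromℕ u D.< fromℕ (4 ℕ.+ w) D.+ suc q D.· x
      lower-hyp = 1ℚ , 0<1 , ev-map₂ (λ n → λ (lo , _) (_ , p) →
        subst₂ _≤_ (cong (_+ 1ℚ) (ι-def u)) (cong₂ (λ a b → a + b * seq x n) (ι-def (4 ℕ.+ w)) (ι-def (suc q)))
          (subst (λ z → ι u + 1ℚ ≤ z + ι (suc q) * seq x n) (sym (4≡ w))
            (by (+-mono-≤ lo p) (solve 4 (λ u w X Y →
               u :+ con 1ℚ :+ ((Y :+ w :+ (con 1ℚ :+ con 1ℚ)) :+ (X :+ con 1ℚ))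
               := (con 1ℚ :+ (con 1ℚ :+ (con 1ℚ :+ (con 1ℚ :+ w)))) :+ X :+ (u :+ Y)) refl
               (ι u) (ι w) (ι (suc q) * seq x n) (ι (suc q) * seq y n))))) near xy-close

      upper-hyp : fromℕ w D.+ suc q D.· x D.< fromℕ (4 ℕ.+ u)
      upper-hyp = 1ℚ , 0<1 , ev-map₂ (λ n → λ (_ , hi) (p , _) →
        subst₂ _≤_ (cong (_+ 1ℚ) (cong₂ (λ a b → a + b * seq x n) (ι-def w) (ι-def (suc q)))) (ι-def (4 ℕ.+ u))
          (subst (λ z → ι w + ι (suc q) * seq x n + 1ℚ ≤ z) (sym (4≡ u))
            (by (+-mono-≤ hi p) (solve 4 (λ u w X Y →
               w :+ X :+ con 1ℚ :+ ((u :+ (con 1ℚ :+ con 1ℚ)) :+ (Y :+ con 1ℚ))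
               := (con 1ℚ :+ (con 1ℚ :+ (con 1ℚ :+ (con 1ℚ :+ u)))) :+ ((Y :+ w) :+ X)) refl
               (ι u) (ι w) (ι (suc q) * seq x n) (ι (suc q) * seq y n))))) near xy-close

      drop-ε : ∀ {a b ε} → 0ℚ < ε → a + ε ≤ b → a ≤ b
      drop-ε {a} {b} {ε} 0<ε = ≤-trans (subst (_≤ a + ε) (+-identityʳ a) (+-monoʳ-≤ a (<⇒≤ 0<ε)))

      lower-pow : Eventually λ n → seq τ n ↑ u ≤ seq τ n ↑ (4 ℕ.+ w) * seq v n ↑ suc q
      lower-pow = let ε , 0<ε , h = proj₁ (isLog u (suc q) (4 ℕ.+ w)) lower-hyp in
        ev-map (λ n p → subst₂ _≤_ (seq-^ τ u n) (cong₂ _*_ (seq-^ τ (4 ℕ.+ w) n) (seq-^ v (suc q) n)) (drop-ε 0<ε p)) h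

      upper-pow : Eventually λ n → seq τ n ↑ w * seq v n ↑ suc q ≤ seq τ n ↑ (4 ℕ.+ u)
      upper-pow = let ε , 0<ε , h = proj₂ (isLog (4 ℕ.+ u) (suc q) w) upper-hyp in
        ev-map (λ n p → subst₂ _≤_ (cong₂ _*_ (seq-^ τ w n) (seq-^ v (suc q) n)) (seq-^ τ (4 ℕ.+ u) n) (drop-ε 0<ε p)) h

    sandwich : Eventually λ n → Sandwich (seq τ n) (suc q) u w N
    sandwich = ev-map₂ (λ n (2^q≤t , 0≤V , V≤2N , N≤2V) (lo , hi) →
        lower-sandwich (seq τ n) (seq v n) (ι N) (suc q) u w 2^q≤t 0≤V (0≤ι N) V≤2N lo
      , upper-sandwich (seq τ n) (seq v n) (ι N) (suc q) u w 2^q≤t 0≤V (0≤ι N) N≤2V hi)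
      (ev-× large 2-bound) (ev-× lower-pow upper-pow)

  -- The bounds for the three counts are inserted into the q-th power of the inequality between
  -- them, and exponents of t are compared. The constant D costs the single `suc`, by D^q ≤ t.
  combine : ∀ {t q Nᵢ Nⱼ Nₖ A B C D uᵢ wᵢ uⱼ wⱼ uₖ wₖ} → 1ℚ < t → ι (D ℕ.^ q) ≤ t →
    Nᵢ ℕ.^ A ℕ.≤ D ℕ.* (Nⱼ ℕ.^ B ℕ.* Nₖ ℕ.^ C) →
    Sandwich t q uᵢ wᵢ Nᵢ → Sandwich t q uⱼ wⱼ Nⱼ → Sandwich t q uₖ wₖ Nₖ →
    uᵢ ℕ.* A ℕ.+ (wⱼ ℕ.* B ℕ.+ wₖ ℕ.* C) ℕ.≤ (5 ℕ.+ wᵢ) ℕ.* A ℕ.+ suc ((5 ℕ.+ uⱼ) ℕ.* B ℕ.+ (5 ℕ.+ uₖ) ℕ.* C)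
  combine {t} {q} {Nᵢ} {Nⱼ} {Nₖ} {A} {B} {C} {D} {uᵢ} {wᵢ} {uⱼ} {wⱼ} {uₖ} {wₖ} 1<t D^q≤t N≤ (loᵢ , _) (_ , hiⱼ) (_ , hiₖ) = ↑-cancel-≤ 1<t (begin
    t ↑ (uᵢ ℕ.* A ℕ.+ (wⱼ ℕ.* B ℕ.+ wₖ ℕ.* C))
      ≡⟨ trans (↑-homo-* t (uᵢ ℕ.* A) _) (cong₂ _*_ (sym (↑-assocʳ t uᵢ A))
           (trans (↑-homo-* t (wⱼ ℕ.* B) (wₖ ℕ.* C)) (cong₂ _*_ (sym (↑-assocʳ t wⱼ B)) (sym (↑-assocʳ t wₖ C))))) ⟩
    (t ↑ uᵢ) ↑ A * ((t ↑ wⱼ) ↑ B * (t ↑ wₖ) ↑ C)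
      ≤⟨ *-monoʳ-≤ 0≤WW (≤-trans (↑-monoˡ-≤ (0≤↑ 0≤t uᵢ) loᵢ A) (≤-reflexive (↑-distrib-* (t ↑ (5 ℕ.+ wᵢ)) (ι Nᵢ ↑ q) A))) ⟩
    X * (ι Nᵢ ↑ q) ↑ A * ((t ↑ wⱼ) ↑ B * (t ↑ wₖ) ↑ C)
      ≤⟨ *-monoʳ-≤ 0≤WW (*-monoˡ-≤ 0≤X N-bound) ⟩
    X * (t * ((ι Nⱼ ↑ q) ↑ B * (ι Nₖ ↑ q) ↑ C)) * ((t ↑ wⱼ) ↑ B * (t ↑ wₖ) ↑ C)
      ≡⟨ solve 6 (λ X t a b c d → X :* (t :* (a :* b)) :* (c :* d) := X :* (t :* ((c :* a) :* (d :* b)))) refl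
           X t ((ι Nⱼ ↑ q) ↑ B) ((ι Nₖ ↑ q) ↑ C) ((t ↑ wⱼ) ↑ B) ((t ↑ wₖ) ↑ C) ⟩
    X * (t * (((t ↑ wⱼ) ↑ B * (ι Nⱼ ↑ q) ↑ B) * ((t ↑ wₖ) ↑ C * (ι Nₖ ↑ q) ↑ C)))
      ≡⟨ cong (λ z → X * (t * z)) (cong₂ _*_ (↑-distrib-* (t ↑ wⱼ) (ι Nⱼ ↑ q) B) (↑-distrib-* (t ↑ wₖ) (ι Nₖ ↑ q) C)) ⟨
    X * (t * ((t ↑ wⱼ * ι Nⱼ ↑ q) ↑ B * (t ↑ wₖ * ι Nₖ ↑ q) ↑ C))
      ≤⟨ *-monoˡ-≤ 0≤X (*-monoˡ-≤ 0≤t (*-mono-≤ (0≤↑ (0≤* (0≤↑ 0≤t wₖ) (0≤↑ (0≤ι Nₖ) q)) C)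
           (0≤↑ (0≤↑ 0≤t (5 ℕ.+ uⱼ)) B)
           (↑-monoˡ-≤ (0≤* (0≤↑ 0≤t wⱼ) (0≤↑ (0≤ι Nⱼ) q)) hiⱼ B)
           (↑-monoˡ-≤ (0≤* (0≤↑ 0≤t wₖ) (0≤↑ (0≤ι Nₖ) q)) hiₖ C))) ⟩
    X * (t * ((t ↑ (5 ℕ.+ uⱼ)) ↑ B * (t ↑ (5 ℕ.+ uₖ)) ↑ C))
      ≡⟨ cong₂ (λ a b → a * (t * b)) (↑-assocʳ t (5 ℕ.+ wᵢ) A)
           (trans (cong₂ _*_ (↑-assocʳ t (5 ℕ.+ uⱼ) B) (↑-assocʳ t (5 ℕ.+ uₖ) C)) (sym (↑-homo-* t ((5 ℕ.+ uⱼ) ℕ.* B) ((5 ℕ.+ uₖ) ℕ.* C)))) ⟩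
    t ↑ ((5 ℕ.+ wᵢ) ℕ.* A) * t ↑ suc ((5 ℕ.+ uⱼ) ℕ.* B ℕ.+ (5 ℕ.+ uₖ) ℕ.* C)
      ≡⟨ ↑-homo-* t ((5 ℕ.+ wᵢ) ℕ.* A) (suc ((5 ℕ.+ uⱼ) ℕ.* B ℕ.+ (5 ℕ.+ uₖ) ℕ.* C)) ⟨
    t ↑ ((5 ℕ.+ wᵢ) ℕ.* A ℕ.+ suc ((5 ℕ.+ uⱼ) ℕ.* B ℕ.+ (5 ℕ.+ uₖ) ℕ.* C)) ∎)
    where
    open ≤-Reasoning
    open +-*-Solver
    0≤t : 0ℚ ≤ t
    0≤t = <⇒≤ (<-trans 0<1 1<t)

    X : ℚ
    X = (t ↑ (5 ℕ.+ wᵢ)) ↑ A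

    0≤X : 0ℚ ≤ X
    0≤X = 0≤↑ (0≤↑ 0≤t (5 ℕ.+ wᵢ)) A

    0≤WW : 0ℚ ≤ (t ↑ wⱼ) ↑ B * (t ↑ wₖ) ↑ C
    0≤WW = 0≤* (0≤↑ (0≤↑ 0≤t wⱼ) B) (0≤↑ (0≤↑ 0≤t wₖ) C)

    ↑-swap : ∀ x a b → (x ↑ a) ↑ b ≡ (x ↑ b) ↑ a
    ↑-swap x a b = trans (↑-assocʳ x a b) (trans (cong (x ↑_) (ℕ.*-comm a b)) (sym (↑-assocʳ x b a)))

    ι-pow : ∀ N A → (ι N ↑ q) ↑ A ≡ ι (N ℕ.^ A) ↑ q
    ι-pow N A = trans (↑-swap (ι N) q A) (cong (_↑ q) (sym (ι-^ N A)))

    N-bound : (ι Nᵢ ↑ q) ↑ A ≤ t * ((ι Nⱼ ↑ q) ↑ B * (ι Nₖ ↑ q) ↑ C)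
    N-bound = begin
      (ι Nᵢ ↑ q) ↑ A                                      ≡⟨ ι-pow Nᵢ A ⟩
      ι (Nᵢ ℕ.^ A) ↑ q                                    ≤⟨ ↑-monoˡ-≤ (0≤ι (Nᵢ ℕ.^ A)) (ι-mono-≤ N≤) q ⟩
      ι (D ℕ.* (Nⱼ ℕ.^ B ℕ.* Nₖ ℕ.^ C)) ↑ q              ≡⟨ cong (_↑ q) (trans (ι-* D (Nⱼ ℕ.^ B ℕ.* Nₖ ℕ.^ C)) (cong (ι D *_) (ι-* (Nⱼ ℕ.^ B) (Nₖ ℕ.^ C)))) ⟩
      (ι D * (ι (Nⱼ ℕ.^ B) * ι (Nₖ ℕ.^ C))) ↑ q          ≡⟨ trans (↑-distrib-* (ι D) (ι (Nⱼ ℕ.^ B) * ι (Nₖ ℕ.^ C)) q) (cong (ι D ↑ q *_) (↑-distrib-* (ι (Nⱼ ℕ.^ B)) (ι (Nₖ ℕ.^ C)) q)) ⟩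
      ι D ↑ q * (ι (Nⱼ ℕ.^ B) ↑ q * ι (Nₖ ℕ.^ C) ↑ q)    ≡⟨ cong₂ _*_ (sym (ι-^ D q)) (cong₂ _*_ (sym (ι-pow Nⱼ B)) (sym (ι-pow Nₖ C))) ⟩
      ι (D ℕ.^ q) * ((ι Nⱼ ↑ q) ↑ B * (ι Nₖ ↑ q) ↑ C)    ≤⟨ *-monoʳ-≤ (0≤* (0≤↑ (0≤↑ (0≤ι Nⱼ) q) B) (0≤↑ (0≤↑ (0≤ι Nₖ) q) C)) D^q≤t ⟩
      t * ((ι Nⱼ ↑ q) ↑ B * (ι Nₖ ↑ q) ↑ C)               ∎

  private
    slack : ∀ Q A B C ui wi uj wj uk wk si sj sk f two ε → 0ℚ < Q → 0ℚ ≤ A → 0ℚ ≤ B → 0ℚ ≤ C →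
      ui * A + (wj * B + wk * C) ≤ (f + wi) * A + (1ℚ + ((f + uj) * B + (f + uk) * C)) →
      Q * si + wi ≤ ui + two → uj ≤ Q * sj + wj + two → uk ≤ Q * sk + wk + two →
      (f + two) * (A + B + C) + 1ℚ ≤ Q * ε →
      0ℚ ≤ B * sj + C * sk - A * si + ε
    slack Q A B C ui wi uj wj uk wk si sj sk f two ε 0<Q 0≤A 0≤B 0≤C p hᵢ hⱼ hₖ e = *-cancelˡ-≤ 0<Q
      (by (+-mono-≤ (+-mono-≤ (+-mono-≤ (*-monoˡ-≤ 0≤A hᵢ) (*-monoˡ-≤ 0≤B hⱼ)) (*-monoˡ-≤ 0≤C hₖ)) (+-mono-≤ p e))
        (solve 16 (λ Q A B C ui wi uj wj uk wk si sj sk f two ε →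
          Q :* con 0ℚ :+ (A :* (ui :+ two) :+ B :* (Q :* sj :+ wj :+ two) :+ C :* (Q :* sk :+ wk :+ two)
            :+ ((f :+ wi) :* A :+ (con 1ℚ :+ ((f :+ uj) :* B :+ (f :+ uk) :* C)) :+ Q :* ε))
          := Q :* (B :* sj :+ C :* sk :- A :* si :+ ε) :+ (A :* (Q :* si :+ wi) :+ B :* uj :+ C :* uk
            :+ (ui :* A :+ (wj :* B :+ wk :* C) :+ ((f :+ two) :* (A :+ B :+ C) :+ con 1ℚ))))
          refl Q A B C ui wi uj wj uk wk si sj sk f two ε))
      where open +-*-Solver

  !-fromℕ< : ∀ {s} (y : ℝ^ s) {i} (i<s : i ℕ.< s) → y ! i ≡ y (fromℕ< i<s)
  !-fromℕ< {s} y {i} i<s with i ℕ.<? s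
  ... | yes _   = refl
  ... | no  i≮s = contradiction i<s i≮s

  homs≡hom : ∀ m (G : Graph) (i : Fin (suc m)) → homs G (toℕ i) ≡ D.hom (𝒰 m i) G
  homs≡hom m G zero    = sym (hom-S₀ G)
  homs≡hom m G (suc i) = sym (hom-S₂₁ G (toℕ i))

  private
    positive-count : ∀ {v N} → 0ℝ D.< v → v D.≃ fromℕ N → 1 ℕ.≤ N
    positive-count {v} {suc N} _ _ = s≤s z≤n
    positive-count {v} {zero} (ε , 0<ε , 0<v) (v≤N , _) with inverse (subst (0ℚ <_) (ι-suc 1) (0<ι 1))
    ... | h , 0<h , 2h≡1 = contradiction (ev-const (ev-map₂ (λ n p r → refute (seq v n) p r) 0<v (v≤N (ε * h) (0<* 0<ε 0<h)))) λ ()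
      where
      open +-*-Solver
      refute : ∀ V → 0ℚ + ε ≤ V → V ≤ + 0 / 1 + ε * h → 1 ≡ 0
      refute V p r = contradiction (*-cancelˡ-≤ 0<ε (≤-trans (by (+-mono-≤ p r) (solve 3 (λ ε h V →
          ε :* (con 1ℚ :+ h) :+ (V :+ (con 0ℚ :+ ε :* h)) := ε :* (h :+ h) :+ (con 0ℚ :+ ε :+ V)) refl ε h V))
          (≤-reflexive (cong (ε *_) (trans (solve 1 (λ h → h :+ h := (con 1ℚ :+ con 1ℚ) :* h) refl h)
            (trans (cong (λ z → (1ℚ + z) * h) (sym ι-1)) 2h≡1))))))
        (λ 1+h≤1 → <-irrefl refl (<-≤-trans (subst (_< 1ℚ + h) (+-identityʳ 1ℚ) (+-monoʳ-< 1ℚ 0<h)) 1+h≤1))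

  -- For given constraint and ε a single pair (τ, x) is enough: u and w depend on y and q alone, so
  -- the inequality `ineq` between natural numbers, once obtained from that pair, bounds the
  -- constraint at y up to ε.
  LimSup⊆Q : ∀ {K} → 2 ℕ.≤ K → ∀ {y} → LimSup (λ τ → log[ τ ] (𝒩 (𝒰 (2+ K)))) y → Q (2+ K) y
  LimSup⊆Q {K} 2≤K {y} y∈ = Holds⇒Q 2≤K λ c → holds c
    where
    holds : ∀ {A i B j C k} → Constraint K A i B j C k → Holds y A i B j C k
    -- One more than 64^(q+1), because T ≤ τ bounds the terms of τ only up to a positive error,
    -- taken to be 1.
    holds {A} {i} {B} {j} {C} {k} c ε 0<ε = conclude (y∈ (fromℚ (inv q)) (inv q , 0<inv q , 0 , λ _ _ → ≤-reflexive (+-identityˡ (inv q)))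
        (fromℕ (suc (64 ℕ.^ suc q))))
      where
      S : ℕ
      -- Per unit of coefficient, 5 from `Sandwich` and 2 from `NearInteger`; the final 1 is for the
      -- constant 64.
      S = 7 ℕ.* (A ℕ.+ B ℕ.+ C) ℕ.+ 1

      q : ℕ
      q = proj₁ (large-denominator 0<ε S)

      u w : ℕ → ℕ
      u l = proj₁ (real-floor (y ! l) q)
      w l = proj₁ (proj₂ (real-floor (y ! l) q))

      near : ∀ l → Eventually λ n → NearInteger q (u l) (w l) (seq (y ! l) n)
      near l = proj₂ (proj₂ (real-floor (y ! l) q))

      S≤ : (ι 5 + (1ℚ + 1ℚ)) * (ι A + ι B + ι C) + 1ℚ ≤ ι (suc q) * ε
      S≤ = subst (_≤ ι (suc q) * ε) (trans (ι-+ (7 ℕ.* (A ℕ.+ B ℕ.+ C)) 1) (cong₂ _+_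
          (trans (ι-* 7 (A ℕ.+ B ℕ.+ C)) (cong₂ _*_ (trans (ι-+ 5 2) (cong (_+_ (ι 5)) (trans (ι-suc 1) (cong (_+_ 1ℚ) ι-1))))
            (trans (ι-+ (A ℕ.+ B) C) (cong (_+ ι C) (ι-+ A B))))) ι-1))
        (proj₂ (large-denominator 0<ε S))

      conclude : (∃ λ τ → 1ℝ D.< τ × fromℕ (suc (64 ℕ.^ suc q)) D.≤ τ × ∃ λ x →
          log[ τ ] (𝒩 (𝒰 (2+ K))) x × D.Within (fromℚ (inv q)) x y) →
        Eventually λ n → 0ℚ ≤ form (λ i → seq (y ! i) n) A i B j C k + ε
      conclude (τ , (δ , 0<δ , 1+δ≤τ) , T≤τ , x , (v , (G , v≃) , 0<v , isLog) , close) =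
        ev-map (λ n ((nᵢ , nⱼ) , nₖ) → slack (ι (suc q)) (ι A) (ι B) (ι C) (ι (u i)) (ι (w i)) (ι (u j)) (ι (w j)) (ι (u k)) (ι (w k))
            (seq (y ! i) n) (seq (y ! j) n) (seq (y ! k) n) (ι 5) (1ℚ + 1ℚ) ε
            (0<ι q) (0≤ι A) (0≤ι B) (0≤ι C) ι-ineq (proj₂ nᵢ) (proj₁ nⱼ) (proj₁ nₖ) S≤)
          (ev-× (ev-× (near i) (near j)) (near k))
        where
        large : Eventually λ n → ι (64 ℕ.^ suc q) ≤ seq τ n
        large = ev-map (λ n p → +-cancelˡ (subst (_≤ seq τ n + 1ℚ) (trans (sym (ι-def (suc (64 ℕ.^ suc q)))) (ι-suc (64 ℕ.^ suc q))) p))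
            (T≤τ 1ℚ 0<1)
          where
          +-cancelˡ : ∀ {a b} → 1ℚ + a ≤ b + 1ℚ → a ≤ b
          +-cancelˡ {a} {b} p = by p (solve 2 (λ a b → a :+ (b :+ con 1ℚ) := b :+ (con 1ℚ :+ a)) refl a b)
            where open +-*-Solver

        1<t : Eventually λ n → 1ℚ < seq τ n
        1<t = ev-map (λ n → <-≤-trans (subst (_< 1ℚ + δ) (+-identityʳ 1ℚ) (+-monoʳ-< 1ℚ 0<δ))) 1+δ≤τ

        coordinate : ∀ l → l ℕ.≤ 2+ K → Eventually λ n → Sandwich (seq τ n) (suc q) (u l) (w l) (homs G l)
        coordinate l l≤ = sandwich {τ} {v l′} {x l′} {y ! l} (isLog l′) v≃′ (positive-count {v l′} (0<v l′) v≃′)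
            (subst (λ z → D.∣ x l′ D.- z ∣ D.< fromℚ (inv q)) (sym (!-fromℕ< y (s≤s l≤))) (close l′))
            (near l) (ev-map (λ n → ≤-trans (ι-mono-≤ (ℕ.^-monoˡ-≤ (suc q) {2} {64} (ℕ.m≤m+n 2 62)))) large)
          where
          l′ : Fin (suc (2+ K))
          l′ = fromℕ< (s≤s l≤)

          v≃′ : v l′ D.≃ fromℕ (homs G l)
          v≃′ = subst (λ N → v l′ D.≃ fromℕ N) (trans (sym (homs≡hom (2+ K) G l′)) (cong (homs G) (toℕ-fromℕ< (s≤s l≤)))) (v≃ l′)

        ineq : u i ℕ.* A ℕ.+ (w j ℕ.* B ℕ.+ w k ℕ.* C) ℕ.≤ (5 ℕ.+ w i) ℕ.* A ℕ.+ suc ((5 ℕ.+ u j) ℕ.* B ℕ.+ (5 ℕ.+ u k) ℕ.* C)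
        ineq = let i≤ , j≤ , k≤ = indices≤ 2≤K c in ev-const (ev-map₂
          (λ n (1<t , large) ((sᵢ , sⱼ) , sₖ) →
            combine {q = suc q} {Nᵢ = homs G i} {homs G j} {homs G k} {A} {B} {C} {64} {u i} {w i} {u j} {w j} {u k} {w k}
              1<t large (homs-Constraint G c) sᵢ sⱼ sₖ)
          (ev-× 1<t large) (ev-× (ev-× (coordinate i i≤) (coordinate j j≤)) (coordinate k k≤)))

        ι-5+ : ∀ a b → ι ((5 ℕ.+ a) ℕ.* b) ≡ (ι 5 + ι a) * ι b
        ι-5+ a b = trans (ι-* (5 ℕ.+ a) b) (cong (_* ι b) (ι-+ 5 a))

        ι-ineq : ι (u i) * ι A + (ι (w j) * ι B + ι (w k) * ι C)
          ≤ (ι 5 + ι (w i)) * ι A + (1ℚ + ((ι 5 + ι (u j)) * ι B + (ι 5 + ι (u k)) * ι C))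
        ι-ineq = subst₂ _≤_
          (trans (ι-+ (u i ℕ.* A) _) (cong₂ _+_ (ι-* (u i) A) (trans (ι-+ (w j ℕ.* B) (w k ℕ.* C)) (cong₂ _+_ (ι-* (w j) B) (ι-* (w k) C)))))
          (trans (ι-+ ((5 ℕ.+ w i) ℕ.* A) _) (cong₂ _+_ (ι-5+ (w i) A) (trans (ι-suc _) (cong (_+_ 1ℚ)
            (trans (ι-+ ((5 ℕ.+ u j) ℕ.* B) ((5 ℕ.+ u k) ℕ.* C)) (cong₂ _+_ (ι-5+ (u j) B) (ι-5+ (u k) C)))))))
          (ι-mono-≤ ineq)

-- Rounding a point of Q to an integral point of its cone

module Sufficiency where

  open Rationals
  open Logarithm
  open Constraints
  open Necessity
  open Exponents using (QNat)
  open import Data.Nat.Base as ℕ using (ℕ; zero; suc; 2+)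
  import Data.Nat.Properties as ℕ
  open import Data.Rational
  open import Data.Rational.Properties
  open import Data.Rational.Solver using (module +-*-Solver)
  open import Data.Product.Base using (_×_; _,_; proj₁; proj₂)
  open import Function.Base using (_∘_)
  open import Relation.Binary.PropositionalEquality
  open import Defs using (ℝ^; seq; _!_; Q)

  private
    interior≤ : ∀ K l → l ℕ.≤ 2+ K → interior K l ℕ.≤ 3 ℕ.* ((2+ K) ℕ.* (2+ K))
    interior≤ K zero    _ = ℕ.*-monoˡ-≤ ((2+ K) ℕ.* (2+ K)) {2} {3} (ℕ.n≤1+n 2)
    interior≤ K (suc i) i< = ℕ.≤-trans
      (ℕ.+-monoʳ-≤ (2 ℕ.* ((2+ K) ℕ.* (2+ K))) (ℕ.*-mono-≤ (ℕ.<⇒≤ i<) (ℕ.<⇒≤ i<)))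
      (ℕ.≤-reflexive (ℕ.+-comm (2 ℕ.* ((2+ K) ℕ.* (2+ K))) ((2+ K) ℕ.* (2+ K))))

  abstract
    -- Rounding moves each coordinate by at most 2, hence a constraint by at most 2 (A + B + C); the
    -- last 1 comes from the scaled tolerance of `Holds`.
    margin : ℕ → ℕ
    margin K = 2 ℕ.* (2 ℕ.* K ℕ.+ 3) ℕ.+ 1

    ≤margin : ∀ K {n} → n ℕ.≤ 2 ℕ.* K ℕ.+ 3 → 2 ℕ.* n ℕ.+ 1 ℕ.≤ margin K
    ≤margin K n≤ = ℕ.+-monoˡ-≤ 1 (ℕ.*-monoʳ-≤ 2 n≤)

    radius : ℕ → ℕ
    radius K = margin K ℕ.* (3 ℕ.* ((2+ K) ℕ.* (2+ K)))

    ≤radius : ∀ K l → l ℕ.≤ 2+ K → margin K ℕ.* interior K l ℕ.≤ radius K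
    ≤radius K l l≤ = ℕ.*-monoʳ-≤ (margin K) (interior≤ K l l≤)

  -- Rounding (q + 1) y to an integer violates each constraint by at most
  -- margin K, and adding that multiple of an interior point repairs it.
  module Rounding {K : ℕ} (2≤K : 2 ℕ.≤ K) {y : ℝ^ (suc (2+ K))} (y∈Q : Q (2+ K) y) (q : ℕ) where
    private
      u w : ℕ → ℕ
      u l = proj₁ (real-floor (y ! l) q)
      w l = proj₁ (proj₂ (real-floor (y ! l) q))

      near : ∀ l → Eventually λ n → NearInteger q (u l) (w l) (seq (y ! l) n)
      near l = proj₂ (proj₂ (real-floor (y ! l) q))

      κ : ℚ
      κ = ι (margin K)

      z : ℕ → ℚ
      z l = ι (interior K l)

      P : ℕ → ℕ
      P l = u l ℕ.+ margin K ℕ.* interior K l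

      r : ℕ → ℚ
      r l = (ι (u l) - ι (w l)) + κ * z l

      rounded : ∀ A B C ui wi uj wj uk wk xi xj xk → 0ℚ ≤ A → 0ℚ ≤ B → 0ℚ ≤ C →
        ui ≤ xi + wi + (1ℚ + 1ℚ) → xj + wj ≤ uj + (1ℚ + 1ℚ) → xk + wk ≤ uk + (1ℚ + 1ℚ) →
        0ℚ ≤ B * xj + C * xk - A * xi + 1ℚ →
        A * (ui - wi) ≤ B * (uj - wj) + C * (uk - wk) + ((1ℚ + 1ℚ) * (A + B + C) + 1ℚ)
      rounded A B C ui wi uj wj uk wk xi xj xk 0≤A 0≤B 0≤C hᵢ hⱼ hₖ h =
        by (+-mono-≤ (+-mono-≤ (*-monoˡ-≤ 0≤A hᵢ) (*-monoˡ-≤ 0≤B hⱼ)) (+-mono-≤ (*-monoˡ-≤ 0≤C hₖ) h))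
          (solve 12 (λ A B C ui wi uj wj uk wk xi xj xk → let two = con 1ℚ :+ con 1ℚ in
            A :* (ui :- wi) :+ (A :* (xi :+ wi :+ two) :+ B :* (uj :+ two) :+ (C :* (uk :+ two) :+ (B :* xj :+ C :* xk :- A :* xi :+ con 1ℚ)))
            := B :* (uj :- wj) :+ C :* (uk :- wk) :+ (two :* (A :+ B :+ C) :+ con 1ℚ)
              :+ (A :* ui :+ B :* (xj :+ wj) :+ (C :* (xk :+ wk) :+ con 0ℚ)))
            refl A B C ui wi uj wj uk wk xi xj xk)
        where open +-*-Solver

      repaired : ∀ A B C di dj dk zi zj zk κ s → 0ℚ ≤ κ → A * di ≤ B * dj + C * dk + s → s ≤ κ →
        1ℚ + A * zi ≤ B * zj + C * zk → A * (di + κ * zi) ≤ B * (dj + κ * zj) + C * (dk + κ * zk)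
      repaired A B C di dj dk zi zj zk κ s 0≤κ h hκ hz =
        by (+-mono-≤ h (+-mono-≤ (*-monoˡ-≤ 0≤κ hz) hκ))
          (solve 11 (λ A B C di dj dk zi zj zk κ s →
            A :* (di :+ κ :* zi) :+ (B :* dj :+ C :* dk :+ s :+ (κ :* (B :* zj :+ C :* zk) :+ κ))
            := B :* (dj :+ κ :* zj) :+ C :* (dk :+ κ :* zk) :+ (A :* di :+ (κ :* (con 1ℚ :+ A :* zi) :+ s)))
            refl A B C di dj dk zi zj zk κ s)
        where open +-*-Solver

      scaled-form : ∀ Q A B C si sj sk i → 0ℚ ≤ Q → Q * i ≡ 1ℚ → 0ℚ ≤ B * sj + C * sk - A * si + i →
        0ℚ ≤ B * (Q * sj) + C * (Q * sk) - A * (Q * si) + 1ℚ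
      scaled-form Q A B C si sj sk i 0≤Q Qi≡1 h = subst (λ o → 0ℚ ≤ B * (Q * sj) + C * (Q * sk) - A * (Q * si) + o) Qi≡1
        (by (*-monoˡ-≤ 0≤Q h) (solve 8 (λ Q A B C si sj sk i →
          con 0ℚ :+ Q :* (B :* sj :+ C :* sk :- A :* si :+ i)
          := B :* (Q :* sj) :+ C :* (Q :* sk) :- A :* (Q :* si) :+ Q :* i :+ Q :* con 0ℚ) refl Q A B C si sj sk i))
        where open +-*-Solver

      ι-2* : ∀ n → ι (2 ℕ.* n) ≡ (1ℚ + 1ℚ) * ι n
      ι-2* n = trans (ι-* 2 n) (cong (_* ι n) (trans (ι-suc 1) (cong (_+_ 1ℚ) ι-1)))

      r-Constraint : ∀ {A i B j C k} → Constraint K A i B j C k → ι A * r i ≤ ι B * r j + ι C * r k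
      r-Constraint {A} {i} {B} {j} {C} {k} c = ev-const (ev-map₂ (λ n h ((nᵢ , nⱼ) , nₖ) →
          repaired (ι A) (ι B) (ι C) (ι (u i) - ι (w i)) (ι (u j) - ι (w j)) (ι (u k) - ι (w k)) (z i) (z j) (z k) κ
            ((1ℚ + 1ℚ) * (ι A + ι B + ι C) + 1ℚ) (0≤ι (margin K))
            (rounded (ι A) (ι B) (ι C) (ι (u i)) (ι (w i)) (ι (u j)) (ι (w j)) (ι (u k)) (ι (w k))
              (ι (suc q) * seq (y ! i) n) (ι (suc q) * seq (y ! j) n) (ι (suc q) * seq (y ! k) n)
              (0≤ι A) (0≤ι B) (0≤ι C) (proj₁ nᵢ) (proj₂ nⱼ) (proj₂ nₖ)
              (scaled-form (ι (suc q)) (ι A) (ι B) (ι C) (seq (y ! i) n) (seq (y ! j) n) (seq (y ! k) n) (inv q)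
                (0≤ι (suc q)) (q*inv≡1 q) h))
            κ≥ z≤)
        (Q⇒Holds 2≤K y∈Q c (inv q) (0<inv q)) (ev-× (ev-× (near i) (near j)) (near k)))
        where
        z≤ : 1ℚ + ι A * z i ≤ ι B * z j + ι C * z k
        z≤ = subst₂ _≤_ (trans (ι-suc (A ℕ.* interior K i)) (cong (_+_ 1ℚ) (ι-* A (interior K i))))
          (trans (ι-+ (B ℕ.* interior K j) (C ℕ.* interior K k)) (cong₂ _+_ (ι-* B (interior K j)) (ι-* C (interior K k))))
          (ι-mono-≤ (interior-Constraint c))

        κ≥ : (1ℚ + 1ℚ) * (ι A + ι B + ι C) + 1ℚ ≤ κ
        κ≥ = subst (_≤ κ) (trans (ι-+ (2 ℕ.* (A ℕ.+ B ℕ.+ C)) 1) (cong₂ _+_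
            (trans (ι-2* (A ℕ.+ B ℕ.+ C)) (cong ((1ℚ + 1ℚ) *_) (trans (ι-+ (A ℕ.+ B) C) (cong (_+ ι C) (ι-+ A B))))) ι-1))
          (ι-mono-≤ (≤margin K (coefficients≤ 2≤K c)))

      1* : ∀ x → ι 1 * x ≡ x
      1* x = trans (cong (_* x) ι-1) (*-identityˡ x)

      0* : ∀ x → ι 0 * x ≡ 0ℚ
      0* x = trans (cong (_* x) ι-0) (*-zeroˡ x)

      2* : ∀ x → ι 2 * x ≡ x + x
      2* x = trans (cong (_* x) (trans (ι-suc 1) (cong (_+_ 1ℚ) ι-1)))
        (solve 1 (λ x → (con 1ℚ :+ con 1ℚ) :* x := x :+ x) refl x)
        where open +-*-Solver

      r-nondecreasing : ∀ i → i ℕ.≤ K → r (suc i) ≤ r (2+ i)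
      r-nondecreasing zero    _   = subst₂ _≤_ (1* (r 1)) (trans (cong₂ _+_ (1* (r 2)) (0* (r 0))) (+-identityʳ (r 2))) (r-Constraint c₁)
      r-nondecreasing (suc i) i<K = step (r (suc i)) (r (2+ i)) (r (suc (2+ i)))
        (subst₂ _≤_ (2* (r (2+ i))) (cong₂ _+_ (1* (r (suc i))) (1* (r (suc (2+ i))))) (r-Constraint (c₇ i i<K)))
        (r-nondecreasing i (ℕ.<⇒≤ i<K))
        where
        step : ∀ a b c → b + b ≤ a + c → a ≤ b → b ≤ c
        step a b c p s = by (+-mono-≤ p s) (solve 3 (λ a b c → b :+ (a :+ c :+ b) := c :+ (b :+ b :+ a)) refl a b c)
          where open +-*-Solver

      -- Nonnegativity is a consequence of the constraints: once `r` is nondecreasing, `c₅` gives it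
      -- for r 0 and `c₄` for r 1.
      r-nonneg : ∀ l → l ℕ.≤ 2+ K → 0ℚ ≤ r l
      r-nonneg zero _ = step (r 0) (r (suc K)) (r (2+ K))
          (subst₂ _≤_ (1* (r (2+ K))) (cong₂ _+_ (1* (r 0)) (1* (r (suc K)))) (r-Constraint c₅)) (r-nondecreasing K ℕ.≤-refl)
        where
        step : ∀ a b c → c ≤ a + b → b ≤ c → 0ℚ ≤ a
        step a b c p s = by (+-mono-≤ p s) (solve 3 (λ a b c → con 0ℚ :+ (a :+ b :+ c) := a :+ (c :+ b)) refl a b c)
          where open +-*-Solver
      r-nonneg (suc zero) _ = step (r 1) (r (suc K)) (r (2+ K))
          (subst₂ _≤_ (2* (r (2+ K))) (cong₂ _+_ (1* (r 1)) (2* (r (suc K)))) (r-Constraint c₄)) (r-nondecreasing K ℕ.≤-refl)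
        where
        step : ∀ a b c → c + c ≤ a + (b + b) → b ≤ c → 0ℚ ≤ a
        step a b c p s = by (+-mono-≤ p (+-mono-≤ s s)) (solve 3 (λ a b c → con 0ℚ :+ (a :+ (b :+ b) :+ (c :+ c)) := a :+ (c :+ c :+ (b :+ b))) refl a b c)
          where open +-*-Solver
      r-nonneg (suc (suc i)) l≤ = ≤-trans (r-nonneg (suc i) (ℕ.<⇒≤ l≤)) (r-nondecreasing i (ℕ.≤-pred (ℕ.≤-pred l≤)))

      ιP : ∀ l → ι (P l) ≡ ι (u l) + κ * z l
      ιP l = trans (ι-+ (u l) (margin K ℕ.* interior K l)) (cong (_+_ (ι (u l))) (ι-* (margin K) (interior K l)))

      w≤P : ∀ l → l ℕ.≤ 2+ K → w l ℕ.≤ P l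
      w≤P l l≤ = ι-cancel-≤ (subst (ι (w l) ≤_) (sym (ιP l)) (by (r-nonneg l l≤)
          (solve 3 (λ u w k → w :+ ((u :- w) :+ k) := u :+ k :+ con 0ℚ) refl (ι (u l)) (ι (w l)) (κ * z l))))
        where open +-*-Solver

    -- The truncated subtraction is exact by `w≤P`, so `point l` is the integer `r l`.
    point : ℕ → ℕ
    point l = P l ℕ.∸ w l

    private
      ι-point : ∀ l → l ℕ.≤ 2+ K → ι (point l) ≡ r l
      ι-point l l≤ = cancel (ι (point l)) (ι (w l)) (ι (u l)) (κ * z l)
          (trans (sym (ι-+ (point l) (w l))) (trans (cong ι (ℕ.m∸n+n≡m (w≤P l l≤))) (ιP l)))
        where
        open +-*-Solver
        cancel : ∀ p w u k → p + w ≡ u + k → p ≡ (u - w) + k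
        cancel p w u k e = trans (solve 2 (λ p w → p := p :+ w :- w) refl p w)
          (trans (cong (_- w) e) (solve 3 (λ u k w → u :+ k :- w := (u :- w) :+ k) refl u k w))

    point-QNat : QNat K (point 0) (point ∘ suc)
    point-QNat = Constraints⇒QNat 2≤K point λ {A} {i} {B} {j} {C} {k} c → let i≤ , j≤ , k≤ = indices≤ 2≤K c in
      ι-cancel-≤ (subst₂ _≤_
        (sym (trans (ι-* A (point i)) (cong (ι A *_) (ι-point i i≤))))
        (sym (trans (ι-+ (B ℕ.* point j) (C ℕ.* point k)) (cong₂ _+_
          (trans (ι-* B (point j)) (cong (ι B *_) (ι-point j j≤)))
          (trans (ι-* C (point k)) (cong (ι C *_) (ι-point k k≤))))))
        (r-Constraint c))

    private
      below : ∀ x u w k → x + w ≤ u + (1ℚ + 1ℚ) → 0ℚ ≤ k → x ≤ (u - w) + k + (1ℚ + 1ℚ)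
      below x u w k p r = by (+-mono-≤ p r) (solve 4 (λ x u w k →
          x :+ (u :+ (con 1ℚ :+ con 1ℚ) :+ k) := (u :- w) :+ k :+ (con 1ℚ :+ con 1ℚ) :+ (x :+ w :+ con 0ℚ)) refl x u w k)
        where open +-*-Solver

      above : ∀ x u w k R → u ≤ x + w + (1ℚ + 1ℚ) → k ≤ R → (u - w) + k ≤ x + (1ℚ + 1ℚ) + R
      above x u w k R p r = by (+-mono-≤ p r) (solve 5 (λ x u w k R →
          (u :- w) :+ k :+ (x :+ w :+ (con 1ℚ :+ con 1ℚ) :+ R) := x :+ (con 1ℚ :+ con 1ℚ) :+ R :+ (u :+ k)) refl x u w k R)
        where open +-*-Solver

      κz≤radius : ∀ l → l ℕ.≤ 2+ K → κ * z l ≤ ι (radius K)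
      κz≤radius l l≤ = subst (_≤ ι (radius K)) (ι-* (margin K) (interior K l)) (ι-mono-≤ (≤radius K l l≤))

      0≤κz : ∀ l → 0ℚ ≤ κ * z l
      0≤κz l = 0≤* {κ} {z l} (0≤ι (margin K)) (0≤ι (interior K l))

      near-below : ∀ l → l ℕ.≤ 2+ K → ∀ x → NearInteger q (u l) (w l) x → ι (suc q) * x ≤ ι (point l) + (1ℚ + 1ℚ)
      near-below l l≤ x h = subst (λ p → ι (suc q) * x ≤ p + (1ℚ + 1ℚ)) (sym (ι-point l l≤))
        (below (ι (suc q) * x) (ι (u l)) (ι (w l)) (κ * z l) (proj₂ h) (0≤κz l))

      near-above : ∀ l → l ℕ.≤ 2+ K → ∀ x → NearInteger q (u l) (w l) x → ι (point l) ≤ ι (suc q) * x + (1ℚ + 1ℚ) + ι (radius K)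
      near-above l l≤ x h = subst (_≤ ι (suc q) * x + (1ℚ + 1ℚ) + ι (radius K)) (sym (ι-point l l≤))
        (above (ι (suc q) * x) (ι (u l)) (ι (w l)) (κ * z l) (ι (radius K)) (proj₁ h) (κz≤radius l l≤))

    -- The bounds are asymmetric because the repair only adds a nonnegative multiple of the interior
    -- point.
    Near : ℕ → ℚ → Set
    Near l x = ι (suc q) * x ≤ ι (point l) + (1ℚ + 1ℚ) × ι (point l) ≤ ι (suc q) * x + (1ℚ + 1ℚ) + ι (radius K)

    point-near : ∀ l → l ℕ.≤ 2+ K → Eventually λ n → Near l (seq (y ! l) n)
    point-near l l≤ = ev-map {λ n → NearInteger q (u l) (w l) (seq (y ! l) n)} {λ n → Near l (seq (y ! l) n)}
      (λ n h → near-below l l≤ (seq (y ! l) n) h , near-above l l≤ (seq (y ! l) n) h) (near l)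

-- Points of Q are limits

module LimitPoints where

  open FiniteSums using (∑; term≤∑; ^-distribʳ-*)
  open Rationals
  open Logarithm
  open HomCount
  open Constraints
  open Necessity
  open Sufficiency
  open Realisation
  open import Data.Nat.Base as ℕ using (ℕ; zero; suc; 2+; z≤n; s≤s)
  import Data.Nat.Properties as ℕ
  open import Data.Nat.Tactic.RingSolver using (solve-∀)
  open import Data.Fin.Base using (Fin; zero; suc; toℕ)
  open import Data.Fin.Properties using (toℕ<n; fromℕ<-toℕ)
  open import Data.Rational
  open import Data.Rational.Properties
  open import Data.Rational.Solver using (module +-*-Solver)
  open import Data.Product.Base using (∃; _×_; _,_; proj₁; proj₂)
  open import Data.Sum.Base using (inj₁; inj₂)
  open import Relation.Binary.PropositionalEquality
  open import Relation.Nullary using (yes; no)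
  open import Defs as D using (ℝ; ℝ^; seq; cauchy; 0ℝ; 1ℝ; _!_; Q; Graph; fromℕ; 𝒩; 𝒰; log[_]; LimInf)

  private
    root : ∀ e {b} → 1ℚ ≤ b → ∃ λ n → ι (suc n ℕ.^ suc e) ≤ b × b < ι (2+ n ℕ.^ suc e)
    root e {b} 1≤b = let M , b≤M = archimedean b in search M (≤-<-trans b≤M (ι-mono-< (M< M)))
      where
      M< : ∀ M → M ℕ.< 2+ M ℕ.^ suc e
      M< M = ℕ.≤-trans (ℕ.n≤1+n (suc M)) (ℕ.m≤m*n (2+ M) (2+ M ℕ.^ e) {{ℕ.m^n≢0 (2+ M) e}})

      search : ∀ M → b < ι (2+ M ℕ.^ suc e) → ∃ λ n → ι (suc n ℕ.^ suc e) ≤ b × b < ι (2+ n ℕ.^ suc e)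
      search zero    b< = 0 , ≤-trans (≤-reflexive (trans (cong ι (ℕ.^-zeroˡ (suc e))) ι-1)) 1≤b , b<
      search (suc M) b< with ι (2+ M ℕ.^ suc e) ≤? b
      ... | yes ≤b = suc M , ≤b , b<
      ... | no  ≰b = search M (≰⇒> ≰b)

    -- With c = 2 (n + 1), both (n + 2)^E and 2 are at most c^E, and 2 c^E ≤ (2c)^E. The summand 2
    -- leaves room for the fluctuation of the terms of τ in `base`.
    root-gap-ℕ : ∀ n e → 2+ n ℕ.^ suc e ℕ.+ 2 ℕ.≤ (4 ℕ.* suc n) ℕ.^ suc e
    root-gap-ℕ n e = begin
      2+ n ℕ.^ suc e ℕ.+ 2              ≤⟨ ℕ.+-mono-≤ (ℕ.^-monoˡ-≤ (suc e) (n+2≤c n)) (ℕ.≤-trans (2≤c n) (ℕ.m≤m*n c (c ℕ.^ e) {{ℕ.m^n≢0 c e}})) ⟩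
      c ℕ.^ suc e ℕ.+ c ℕ.^ suc e       ≡⟨ cong (c ℕ.^ suc e ℕ.+_) (ℕ.+-identityʳ (c ℕ.^ suc e)) ⟨
      2 ℕ.* c ℕ.^ suc e                 ≤⟨ ℕ.*-monoˡ-≤ (c ℕ.^ suc e) (ℕ.m≤m*n 2 (2 ℕ.^ e) {{ℕ.m^n≢0 2 e}}) ⟩
      2 ℕ.^ suc e ℕ.* c ℕ.^ suc e       ≡⟨ ^-distribʳ-* 2 c (suc e) ⟨
      (2 ℕ.* c) ℕ.^ suc e               ≡⟨ cong (ℕ._^ suc e) (ℕ.*-assoc 2 2 (suc n)) ⟨
      (4 ℕ.* suc n) ℕ.^ suc e           ∎
      where
      open ℕ.≤-Reasoning
      c : ℕ
      c = 2 ℕ.* suc n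

      2≤c : ∀ n → 2 ℕ.≤ 2 ℕ.* suc n
      2≤c n = ℕ.*-monoʳ-≤ 2 {1} {suc n} (s≤s z≤n)

      eq : ∀ n → 2 ℕ.+ n ℕ.+ n ≡ 2 ℕ.* suc n
      eq = solve-∀

      n+2≤c : ∀ n → 2+ n ℕ.≤ 2 ℕ.* suc n
      n+2≤c n = ℕ.≤-trans (ℕ.m≤m+n (2+ n) n) (ℕ.≤-reflexive (eq n))

    Base : ℕ → ℕ → ℚ → Set
    Base e n t = ι (suc n ℕ.^ suc e) ≤ t × t ≤ ι ((4 ℕ.* suc n) ℕ.^ suc e)

    -- The integer root is taken of t₀ - 1 for one late term t₀, so that all later terms, which
    -- differ from t₀ by less than 1, stay above (n + 1)^E. The bound 3 ensures t₀ - 1 ≥ 1.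
    base : ∀ τ e → Eventually (λ k → ι 3 ≤ seq τ k) → ∃ λ n → Eventually λ k → Base e n (seq τ k)
    base τ e (N , 3≤t) = n , k₀ , λ k k₀≤k → let close = proj₂ (cauchy τ 1ℚ 0<1) k k₀ (ℕ.≤-trans N₁≤k₀ k₀≤k) N₁≤k₀ in
        lower (seq τ k) close , upper (seq τ k) close
      where
      N₁ k₀ : ℕ
      N₁ = proj₁ (cauchy τ 1ℚ 0<1)
      k₀ = N ℕ.⊔ N₁

      N₁≤k₀ : N₁ ℕ.≤ k₀
      N₁≤k₀ = ℕ.m≤n⊔m N N₁

      t₀ : ℚ
      t₀ = seq τ k₀

      open +-*-Solver
      ι3 : ι 3 ≡ 1ℚ + (1ℚ + 1ℚ)
      ι3 = trans (ι-suc 2) (cong (_+_ 1ℚ) (trans (ι-suc 1) (cong (_+_ 1ℚ) ι-1)))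

      1≤t₀-1 : 1ℚ ≤ t₀ - 1ℚ
      1≤t₀-1 = by (+-mono-≤ (subst (_≤ t₀) ι3 (3≤t k₀ (ℕ.m≤m⊔n N N₁))) (<⇒≤ 0<1))
        (solve 1 (λ t → con 1ℚ :+ (t :+ con 1ℚ) := (t :- con 1ℚ) :+ (con 1ℚ :+ (con 1ℚ :+ con 1ℚ) :+ con 0ℚ)) refl t₀)

      rt = root e {t₀ - 1ℚ} 1≤t₀-1
      n = proj₁ rt

      lower : ∀ t → ∣ t - t₀ ∣ < 1ℚ → ι (suc n ℕ.^ suc e) ≤ t
      lower t close = ≤-trans (proj₁ (proj₂ rt)) (by (≤-trans (x≤∣x∣ (- (t - t₀))) (≤-trans (≤-reflexive (∣-p∣≡∣p∣ (t - t₀))) (<⇒≤ close)))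
        (solve 2 (λ t t₀ → t₀ :- con 1ℚ :+ con 1ℚ := t :+ (:- (t :- t₀))) refl t t₀))

      upper : ∀ t → ∣ t - t₀ ∣ < 1ℚ → t ≤ ι ((4 ℕ.* suc n) ℕ.^ suc e)
      upper t close = ≤-trans (by (+-mono-≤ (≤-trans (x≤∣x∣ (t - t₀)) (<⇒≤ close)) (<⇒≤ (proj₂ (proj₂ rt))))
          (solve 3 (λ t t₀ x → t :+ (con 1ℚ :+ x) := (x :+ (con 1ℚ :+ con 1ℚ)) :+ ((t :- t₀) :+ (t₀ :- con 1ℚ))) refl t t₀ (ι (2+ n ℕ.^ suc e))))
        (subst (_≤ ι ((4 ℕ.* suc n) ℕ.^ suc e)) (trans (ι-+ (2+ n ℕ.^ suc e) 2) (cong (_+_ (ι (2+ n ℕ.^ suc e))) (trans (ι-suc 1) (cong (_+_ 1ℚ) ι-1))))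
          (ι-mono-≤ (root-gap-ℕ n e)))

    ^-swap : ∀ x a b → (x ℕ.^ a) ℕ.^ b ≡ (x ℕ.^ b) ℕ.^ a
    ^-swap x a b = trans (ℕ.^-*-assoc x a b) (trans (cong (x ℕ.^_) (ℕ.*-comm a b)) (sym (ℕ.^-*-assoc x b a)))

    module _ {t : ℚ} (1<t : 1ℚ < t) (E n P V C a s : ℕ) (lo : t ↑ a ≤ ι V ↑ s) (hi : ι V ↑ s ≤ t ↑ suc a)
      (n^E≤t : ι (n ℕ.^ E) ≤ t) (t≤[4n]^E : t ≤ ι ((4 ℕ.* n) ℕ.^ E))
      (n^P≤V : n ℕ.^ P ℕ.≤ V) (V≤ : V ℕ.≤ C ℕ.* n ℕ.^ P) where
      private
        0≤t : 0ℚ ≤ t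
        0≤t = <⇒≤ (<-trans 0<1 1<t)

      open ≤-Reasoning

      -- Says that E log_t V is at most P + 1, multiplied by s: the E-th power of the constant C is
      -- worth at most one factor t.
      count-upper : ι (C ℕ.^ E) ≤ t → a ℕ.* E ℕ.≤ s ℕ.+ P ℕ.* s
      count-upper C^E≤t = ↑-cancel-≤ 1<t (begin
        t ↑ (a ℕ.* E)                                        ≡⟨ ↑-assocʳ t a E ⟨
        (t ↑ a) ↑ E                                          ≤⟨ ↑-monoˡ-≤ (0≤↑ 0≤t a) lo E ⟩
        (ι V ↑ s) ↑ E                                        ≡⟨ trans (ι-^ (V ℕ.^ s) E) (cong (_↑ E) (ι-^ V s)) ⟨
        ι ((V ℕ.^ s) ℕ.^ E)                                  ≤⟨ ι-mono-≤ (ℕ.^-monoˡ-≤ E (ℕ.^-monoˡ-≤ s V≤)) ⟩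
        ι (((C ℕ.* n ℕ.^ P) ℕ.^ s) ℕ.^ E)                    ≡⟨ cong ι power ⟩
        ι ((C ℕ.^ E) ℕ.^ s ℕ.* (n ℕ.^ E) ℕ.^ (P ℕ.* s))      ≡⟨ trans (ι-* ((C ℕ.^ E) ℕ.^ s) ((n ℕ.^ E) ℕ.^ (P ℕ.* s))) (cong₂ _*_ (ι-^ (C ℕ.^ E) s) (ι-^ (n ℕ.^ E) (P ℕ.* s))) ⟩
        ι (C ℕ.^ E) ↑ s * ι (n ℕ.^ E) ↑ (P ℕ.* s)            ≤⟨ *-mono-≤ (0≤↑ (0≤ι (n ℕ.^ E)) (P ℕ.* s)) (0≤↑ 0≤t s)
                                                                  (↑-monoˡ-≤ (0≤ι (C ℕ.^ E)) C^E≤t s) (↑-monoˡ-≤ (0≤ι (n ℕ.^ E)) n^E≤t (P ℕ.* s)) ⟩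
        t ↑ s * t ↑ (P ℕ.* s)                                ≡⟨ ↑-homo-* t s (P ℕ.* s) ⟨
        t ↑ (s ℕ.+ P ℕ.* s)                                  ∎)
        where
        power : ((C ℕ.* n ℕ.^ P) ℕ.^ s) ℕ.^ E ≡ (C ℕ.^ E) ℕ.^ s ℕ.* (n ℕ.^ E) ℕ.^ (P ℕ.* s)
        power = trans (^-swap (C ℕ.* n ℕ.^ P) s E) (trans (cong (ℕ._^ s) (^-distribʳ-* C (n ℕ.^ P) E))
          (trans (^-distribʳ-* (C ℕ.^ E) ((n ℕ.^ P) ℕ.^ E) s) (cong ((C ℕ.^ E) ℕ.^ s ℕ.*_)
            (trans (cong (ℕ._^ s) (^-swap n P E)) (ℕ.^-*-assoc (n ℕ.^ E) P s)))))

      -- The matching lower bound; the factor 4 in t ≤ (4n)^E accumulates to 4^(EP), again at most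
      -- one factor t.
      count-lower : ι (4 ℕ.^ (E ℕ.* P)) ≤ t → P ℕ.* s ℕ.≤ s ℕ.+ suc a ℕ.* E
      count-lower 4^EP≤t = ↑-cancel-≤ 1<t (begin
        t ↑ (P ℕ.* s)                                        ≤⟨ ↑-monoˡ-≤ 0≤t t≤[4n]^E (P ℕ.* s) ⟩
        ι ((4 ℕ.* n) ℕ.^ E) ↑ (P ℕ.* s)                      ≡⟨ ι-^ ((4 ℕ.* n) ℕ.^ E) (P ℕ.* s) ⟨
        ι (((4 ℕ.* n) ℕ.^ E) ℕ.^ (P ℕ.* s))                  ≡⟨ cong ι power ⟩
        ι ((4 ℕ.^ (E ℕ.* P)) ℕ.^ s ℕ.* ((n ℕ.^ P) ℕ.^ s) ℕ.^ E)
          ≤⟨ ι-mono-≤ (ℕ.*-monoʳ-≤ ((4 ℕ.^ (E ℕ.* P)) ℕ.^ s) (ℕ.^-monoˡ-≤ E (ℕ.^-monoˡ-≤ s n^P≤V))) ⟩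
        ι ((4 ℕ.^ (E ℕ.* P)) ℕ.^ s ℕ.* (V ℕ.^ s) ℕ.^ E)      ≡⟨ trans (ι-* ((4 ℕ.^ (E ℕ.* P)) ℕ.^ s) ((V ℕ.^ s) ℕ.^ E))
                                                                  (cong₂ _*_ (ι-^ (4 ℕ.^ (E ℕ.* P)) s) (trans (ι-^ (V ℕ.^ s) E) (cong (_↑ E) (ι-^ V s)))) ⟩
        ι (4 ℕ.^ (E ℕ.* P)) ↑ s * (ι V ↑ s) ↑ E              ≤⟨ *-mono-≤ (0≤↑ (0≤↑ (0≤ι V) s) E) (0≤↑ 0≤t s)
                                                                  (↑-monoˡ-≤ (0≤ι (4 ℕ.^ (E ℕ.* P))) 4^EP≤t s) (↑-monoˡ-≤ (0≤↑ (0≤ι V) s) hi E) ⟩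
        t ↑ s * (t ↑ suc a) ↑ E                              ≡⟨ trans (↑-homo-* t s (suc a ℕ.* E)) (cong (t ↑ s *_) (sym (↑-assocʳ t (suc a) E))) ⟨
        t ↑ (s ℕ.+ suc a ℕ.* E)                              ∎)
        where
        power : ((4 ℕ.* n) ℕ.^ E) ℕ.^ (P ℕ.* s) ≡ (4 ℕ.^ (E ℕ.* P)) ℕ.^ s ℕ.* ((n ℕ.^ P) ℕ.^ s) ℕ.^ E
        power = trans (sym (ℕ.^-*-assoc ((4 ℕ.* n) ℕ.^ E) P s)) (trans (cong (ℕ._^ s) (trans (cong (ℕ._^ P) (^-distribʳ-* 4 n E))
          (trans (^-distribʳ-* (4 ℕ.^ E) (n ℕ.^ E) P) (cong₂ ℕ._*_ (ℕ.^-*-assoc 4 E P) (^-swap n E P)))))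
          (trans (^-distribʳ-* (4 ℕ.^ (E ℕ.* P)) ((n ℕ.^ P) ℕ.^ E) s) (cong ((4 ℕ.^ (E ℕ.* P)) ℕ.^ s ℕ.*_) (^-swap (n ℕ.^ P) E s))))

    scaled-upper : ∀ x k E P → x * ι (suc k) * E ≤ ι (suc k) + P * ι (suc k) → x * E ≤ 1ℚ + P
    scaled-upper x k E P h = *-cancelˡ-≤ (0<ι k) (by h (solve 4 (λ x s E P →
        s :* (x :* E) :+ (s :+ P :* s) := s :* (con 1ℚ :+ P) :+ x :* s :* E) refl x (ι (suc k)) E P))
      where open +-*-Solver

    -- The second unit pays for the `suc` in the exponent `suc a`, which is worth E / (k + 1) ≤ 1.
    scaled-lower : ∀ x k E P → P * ι (suc k) ≤ ι (suc k) + (1ℚ + x * ι (suc k)) * E → E ≤ ι (suc k) → P ≤ 1ℚ + 1ℚ + x * E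
    scaled-lower x k E P h r = *-cancelˡ-≤ (0<ι k) (by (+-mono-≤ h r) (solve 4 (λ x s E P →
        s :* P :+ (s :+ (con 1ℚ :+ x :* s) :* E :+ s) := s :* (con 1ℚ :+ con 1ℚ :+ x :* E) :+ (P :* s :+ E)) refl x (ι (suc k)) E P))
      where open +-*-Solver

    -- Scaled by Q, the logarithm is off by at most 1 and the rounding by 2 + R. One further unit
    -- provides the gap `i` that strict inequality of reals requires, giving 4 + R in all. Q + Q
    -- appears because the realised exponents are doubled.
    total-error : ∀ Q p x y R i ε → 0ℚ < Q → Q * i ≡ 1ℚ → 0ℚ ≤ R → x * (Q + Q) ≤ 1ℚ + (p + p) → p + p ≤ 1ℚ + 1ℚ + x * (Q + Q) →
      Q * y ≤ p + (1ℚ + 1ℚ) → p ≤ Q * y + (1ℚ + 1ℚ) + R → (1ℚ + 1ℚ) + (1ℚ + 1ℚ) + R ≤ Q * ε → ∣ x - y ∣ + i ≤ ε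
    total-error Q p x y R i ε 0<Q Qi≡1 0≤R h₁ h₂ h₃ h₄ h₅ with ∣p∣≡p∨∣p∣≡-p (x - y)
    ... | inj₁ e rewrite e = *-cancelˡ-≤ 0<Q (*-cancelˡ-≤ 0<2
        (by (+-mono-≤ (+-mono-≤ (+-mono-≤ h₁ (+-mono-≤ h₄ h₄)) (+-mono-≤ (≤-reflexive Qi≡1) (≤-reflexive Qi≡1))) (+-mono-≤ (+-mono-≤ h₅ h₅) (<⇒≤ 0<1)))
          (solve 7 (λ Q p x y R i ε → let two = con 1ℚ :+ con 1ℚ in
            two :* (Q :* ((x :- y) :+ i)) :+ (con 1ℚ :+ (p :+ p) :+ ((Q :* y :+ two :+ R) :+ (Q :* y :+ two :+ R)) :+ (con 1ℚ :+ con 1ℚ) :+ (Q :* ε :+ Q :* ε :+ con 1ℚ))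
            := two :* (Q :* ε) :+ (x :* (Q :+ Q) :+ (p :+ p) :+ (Q :* i :+ Q :* i) :+ (two :+ two :+ R :+ (two :+ two :+ R) :+ con 0ℚ)))
            refl Q p x y R i ε)))
      where
      open +-*-Solver
      0<2 : 0ℚ < 1ℚ + 1ℚ
      0<2 = +-mono-< 0<1 0<1
    ... | inj₂ e rewrite e = *-cancelˡ-≤ 0<Q (*-cancelˡ-≤ 0<2
        (by (+-mono-≤ (+-mono-≤ (+-mono-≤ h₂ (+-mono-≤ h₃ h₃)) (+-mono-≤ (≤-reflexive Qi≡1) (≤-reflexive Qi≡1))) (+-mono-≤ (+-mono-≤ h₅ h₅) (+-mono-≤ 0≤R 0≤R)))
          (solve 7 (λ Q p x y R i ε → let two = con 1ℚ :+ con 1ℚ in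
            two :* (Q :* ((:- (x :- y)) :+ i)) :+ (two :+ x :* (Q :+ Q) :+ ((p :+ two) :+ (p :+ two)) :+ (con 1ℚ :+ con 1ℚ) :+ (Q :* ε :+ Q :* ε :+ (R :+ R)))
            := two :* (Q :* ε) :+ (p :+ p :+ (Q :* y :+ Q :* y) :+ (Q :* i :+ Q :* i) :+ (two :+ two :+ R :+ (two :+ two :+ R) :+ (con 0ℚ :+ con 0ℚ))))
            refl Q p x y R i ε)))
      where
      open +-*-Solver
      0<2 : 0ℚ < 1ℚ + 1ℚ
      0<2 = +-mono-< 0<1 0<1

    double : ∀ n → ι (2 ℕ.* n) ≡ ι n + ι n
    double n = trans (ι-+ n (n ℕ.+ 0)) (cong (λ m → ι n + ι m) (ℕ.+-identityʳ n))

    -- `Base` takes the predecessor of the exponent: the successor of q + (suc q + 0) is 2 * suc q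
    -- by computation.
    error : ∀ {q p C n V k a} t x y R ε → 1ℚ < t → x * ι (suc k) ≡ ι a → t ↑ a ≤ ι V ↑ suc k → ι V ↑ suc k ≤ t ↑ suc a →
      Base (q ℕ.+ (suc q ℕ.+ 0)) n t → suc n ℕ.^ (2 ℕ.* p) ℕ.≤ V → V ℕ.≤ C ℕ.* suc n ℕ.^ (2 ℕ.* p) →
      ι (C ℕ.^ (2 ℕ.* suc q)) ≤ t → ι (4 ℕ.^ (2 ℕ.* suc q ℕ.* (2 ℕ.* p))) ≤ t → 2 ℕ.* suc q ℕ.≤ k →
      0ℚ ≤ R → ι (suc q) * y ≤ ι p + (1ℚ + 1ℚ) → ι p ≤ ι (suc q) * y + (1ℚ + 1ℚ) + R →
      (1ℚ + 1ℚ) + (1ℚ + 1ℚ) + R ≤ ι (suc q) * ε → ∣ x - y ∣ + inv q ≤ ε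
    error {q} {p} {C} {n} {V} {k} {a} t x y R ε 1<t x≡ lo hi (n^E≤t , t≤) P≤V V≤ C^E≤t 4^EP≤t E≤k 0≤R h₃ h₄ h₅ =
      total-error (ι (suc q)) (ι p) x y R (inv q) ε (0<ι q) (q*inv≡1 q) 0≤R
        (subst₂ (λ E P → x * E ≤ 1ℚ + P) (double (suc q)) (double p) (scaled-upper x k (ι E) (ι P)
          (subst₂ _≤_ (trans (ι-* a E) (cong (_* ι E) (sym x≡))) (trans (ι-+ (suc k) (P ℕ.* suc k)) (cong (_+_ (ι (suc k))) (ι-* P (suc k))))
            (ι-mono-≤ (count-upper 1<t E (suc n) P V C a (suc k) lo hi n^E≤t t≤ P≤V V≤ C^E≤t)))))
        (subst₂ (λ E P → P ≤ 1ℚ + 1ℚ + x * E) (double (suc q)) (double p) (scaled-lower x k (ι E) (ι P)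
          (subst₂ _≤_ (ι-* P (suc k)) (trans (ι-+ (suc k) (suc a ℕ.* E)) (cong (_+_ (ι (suc k)))
              (trans (ι-* (suc a) E) (cong (_* ι E) (trans (ι-suc a) (cong (_+_ 1ℚ) (sym x≡)))))))
            (ι-mono-≤ (count-lower 1<t E (suc n) P V C a (suc k) lo hi n^E≤t t≤ P≤V V≤ 4^EP≤t)))
          (ι-mono-≤ (ℕ.m≤n⇒m≤1+n E≤k))))
        h₃ h₄ h₅
      where
      E P : ℕ
      E = 2 ℕ.* suc q
      P = 2 ℕ.* p

    ≃-refl : ∀ x → x D.≃ x
    ≃-refl x = x≤x , x≤x
      where
      x≤x : x D.≤ x
      x≤x ε 0<ε = 0 , λ n _ → subst (_≤ seq x n + ε) (+-identityʳ (seq x n)) (+-monoʳ-≤ (seq x n) (<⇒≤ 0<ε))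

    0<fromℕ : ∀ {n} → 1 ℕ.≤ n → 0ℝ D.< fromℕ n
    0<fromℕ {n} 1≤n = 1ℚ , 0<1 , 0 , λ _ _ → subst₂ _≤_ (sym (+-identityˡ 1ℚ)) (ι-def n) (subst (_≤ ι n) ι-1 (ι-mono-≤ 1≤n))

  -- The order of choices matters: ε determines q, hence the integral point and the constant C,
  -- hence the threshold for τ; only then does τ determine n and with it the graph.
  Q⊆LimInf : ∀ {K} → 2 ℕ.≤ K → ∀ {y} → Q (2+ K) y → LimInf (λ τ → log[ τ ] (𝒩 (𝒰 (2+ K)))) y
  Q⊆LimInf {K} 2≤K {y} y∈Q ε (ε₀ , 0<ε₀ , ε₀≤ε) = fromℕ (suc big) , close
    where
    q E C : ℕ
    q = proj₁ (large-denominator 0<ε₀ (4 ℕ.+ radius K))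
    E = 2 ℕ.* suc q

    open Rounding 2≤K y∈Q q

    realised = realise point-QNat
    C = proj₁ realised

    4^EP : Fin (suc (2+ K)) → ℕ
    4^EP i = 4 ℕ.^ (E ℕ.* (2 ℕ.* point (toℕ i)))

    big : ℕ
    -- The 3 is for `base`, C^E for `count-upper`, and the sum dominates the 4^(EP) of every
    -- coordinate for `count-lower`.
    big = 3 ℕ.+ (C ℕ.^ E ℕ.+ ∑ 4^EP)

    Qε₀ : (1ℚ + 1ℚ) + (1ℚ + 1ℚ) + ι (radius K) ≤ ι (suc q) * ε₀
    Qε₀ = subst (_≤ ι (suc q) * ε₀) (trans (ι-+ 4 (radius K)) (cong (_+ ι (radius K)) (trans (ι-+ 2 2) (cong₂ _+_ ι2 ι2))))
        (proj₂ (large-denominator 0<ε₀ (4 ℕ.+ radius K)))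
      where
      ι2 : ι 2 ≡ 1ℚ + 1ℚ
      ι2 = trans (ι-suc 1) (cong (_+_ 1ℚ) ι-1)

    module _ (τ : ℝ) (1<τ : 1ℝ D.< τ) (T≤τ : fromℕ (suc big) D.≤ τ) where
      private
        Large : ℚ → Set
        Large t = 1ℚ < t × ι big ≤ t

        large : Eventually λ k → Large (seq τ k)
        large = ev-map₂ {P″ = λ k → Large (seq τ k)}
          (λ k p r → <-≤-trans (subst (_< 1ℚ + proj₁ 1<τ) (+-identityʳ 1ℚ) (+-monoʳ-< 1ℚ (proj₁ (proj₂ 1<τ)))) p
            , +-cancelˡ (ι big) (seq τ k) (subst (_≤ seq τ k + 1ℚ) (trans (sym (ι-def (suc big))) (ι-suc big)) r))
          (proj₂ (proj₂ 1<τ)) (T≤τ 1ℚ 0<1)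
          where
          +-cancelˡ : ∀ a b → 1ℚ + a ≤ b + 1ℚ → a ≤ b
          +-cancelˡ a b p = by p (solve 2 (λ a b → a :+ (b :+ con 1ℚ) := b :+ (con 1ℚ :+ a)) refl a b)
            where open +-*-Solver

        based : ∃ λ n → Eventually λ k → Base (q ℕ.+ (suc q ℕ.+ 0)) n (seq τ k)
        based = base τ (q ℕ.+ (suc q ℕ.+ 0)) (ev-map {λ k → Large (seq τ k)} {λ k → ι 3 ≤ seq τ k}
          (λ k → λ (_ , big≤t) → ≤-trans (ι-mono-≤ (ℕ.m≤m+n 3 (C ℕ.^ E ℕ.+ ∑ 4^EP))) big≤t) large)

        n : ℕ
        n = proj₁ based

        G : Graph
        G = proj₁ (proj₂ realised (suc n))

        open Realises (proj₂ (proj₂ realised (suc n)))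

        homs-bounds : ∀ l → l ℕ.≤ 2+ K →
          suc n ℕ.^ (2 ℕ.* point l) ℕ.≤ homs G l × homs G l ℕ.≤ C ℕ.* suc n ℕ.^ (2 ℕ.* point l)
        homs-bounds zero    _  = ≤order , order≤
        homs-bounds (suc l) l≤ = ≤M l (ℕ.≤-pred l≤) , M≤ l (ℕ.≤-pred l≤)

        V : Fin (suc (2+ K)) → ℕ
        V i = D.hom (𝒰 (2+ K) i) G

        i≤ : ∀ (i : Fin (suc (2+ K))) → toℕ i ℕ.≤ 2+ K
        i≤ i = ℕ.≤-pred (toℕ<n i)

        V-lower : ∀ i → suc n ℕ.^ (2 ℕ.* point (toℕ i)) ℕ.≤ V i
        V-lower i = subst (suc n ℕ.^ (2 ℕ.* point (toℕ i)) ℕ.≤_) (homs≡hom (2+ K) G i) (proj₁ (homs-bounds (toℕ i) (i≤ i)))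

        V-upper : ∀ i → V i ℕ.≤ C ℕ.* suc n ℕ.^ (2 ℕ.* point (toℕ i))
        V-upper i = subst (ℕ._≤ C ℕ.* suc n ℕ.^ (2 ℕ.* point (toℕ i))) (homs≡hom (2+ K) G i) (proj₂ (homs-bounds (toℕ i) (i≤ i)))

        1≤V : ∀ i → 1 ℕ.≤ V i
        1≤V i = ℕ.≤-trans (ℕ.m^n>0 (suc n) (2 ℕ.* point (toℕ i))) (V-lower i)

        x : ℝ^ (suc (2+ K))
        x i = Log.log τ 1<τ (V i) (1≤V i)

        y!toℕ : ∀ i → y ! toℕ i ≡ y i
        y!toℕ i = trans (!-fromℕ< y (toℕ<n i)) (cong y (fromℕ<-toℕ i (toℕ<n i)))

        near : ∀ i → Eventually λ k → Near (toℕ i) (seq (y i) k)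
        near i = subst (λ z → Eventually λ k → Near (toℕ i) (seq z k)) (y!toℕ i) (point-near (toℕ i) (i≤ i))

        Bracket : Fin (suc (2+ K)) → ℕ → Set
        Bracket i k = ∃ λ a → seq (x i) k * ι (suc k) ≡ ι a × seq τ k ↑ a ≤ ι (V i) ↑ suc k × ι (V i) ↑ suc k ≤ seq τ k ↑ suc a

        Facts : Fin (suc (2+ K)) → ℕ → Set
        Facts i k = (Large (seq τ k) × Base (q ℕ.+ (suc q ℕ.+ 0)) n (seq τ k)) × (Bracket i k × Near (toℕ i) (seq (y i) k)) × 2 ℕ.* suc q ℕ.≤ k

        facts : ∀ i → Eventually (Facts i)
        facts i = ev-× {λ k → Large (seq τ k) × Base (q ℕ.+ (suc q ℕ.+ 0)) n (seq τ k)}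
          (ev-× {λ k → Large (seq τ k)} {λ k → Base (q ℕ.+ (suc q ℕ.+ 0)) n (seq τ k)} large (proj₂ based))
          (ev-× {λ k → Bracket i k × Near (toℕ i) (seq (y i) k)} {2 ℕ.* suc q ℕ.≤_}
            (ev-× {Bracket i} {λ k → Near (toℕ i) (seq (y i) k)} (Log.log-bracket τ 1<τ (V i) (1≤V i)) (near i))
            (ev-≥ (2 ℕ.* suc q)))

        bound : ∀ i k → Facts i k → ∣ seq (x i) k - seq (y i) k ∣ + inv q ≤ ε₀
        bound i k (((1<t , big≤t) , bs) , ((a , x≡ , lo , hi) , (h₃ , h₄)) , E≤k) =
          error {q} {point (toℕ i)} {C} {n} {V i} {k} {a} (seq τ k) (seq (x i) k) (seq (y i) k) (ι (radius K)) ε₀ 1<t x≡ lo hi bs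
            (V-lower i) (V-upper i)
            (≤-trans (ι-mono-≤ (ℕ.≤-trans (ℕ.m≤m+n (C ℕ.^ E) (∑ 4^EP)) (ℕ.m≤n+m _ 3))) big≤t)
            (≤-trans (ι-mono-≤ (ℕ.≤-trans (term≤∑ 4^EP i) (ℕ.≤-trans (ℕ.m≤n+m (∑ 4^EP) (C ℕ.^ E)) (ℕ.m≤n+m _ 3)))) big≤t)
            E≤k (0≤ι (radius K)) h₃ h₄ Qε₀

      close : ∃ λ x → log[ τ ] (𝒩 (𝒰 (2+ K))) x × D.Within ε x y
      close = x , ((λ i → fromℕ (V i)) , (G , λ i → ≃-refl (fromℕ (V i))) , (λ i → 0<fromℕ (1≤V i)) , λ i → Log.log-isLog τ 1<τ (V i) (1≤V i))
        , λ i → inv q , 0<inv q , ev-map₂ {Facts i} {λ k → 0ℚ + ε₀ ≤ seq ε k} {λ k → ∣ seq (x i) k - seq (y i) k ∣ + inv q ≤ seq ε k}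
            (λ k f ε₀≤ → ≤-trans (bound i k f) (≤-trans (≤-reflexive (sym (+-identityˡ ε₀))) ε₀≤)) (facts i) ε₀≤ε

open import Data.Nat.Base using (ℕ; _≤_; s≤s)
open import Data.Product.Base using (_,_)
open import Defs using (trop_≐_; 𝒩; 𝒰; Q)

theorem1p2 : ∀ (m : ℕ) → 4 ≤ m → trop (𝒩 (𝒰 m)) ≐ Q m
-- With m = K + 2, the hypothesis 4 ≤ m becomes 2 ≤ K.
theorem1p2 _ (s≤s (s≤s 2≤K)) = LimitPoints.Q⊆LimInf 2≤K , Necessity.LimSup⊆Q 2≤K
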